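{- Let $f=\sum_{\alpha\in\Lambda(f)}c_{\alpha}\mathbf{x}^{\alpha}-\sum_{\beta\in\Gamma(f)}d_{\beta}\mathbf{x}^{\beta}\in\mathbb{R}[x_1,\ldots,x_n]$. If $f\in\mathrm{SONC}$, then $f$ is a sum of nonnegative circuit polynomials with the same support.
   Context: Notation. $\mathbf{x}^{\alpha}=x_1^{\alpha_1}\cdots x_n^{\alpha_n}$ for $\alpha\in\mathbb{N}^n$, where $0\in\mathbb{N}$. For $f=\sum_\alpha f_\alpha \mathbf{x}^\alpha\in\mathbb{R}[x_1,\ldots,x_n]$, $\mathrm{supp}(f)=\{\alpha: f_\alpha\neq 0\}$. For a polytope $P$, $V(P)$ is its vertex set and $P^\circ$ is its interior; for a simplex, $P^\circ$ is the set of convex combinations of its vertices with all coefficients positive. A polynomial is nonnegative if it is $\ge 0$ on all of $\mathbb{R}^n$. Put $\Lambda(f)=\{\alpha\in\mathrm{supp}(f): \alpha\in(2\mathbb{N})^n \text{ and } f_\alpha>0\}$ and $\Gamma(f)=\mathrm{supp}(f)\setminus\Lambda(f)$. One writes $f=\sum_{\alpha\in\Lambda(f)}c_{\alpha}\mathbf{x}^{\alpha}-\sum_{\beta\in\Gamma(f)}d_{\beta}\mathbf{x}^{\beta}$ with $c_\alpha=f_\alpha>0$ and $d_\beta=-f_\beta$. A trellis is a set $\mathscr{A}\subseteq(2\mathbb{N})^n$ consisting of the vertices of a simplex. A circuit polynomial is a polynomial of the form $\sum_{\alpha\in\mathscr{A}}c_\alpha\mathbf{x}^\alpha-d\,\mathbf{x}^\beta$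 with $\mathscr{A}$ a trellis, $c_\alpha>0$ for all $\alpha\in\mathscr A$, $d\in\mathbb{R}$, and $\beta\in\mathbb{N}^n\cap\mathrm{conv}(\mathscr{A})^\circ$. SONC denotes the class of polynomials that can be written as sums of nonnegative circuit polynomials. For $\beta\in\Gamma(f)$, let $\Delta(\beta)$ be the set of all simplices $\Delta$ with $\beta\in\Delta^\circ$ and $V(\Delta)\subseteq\Lambda(f)$. One says that $f$ is a sum of nonnegative circuit polynomials with the same support if one can write $$f=\sum_{\beta\in\Gamma(f)}\ \sum_{\Delta\in\Delta(\beta)}\Big(\sum_{\alpha\in V(\Delta)}c_{\beta\Delta\alpha}\mathbf{x}^{\alpha}-d_{\beta\Delta}\mathbf{x}^{\beta}\Big)$$ such that every $\sum_{\alpha\in V(\Delta)}c_{\beta\Delta\alpha}\mathbf{x}^{\alpha}-d_{\beta\Delta}\mathbf{x}^{\beta}$ is a nonnegative circuit polynomial.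
   Formalization: The sum is taken up to added terms e·x^α with e > 0, α in Λ(f): without them the claim fails, e.g. f = 1 + x² is in SONC but Γ(f) is empty, so the double sum is 0. Summands for some pairs (β, Δ) may be the zero polynomial, which counts as a circuit polynomial. -}

module Defs where

open import Algebra.Bundles using (CommutativeRing; Semiring)
import Algebra.Definitions.RawSemiring as RawSemiringDefs
open import Data.Fin.Base using (Fin)
open import Data.List.Base using (List; []; _∷_; _++_; [_]; foldr; map; concat; tabulate)
open import Data.List.Relation.Unary.All using (All)
open import Data.List.Relation.Unary.AllPairs using (AllPairs)
open import Data.List.Relation.Unary.Any using (Any)
open import Data.Nat.Base using (ℕ; suc)
open import Data.Nat.Divisibility using (_∣_)
import Data.Nat.Properties as ℕ
open import Data.Product.Base using (Σ-syntax; ∃-syntax; _×_; _,_)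
open import Data.Vec.Base using (Vec; lookup)
open import Data.Vec.Functional using (Vector)
open import Data.Vec.Properties using (≡-dec)
import Data.Vec.Relation.Unary.All as Vec
open import Function.Bundles using (_⇔_)
open import Level using (0ℓ)
open import Relation.Binary.Core using (Rel)
open import Relation.Binary.PropositionalEquality.Core using (_≡_)
open import Relation.Binary.Structures using (IsTotalOrder)
open import Relation.Nullary.Decidable.Core using (yes; no)
open import Relation.Nullary.Negation.Core using (¬_)
import Relation.Binary.Construct.NonStrictToStrict as Strict

-- The real numbers, characterised as a Dedekind-complete totally ordered
-- field.  Classically this determines ℝ up to unique isomorphism.

record RealNumbers : Set₁ where
  field
    commutativeRing : CommutativeRing 0ℓ 0ℓ

  open CommutativeRing commutativeRing public

  infix 4 _≤_
  field
    _≤_           : Rel Carrier 0ℓ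
    isTotalOrder  : IsTotalOrder _≈_ _≤_
    1≉0           : ¬ 1# ≈ 0#
    inverse       : ∀ x → ¬ x ≈ 0# → ∃[ y ] x * y ≈ 1#
    +-monoˡ-≤     : ∀ x y z → x ≤ y → x + z ≤ y + z
    *-nonNegative : ∀ x y → 0# ≤ x → 0# ≤ y → 0# ≤ x * y

  IsUpperBound : (Carrier → Set) → Carrier → Set
  IsUpperBound S u = ∀ x → S x → x ≤ u

  field
    supremum : ∀ (S : Carrier → Set) → ∃[ x ] S x → ∃[ u ] IsUpperBound S u →
               ∃[ s ] (IsUpperBound S s × (∀ u → IsUpperBound S u → s ≤ u))

  open Strict _≈_ _≤_ public using (_<_)
  open RawSemiringDefs (Semiring.rawSemiring semiring) public
    using (_^_; sum; product) renaming (_×_ to _·_)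

  fromℕ : ℕ → Carrier
  fromℕ m = m · 1#

Exponent : ℕ → Set
Exponent n = Vec ℕ n

IsEven : ∀ {n} → Exponent n → Set
IsEven = Vec.All (2 ∣_)

module _ (ℝ : RealNumbers) where
  open RealNumbers ℝ

  -- A polynomial is a formal sum of terms, possibly with repeated exponents;
  -- all notions below depend only on its coefficients, and equality of
  -- polynomials is _≋_.

  Polynomial : ℕ → Set
  Polynomial n = List (Carrier × Exponent n)

  coeff : ∀ {n} → Polynomial n → Exponent n → Carrier
  coeff []            α = 0#
  coeff ((a , γ) ∷ f) α with ≡-dec ℕ._≟_ γ α
  ... | yes _ = a + coeff f α
  ... | no  _ = coeff f α

  infix 4 _≋_
  _≋_ : ∀ {n} → Polynomial n → Polynomial n → Set
  f ≋ g = ∀ α → coeff f α ≈ coeff g α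

  monomial : ∀ {n} → Exponent n → Vector Carrier n → Carrier
  monomial α x = product (λ j → x j ^ lookup α j)

  eval : ∀ {n} → Polynomial n → Vector Carrier n → Carrier
  eval f x = foldr (λ (a , α) s → a * monomial α x + s) 0# f

  Nonnegative : ∀ {n} → Polynomial n → Set
  Nonnegative f = ∀ x → 0# ≤ eval f x

  sumPoly : ∀ {n} → List (Polynomial n) → Polynomial n
  sumPoly = concat

  Supp Λ Γ : ∀ {n} → Polynomial n → Exponent n → Set
  Supp f α = ¬ coeff f α ≈ 0#
  Λ    f α = Supp f α × IsEven α × 0# < coeff f α
  Γ    f α = Supp f α × ¬ Λ f α

  AffinelyIndependent : ∀ {n m} → Vector (Exponent n) m → Set
  AffinelyIndependent {n} {m} v =
    ∀ (μ : Vector Carrier m) → sum μ ≈ 0# →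
    (∀ (j : Fin n) → sum (λ i → μ i * fromℕ (lookup (v i) j)) ≈ 0#) →
    ∀ i → μ i ≈ 0#

  -- Only simplices with vertices in ℕⁿ occur; affine independence makes the
  -- listing of the vertices repetition-free.

  record Simplex (n : ℕ) : Set where
    field
      dim                 : ℕ
      vertex              : Vector (Exponent n) (suc dim)
      affinelyIndependent : AffinelyIndependent vertex

  open Simplex public

  infix 4 _∈V_ _∈°_ _≐_

  _∈V_ : ∀ {n} → Exponent n → Simplex n → Set
  α ∈V Δ = ∃[ i ] vertex Δ i ≡ α

  _∈°_ : ∀ {n} → Exponent n → Simplex n → Set
  _∈°_ {n} β Δ =
    Σ[ w ∈ Vector Carrier (suc (dim Δ)) ]
      ((∀ i → 0# < w i) × sum w ≈ 1# ×
       (∀ (j : Fin n) → sum (λ i → w i * fromℕ (lookup (vertex Δ i) j)) ≈ fromℕ (lookup β j)))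

  -- Equality of simplices: the order in which vertices are listed is irrelevant.
  _≐_ : ∀ {n} → Simplex n → Simplex n → Set
  Δ ≐ Δ′ = ∀ α → (α ∈V Δ) ⇔ (α ∈V Δ′)

  IsTrellis : ∀ {n} → Simplex n → Set
  IsTrellis Δ = ∀ i → IsEven (vertex Δ i)

  -- Σ_{α ∈ V(Δ)} c_α x^α − d x^β
  circuitForm : ∀ {n} (Δ : Simplex n) → Vector Carrier (suc (dim Δ)) →
                Exponent n → Carrier → Polynomial n
  circuitForm Δ c β d = tabulate (λ i → c i , vertex Δ i) ++ [ (- d , β) ]

  -- A trellis may be a single point α, and then β = α: hence every c x^α with α
  -- even and c ≥ 0 (including the zero polynomial, c x^α − c x^α) is a
  -- nonnegative circuit polynomial.
  IsCircuitPolynomial : ∀ {n} → Polynomial n → Set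
  IsCircuitPolynomial {n} p =
    Σ[ 𝒜 ∈ Simplex n ] Σ[ c ∈ Vector Carrier (suc (dim 𝒜)) ]
    Σ[ β ∈ Exponent n ] Σ[ d ∈ Carrier ]
      (IsTrellis 𝒜 × (∀ i → 0# < c i) × β ∈° 𝒜 × p ≋ circuitForm 𝒜 c β d)

  IsNonnegativeCircuit : ∀ {n} → Polynomial n → Set
  IsNonnegativeCircuit p = IsCircuitPolynomial p × Nonnegative p

  SONC : ∀ {n} → Polynomial n → Set
  SONC {n} f = Σ[ ps ∈ List (Polynomial n) ] (All IsNonnegativeCircuit ps × f ≋ sumPoly ps)

  -- InΔ f β Δ : Δ belongs to the set Δ(β) attached to f.
  InΔ : ∀ {n} → Polynomial n → Exponent n → Simplex n → Set
  InΔ f β Δ = β ∈° Δ × (∀ i → Λ f (vertex Δ i))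

  record Summand {n} (f : Polynomial n) : Set where
    field
      β   : Exponent n
      Δ   : Simplex n
      β∈Γ : Γ f β
      Δ∈  : InΔ f β Δ
      c   : Vector Carrier (suc (dim Δ))
      d   : Carrier

    poly : Polynomial n
    poly = circuitForm Δ c β d

  HasIndex : ∀ {n} {f : Polynomial n} → Exponent n → Simplex n → Summand f → Set
  HasIndex β Δ s = β ≡ Summand.β s × Δ ≐ Summand.Δ s

  -- The list has exactly one entry for each pair (β , Δ) with β ∈ Γ(f) and
  -- Δ ∈ Δ(β), so that summing it is the double sum over Γ(f) and Δ(β).
  IndexedByAllPairs : ∀ {n} {f : Polynomial n} → List (Summand f) → Set
  IndexedByAllPairs {n} {f} ss =
    AllPairs (λ s t → ¬ HasIndex (Summand.β s) (Summand.Δ s) t) ss ×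
    (∀ (β : Exponent n) (Δ : Simplex n) → Γ f β → InΔ f β Δ → Any (HasIndex β Δ) ss)

  -- The double sum of nonnegative circuit polynomials is taken up to monomial
  -- squares e x^α with α ∈ Λ(f), which are themselves nonnegative circuit
  -- polynomials supported in supp(f).  They cannot be dropped: for f = x² the
  -- set Γ(f), hence the double sum, is empty, although f is SONC.
  SameSupportSONC : ∀ {n} → Polynomial n → Set
  SameSupportSONC {n} f =
    Σ[ ss ∈ List (Summand f) ] Σ[ es ∈ Polynomial n ]
      (IndexedByAllPairs ss ×
       All (λ s → IsNonnegativeCircuit (Summand.poly s)) ss ×
       All (λ (e , α) → 0# < e × Λ f α) es ×
       f ≋ sumPoly (map Summand.poly ss) ++ es)

-- The idea is to work with AGE (arithmetic-geometric-mean) polynomials: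
-- nonnegative polynomials with at most one term that is not a monomial square.  The circuits of a SONC decomposition
-- are summed up to one AGE polynomial G β for each inner exponent β.  Whenever G k
-- has a negative coefficient at k, suitable multiples of G k are shifted to the
-- G β with k among their monomial squares; this cancels k from all of them if
-- f_k ≤ 0, and uses up G k if f_k > 0.  In the end every G β is supported in
-- Λ(f) ∪ {β}, and only those with β ∈ Γ(f) have a term which is not a square.
--
-- It remains to split Σ c_α x^α - d x^β ≥ 0 into circuits.  The closure of the set
-- of all (x^(α - β))_α with x > 0 contains a minimiser z of Σ c_α z_α, and the
-- minimum is at least |d|.  The set is invariant under scaling the coordinates of
-- x, so the first-order condition reads Σ c_α z_α (α - β) = 0.  By Carathéodory the
-- weights c_α z_α are a sum of weights w on affinely independent sets with the
-- same property, and Σ (w_α / z_α) x^α ≥ (Σ w_α) x^β by AM-GM, since z is a limit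
-- of points (y^(α - β))_α.
--
-- Neither logarithms nor real powers are available.  AM-GM is obtained by rounding
-- the coordinates of x to powers of z > 1, applying Bernoulli's inequality to
-- powers of z, and letting z tend to 1.

module Submission where

open import Algebra.Bundles using (CommutativeRing; RawRing)
import Algebra.Properties.AbelianGroup as AbelianGroupProperties
import Algebra.Properties.CommutativeSemiring.Exp as ExpProperties
import Algebra.Properties.Ring as RingProperties
import Algebra.Properties.Semiring.Mult as MultProperties
import Algebra.Properties.Semiring.Sum as SemiringSum
import Algebra.Solver.Ring as RingSolver
open import Algebra.Solver.Ring.AlmostCommutativeRing using (fromCommutativeRing; _-Raw-AlmostCommutative⟶_)
open import Axiom.ExcludedMiddle using (ExcludedMiddle)
open import Data.Fin.Base using (Fin; zero; suc)
open import Data.Fin.Properties using (suc-injective) renaming (_≟_ to _≟ᶠ_)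
open import Data.List.Base as List
  using (List; []; _∷_; _++_; [_]; concat; concatMap; filter; map; tabulate)
open import Data.List.Membership.Propositional using (_∈_; _∉_; lose)
open import Data.List.Membership.Propositional.Properties
  using (∈-deduplicate⁺; ∈-filter⁺; ∈-filter⁻; ∈-lookup; ∈-map⁺; ∈-++⁺ˡ; ∈-++⁺ʳ)
import Data.List.Properties as List
open import Data.List.Relation.Unary.All as All using (All; []; _∷_)
import Data.List.Relation.Unary.All.Properties as All
open import Data.List.Relation.Unary.AllPairs as AllPairs using (AllPairs; []; _∷_)
import Data.List.Relation.Unary.AllPairs.Properties as AllPairs
open import Data.List.Relation.Unary.Any as Any using (Any; here; there)
import Data.List.Relation.Unary.Any.Properties as Any
open import Data.List.Relation.Unary.Unique.Propositional using (Unique)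
import Data.List.Relation.Unary.Unique.DecPropositional.Properties as Unique
import Data.List.Relation.Unary.Unique.Propositional.Properties as Unique
open import Data.Maybe.Base using (Maybe; just; nothing)
open import Data.Nat.Base as ℕ using (ℕ; zero; suc)
open import Data.Nat.Divisibility using (_∣_; divides; _∣0; ∣-refl; ∣m∣n⇒∣m+n)
import Data.Nat.Properties as ℕ
open import Data.Product.Base using (Σ-syntax; ∃-syntax; _×_; _,_; proj₁; proj₂)
open import Data.Sum.Base using (_⊎_; inj₁; inj₂; [_,_]′)
open import Data.Vec.Base using (lookup; replicate)
open import Data.Vec.Functional as Vector using (Vector; removeAt)
import Data.Vec.Properties as Vec
import Data.Vec.Relation.Unary.All.Properties as VecAll
open import Function.Bundles using (_⇔_; mk⇔; Equivalence)
import Function.Properties.Equivalence as ⇔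
open import Level using (0ℓ)
open import Relation.Binary.Bundles using (Poset)
open import Relation.Binary.Definitions using (DecidableEquality)
open import Relation.Binary.PropositionalEquality.Core as ≡ using (_≡_)
import Relation.Binary.Reasoning.PartialOrder as PartialOrderReasoning
import Relation.Binary.Reasoning.Setoid as SetoidReasoning
open import Relation.Binary.Structures using (IsTotalOrder)
open import Relation.Nullary.Decidable.Core using (Dec; yes; no)
open import Relation.Nullary.Negation.Core using (¬_; contradiction)
open import Defs

-- The obstacle is cancellation: the circuits of a SONC decomposition may have vertices outside
-- supp(f). Let a < 0 be the coefficient of G k at k, and S the sum of the coefficients at k of the
-- other members, so that f_k = a + S. A member receives G k in proportion to its own coefficient at
-- k; all these coefficients then shrink by one common factor. The largest admissible multiple makes
-- this factor zero if f_k ≤ 0 and leaves nothing of G k if f_k > 0. One pass over the inner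
-- exponents suffices, because later shifts do not spoil earlier ones.
--
-- When β lies on a proper face of the Newton polytope, the infimum of Σ c_α z_α may be approached
-- only as some z_α tend to 0; hence the closure. Exponents with z_α = 0 enter no circuit and stay
-- behind as squares. If M ≥ |d| is the minimum, a circuit with weights w gets the inner coefficient
-- (d / M) Σ w, so that these add up to d exactly. In the end circuits with the same simplex are
-- added, and a pair (β , Δ) without circuits gets the zero polynomial.

-- Ring solver with integer coefficients

module CommutativeRingSolver (R : CommutativeRing 0ℓ 0ℓ) where

  open CommutativeRing R
  open RingProperties ring using (x[y-z]≈xy-xz; [y-z]x≈yx-zx; -0#≈0#)
  open AbelianGroupProperties +-abelianGroup using (⁻¹-∙-comm; ⁻¹-involutive)
  open MultProperties semiring using (×-homo-+; ×1-homo-*) renaming (_×_ to _·_)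
  open SetoidReasoning setoid

  private
    exchange : ∀ p q r s → (p + q) + (r + s) ≈ (p + r) + (q + s)
    exchange p q r s = begin
      (p + q) + (r + s) ≈⟨ +-assoc p q (r + s) ⟩
      p + (q + (r + s)) ≈⟨ +-congˡ (+-assoc q r s) ⟨
      p + ((q + r) + s) ≈⟨ +-congˡ (+-congʳ (+-comm q r)) ⟩
      p + ((r + q) + s) ≈⟨ +-congˡ (+-assoc r q s) ⟩
      p + (r + (q + s)) ≈⟨ +-assoc p r (q + s) ⟨
      (p + r) + (q + s) ∎

    exchange-difference : ∀ p q r s → (p + q) - (r + s) ≈ (p - r) + (q - s)
    exchange-difference p q r s = begin
      (p + q) - (r + s)         ≈⟨ +-congˡ (⁻¹-∙-comm r s) ⟨
      (p + q) + (- r - s)       ≈⟨ exchange p q (- r) (- s) ⟩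
      (p - r) + (q - s)         ∎

    negate-difference : ∀ p q → - (p - q) ≈ q - p
    negate-difference p q = begin
      - (p - q)     ≈⟨ ⁻¹-∙-comm p (- q) ⟨
      - p + - - q   ≈⟨ +-congˡ (⁻¹-involutive q) ⟩
      - p + q       ≈⟨ +-comm (- p) q ⟩
      q - p         ∎

  cancel : ℕ → ℕ → ℕ × ℕ
  cancel (suc a) (suc b) = cancel a b
  cancel a       b       = a , b

  -- Integers as formal differences of naturals.  The solver compares normal
  -- forms syntactically, so differences are kept reduced.
  differences : RawRing 0ℓ 0ℓ
  differences = record
    { Carrier = ℕ × ℕ
    ; _≈_     = λ (a , b) (c , d) → a ℕ.+ d ≡ c ℕ.+ b
    ; _+_     = λ (a , b) (c , d) → cancel (a ℕ.+ c) (b ℕ.+ d)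
    ; _*_     = λ (a , b) (c , d) → cancel (a ℕ.* c ℕ.+ b ℕ.* d) (a ℕ.* d ℕ.+ b ℕ.* c)
    ; -_      = λ (a , b) → b , a
    ; 0#      = 0 , 0
    ; 1#      = 1 , 0
    }

  private
    ⟦_⟧ᵈ : ℕ × ℕ → Carrier
    ⟦ a , b ⟧ᵈ = a · 1# - b · 1#

    ⟦⟧ᵈ-cong : ∀ x y → proj₁ x ℕ.+ proj₂ y ≡ proj₁ y ℕ.+ proj₂ x → ⟦ x ⟧ᵈ ≈ ⟦ y ⟧ᵈ
    ⟦⟧ᵈ-cong (a , b) (c , d) a+d≡c+b = begin
      A - B               ≈⟨ +-identityʳ _ ⟨
      (A - B) + 0#        ≈⟨ +-congˡ (-‿inverseʳ D) ⟨
      (A - B) + (D - D)   ≈⟨ exchange _ _ _ _ ⟩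
      (A + D) + (- B - D) ≈⟨ +-congʳ (×-homo-+ 1# a d) ⟨
      (a ℕ.+ d) · 1# + (- B - D) ≡⟨ ≡.cong (λ k → k · 1# + (- B - D)) a+d≡c+b ⟩
      (c ℕ.+ b) · 1# + (- B - D) ≈⟨ +-cong (×-homo-+ 1# c b) (+-comm (- B) (- D)) ⟩
      (C + B) + (- D - B) ≈⟨ exchange _ _ _ _ ⟩
      (C - D) + (B - B)   ≈⟨ +-congˡ (-‿inverseʳ B) ⟩
      (C - D) + 0#        ≈⟨ +-identityʳ _ ⟩
      C - D               ∎
      where
      A = a · 1#
      B = b · 1#
      C = c · 1#
      D = d · 1#

    cancel-difference : ∀ a b → proj₁ (cancel a b) ℕ.+ b ≡ a ℕ.+ proj₂ (cancel a b)
    cancel-difference zero    b       = ≡.refl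
    cancel-difference (suc a) zero    = ≡.refl
    cancel-difference (suc a) (suc b) = ≡.trans (ℕ.+-suc _ b) (≡.cong suc (cancel-difference a b))

    ⟦cancel⟧ : ∀ a b → ⟦ cancel a b ⟧ᵈ ≈ ⟦ a , b ⟧ᵈ
    ⟦cancel⟧ a b = ⟦⟧ᵈ-cong (cancel a b) (a , b) (cancel-difference a b)

    *-homo : ∀ x y → ⟦ RawRing._*_ differences x y ⟧ᵈ ≈ ⟦ x ⟧ᵈ * ⟦ y ⟧ᵈ
    *-homo (a , b) (c , d) = begin
      ⟦ cancel (a ℕ.* c ℕ.+ b ℕ.* d) (a ℕ.* d ℕ.+ b ℕ.* c) ⟧ᵈ
        ≈⟨ ⟦cancel⟧ (a ℕ.* c ℕ.+ b ℕ.* d) (a ℕ.* d ℕ.+ b ℕ.* c) ⟩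
      (a ℕ.* c ℕ.+ b ℕ.* d) · 1# - (a ℕ.* d ℕ.+ b ℕ.* c) · 1#
        ≈⟨ +-cong (expand a c b d) (-‿cong (expand a d b c)) ⟩
      (A * C + B * D) - (A * D + B * C)
        ≈⟨ exchange-difference _ _ _ _ ⟩
      (A * C - A * D) + (B * D - B * C)
        ≈⟨ +-congˡ (negate-difference _ _) ⟨
      (A * C - A * D) - (B * C - B * D)
        ≈⟨ +-cong (x[y-z]≈xy-xz A C D) (-‿cong (x[y-z]≈xy-xz B C D)) ⟨
      A * (C - D) - B * (C - D)
        ≈⟨ [y-z]x≈yx-zx (C - D) A B ⟨
      (A - B) * (C - D) ∎
      where
      A = a · 1#
      B = b · 1#
      C = c · 1#
      D = d · 1#
      expand : ∀ k l m o → (k ℕ.* l ℕ.+ m ℕ.* o) · 1# ≈ (k · 1#) * (l · 1#) + (m · 1#) * (o · 1#)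
      expand k l m o = trans (×-homo-+ 1# (k ℕ.* l) (m ℕ.* o)) (+-cong (×1-homo-* k l) (×1-homo-* m o))

    -- Chosen so that con (0 , 0) and con (1 , 0) denote 0# and 1# definitionally.
    ⟦_⟧ : ℕ × ℕ → Carrier
    ⟦ 0 , 0 ⟧ = 0#
    ⟦ 1 , 0 ⟧ = 1#
    ⟦ x ⟧     = ⟦ x ⟧ᵈ

    ⟦⟧≈⟦⟧ᵈ : ∀ x → ⟦ x ⟧ ≈ ⟦ x ⟧ᵈ
    ⟦⟧≈⟦⟧ᵈ (0 , 0)           = sym (-‿inverseʳ 0#)
    ⟦⟧≈⟦⟧ᵈ (0 , suc b)       = refl
    ⟦⟧≈⟦⟧ᵈ (1 , 0)           = sym (trans (+-cong (+-identityʳ 1#) -0#≈0#) (+-identityʳ 1#))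
    ⟦⟧≈⟦⟧ᵈ (1 , suc b)       = refl
    ⟦⟧≈⟦⟧ᵈ (suc (suc a) , b) = refl

    morphism : differences -Raw-AlmostCommutative⟶ fromCommutativeRing R
    morphism = record
      { ⟦_⟧    = ⟦_⟧
      ; +-homo = λ x@(a , b) y@(c , d) → trans (⟦⟧≈⟦⟧ᵈ (RawRing._+_ differences x y))
          (trans (trans (⟦cancel⟧ (a ℕ.+ c) (b ℕ.+ d)) (+-cong (×-homo-+ 1# a c) (-‿cong (×-homo-+ 1# b d))))
            (trans (exchange-difference _ _ _ _) (sym (+-cong (⟦⟧≈⟦⟧ᵈ x) (⟦⟧≈⟦⟧ᵈ y)))))
      ; *-homo = λ x y → trans (⟦⟧≈⟦⟧ᵈ (RawRing._*_ differences x y))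
          (trans (*-homo x y) (sym (*-cong (⟦⟧≈⟦⟧ᵈ x) (⟦⟧≈⟦⟧ᵈ y))))
      ; -‿homo = λ x@(a , b) → trans (⟦⟧≈⟦⟧ᵈ (b , a))
          (sym (trans (-‿cong (⟦⟧≈⟦⟧ᵈ x)) (negate-difference _ _)))
      ; 0-homo = refl
      ; 1-homo = refl
      }

    _≟ᵈ_ : ∀ x y → Maybe (⟦ x ⟧ ≈ ⟦ y ⟧)
    x ≟ᵈ y with proj₁ x ℕ.+ proj₂ y ℕ.≟ proj₁ y ℕ.+ proj₂ x
    ... | no _    = nothing
    ... | yes x≡y = just (trans (⟦⟧≈⟦⟧ᵈ x) (trans (⟦⟧ᵈ-cong x y x≡y) (sym (⟦⟧≈⟦⟧ᵈ y))))

  open RingSolver differences (fromCommutativeRing R) morphism _≟ᵈ_ public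
    using (solve; _:=_; _:+_; _:*_; _:-_; :-_; _:^_; con)

module _ (em : ExcludedMiddle 0ℓ) (ℝ : RealNumbers) where

  open RealNumbers ℝ hiding (zero)
  open CommutativeRingSolver commutativeRing
  open SemiringSum semiring
    using (sum-cong-≋; *-distribˡ-sum; *-distribʳ-sum; ∑-distrib-+; ∑-comm; sum-remove; sum-replicate-zero)
  open ExpProperties commutativeSemiring using (^-homo-*; ^-distrib-*; ^-congˡ; ^-assocʳ)
  open MultProperties semiring using (×-homo-+; ×1-homo-*)

  open IsTotalOrder isTotalOrder using (antisym; total)
    renaming (refl to ≤-refl; reflexive to ≤-reflexive; trans to ≤-trans)

  poset : Poset 0ℓ 0ℓ 0ℓ
  poset = record { isPartialOrder = IsTotalOrder.isPartialOrder isTotalOrder }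

  module ≤-Reasoning = PartialOrderReasoning poset
  module ≈-Reasoning = SetoidReasoning setoid

  -- Ordered field arithmetic

  ≤-by-gap : ∀ {x y} e → 0# ≤ e → x + e ≈ y → x ≤ y
  ≤-by-gap {x} {y} e 0≤e x+e≈y = begin
    x       ≈⟨ +-identityˡ x ⟨
    0# + x  ≤⟨ +-monoˡ-≤ 0# e x 0≤e ⟩
    e + x   ≈⟨ +-comm e x ⟩
    x + e   ≈⟨ x+e≈y ⟩
    y       ∎
    where open ≤-Reasoning

  gap-nonneg : ∀ {x y} → x ≤ y → 0# ≤ y - x
  gap-nonneg {x} {y} x≤y = begin
    0#    ≈⟨ -‿inverseʳ x ⟨
    x - x ≤⟨ +-monoˡ-≤ x y (- x) x≤y ⟩
    y - x ∎
    where open ≤-Reasoning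

  +-mono-≤ : ∀ {w x y z} → w ≤ x → y ≤ z → w + y ≤ x + z
  +-mono-≤ {w} {x} {y} {z} w≤x y≤z = begin
    w + y ≤⟨ +-monoˡ-≤ w x y w≤x ⟩
    x + y ≈⟨ +-comm x y ⟩
    y + x ≤⟨ +-monoˡ-≤ y z x y≤z ⟩
    z + x ≈⟨ +-comm z x ⟩
    x + z ∎
    where open ≤-Reasoning

  +-nonneg : ∀ {x y} → 0# ≤ x → 0# ≤ y → 0# ≤ x + y
  +-nonneg 0≤x 0≤y = ≤-trans (≤-reflexive (sym (+-identityˡ 0#))) (+-mono-≤ 0≤x 0≤y)

  *-nonneg : ∀ {x y} → 0# ≤ x → 0# ≤ y → 0# ≤ x * y
  *-nonneg = *-nonNegative _ _

  *-monoˡ-≤ : ∀ {x y z} → 0# ≤ z → x ≤ y → z * x ≤ z * y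
  *-monoˡ-≤ {x} {y} {z} 0≤z x≤y = ≤-by-gap (z * (y - x)) (*-nonneg 0≤z (gap-nonneg x≤y))
    (solve 3 (λ x y z → z :* x :+ z :* (y :- x) := z :* y) refl x y z)

  *-monoʳ-≤ : ∀ {x y z} → 0# ≤ z → x ≤ y → x * z ≤ y * z
  *-monoʳ-≤ {x} {y} {z} 0≤z x≤y = ≤-trans (≤-reflexive (*-comm x z))
    (≤-trans (*-monoˡ-≤ 0≤z x≤y) (≤-reflexive (*-comm z y)))

  *-mono-≤ : ∀ {w x y z} → 0# ≤ x → 0# ≤ y → w ≤ x → y ≤ z → w * y ≤ x * z
  *-mono-≤ 0≤x 0≤y w≤x y≤z = ≤-trans (*-monoʳ-≤ 0≤y w≤x) (*-monoˡ-≤ 0≤x y≤z)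

  <⇒≤ : ∀ {x y} → x < y → x ≤ y
  <⇒≤ = proj₁

  ≰⇒> : ∀ {x y} → ¬ x ≤ y → y < x
  ≰⇒> {x} {y} x≰y with total x y
  ... | inj₁ x≤y = contradiction x≤y x≰y
  ... | inj₂ y≤x = y≤x , λ y≈x → x≰y (≤-reflexive (sym y≈x))

  ≮⇒≥ : ∀ {x y} → ¬ x < y → y ≤ x
  ≮⇒≥ {x} {y} x≮y with em {y ≤ x}
  ... | yes y≤x = y≤x
  ... | no y≰x = contradiction (≰⇒> y≰x) x≮y

  <⇒≱ : ∀ {x y} → x < y → ¬ y ≤ x
  <⇒≱ (x≤y , x≉y) y≤x = x≉y (antisym x≤y y≤x)

  <-≤-trans : ∀ {x y z} → x < y → y ≤ z → x < z
  <-≤-trans x<y y≤z = ≤-trans (<⇒≤ x<y) y≤z , λ x≈z → <⇒≱ x<y (≤-trans y≤z (≤-reflexive (sym x≈z)))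

  ≤-<-trans : ∀ {x y z} → x ≤ y → y < z → x < z
  ≤-<-trans x≤y y<z = ≤-trans x≤y (<⇒≤ y<z) , λ x≈z → <⇒≱ y<z (≤-trans (≤-reflexive (sym x≈z)) x≤y)

  <-respʳ : ∀ {x y z} → y ≈ z → x < y → x < z
  <-respʳ y≈z x<y = <-≤-trans x<y (≤-reflexive y≈z)

  0≤⇒0<⊎≈0 : ∀ {x} → 0# ≤ x → 0# < x ⊎ x ≈ 0#
  0≤⇒0<⊎≈0 {x} 0≤x with em {x ≈ 0#}
  ... | yes x≈0 = inj₂ x≈0
  ... | no x≉0 = inj₁ (0≤x , λ 0≈x → x≉0 (sym 0≈x))

  gap-pos : ∀ {x y} → x < y → 0# < y - x
  gap-pos {x} {y} x<y = gap-nonneg (<⇒≤ x<y) , λ 0≈y-x → proj₂ x<y (begin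
    x             ≈⟨ +-identityˡ x ⟨
    0# + x        ≈⟨ +-congʳ 0≈y-x ⟩
    (y - x) + x   ≈⟨ solve 2 (λ x y → (y :- x) :+ x := y) refl x y ⟩
    y             ∎)
    where open ≈-Reasoning

  neg-nonneg : ∀ {x} → x ≤ 0# → 0# ≤ - x
  neg-nonneg {x} x≤0 = ≤-trans (gap-nonneg x≤0) (≤-reflexive (+-identityˡ (- x)))

  neg-nonpos : ∀ {x} → 0# ≤ x → - x ≤ 0#
  neg-nonpos {x} 0≤x = ≤-by-gap x 0≤x (-‿inverseˡ x)

  +-pos-nonneg : ∀ {x y} → 0# < x → 0# ≤ y → 0# < x + y
  +-pos-nonneg {x} {y} 0<x 0≤y = <-≤-trans 0<x (≤-by-gap y 0≤y refl)

  square-nonneg : ∀ x → 0# ≤ x * x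
  square-nonneg x with total 0# x
  ... | inj₁ 0≤x = *-nonneg 0≤x 0≤x
  ... | inj₂ x≤0 = ≤-trans (*-nonneg (neg-nonneg x≤0) (neg-nonneg x≤0))
                     (≤-reflexive (solve 1 (λ x → (:- x) :* (:- x) := x :* x) refl x))

  0<1 : 0# < 1#
  0<1 = ≤-trans (square-nonneg 1#) (≤-reflexive (*-identityˡ 1#)) , λ 0≈1 → 1≉0 (sym 0≈1)

  0≤1 : 0# ≤ 1#
  0≤1 = <⇒≤ 0<1

  x*y≈0⇒y≈0 : ∀ {x y} → ¬ x ≈ 0# → x * y ≈ 0# → y ≈ 0#
  x*y≈0⇒y≈0 {x} {y} x≉0 xy≈0 with inverse x x≉0
  ... | x⁻¹ , xx⁻¹≈1 = begin
    y               ≈⟨ *-identityˡ y ⟨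
    1# * y          ≈⟨ *-congʳ xx⁻¹≈1 ⟨
    (x * x⁻¹) * y   ≈⟨ solve 3 (λ x i y → (x :* i) :* y := i :* (x :* y)) refl x x⁻¹ y ⟩
    x⁻¹ * (x * y)   ≈⟨ *-congˡ xy≈0 ⟩
    x⁻¹ * 0#        ≈⟨ zeroʳ x⁻¹ ⟩
    0#              ∎
    where open ≈-Reasoning

  pos⇒≉0 : ∀ {x} → 0# < x → ¬ x ≈ 0#
  pos⇒≉0 0<x x≈0 = proj₂ 0<x (sym x≈0)

  *-pos : ∀ {x y} → 0# < x → 0# < y → 0# < x * y
  *-pos 0<x 0<y = *-nonneg (<⇒≤ 0<x) (<⇒≤ 0<y) ,
    λ 0≈xy → pos⇒≉0 0<y (x*y≈0⇒y≈0 (pos⇒≉0 0<x) (sym 0≈xy))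

  *-cancelˡ-≤ : ∀ {x y z} → 0# < z → z * x ≤ z * y → x ≤ y
  *-cancelˡ-≤ {x} {y} {z} 0<z zx≤zy with em {x ≤ y}
  ... | yes x≤y = x≤y
  ... | no x≰y = contradiction zx≤zy (<⇒≱ (*-monoˡ-≤ (<⇒≤ 0<z) (<⇒≤ y<x) ,
      λ zy≈zx → pos⇒≉0 (*-pos 0<z (gap-pos y<x)) (begin
        z * (x - y)   ≈⟨ solve 3 (λ x y z → z :* (x :- y) := z :* x :- z :* y) refl x y z ⟩
        z * x - z * y ≈⟨ +-congˡ (-‿cong zy≈zx) ⟩
        z * x - z * x ≈⟨ -‿inverseʳ _ ⟩
        0#            ∎)))
    where
    open ≈-Reasoning
    y<x = ≰⇒> x≰y

  recip : ∀ x → 0# < x → Carrier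
  recip x 0<x = proj₁ (inverse x (pos⇒≉0 0<x))

  recip-inverseʳ : ∀ {x} (0<x : 0# < x) → x * recip x 0<x ≈ 1#
  recip-inverseʳ 0<x = proj₂ (inverse _ (pos⇒≉0 0<x))

  recip-inverseˡ : ∀ {x} (0<x : 0# < x) → recip x 0<x * x ≈ 1#
  recip-inverseˡ 0<x = trans (*-comm _ _) (recip-inverseʳ 0<x)

  inverse-pos : ∀ {x y} → 0# < x → x * y ≈ 1# → 0# < y
  inverse-pos {x} {y} 0<x xy≈1 = ≰⇒> λ y≤0 → <⇒≱ 0<1 (begin
    1#              ≈⟨ xy≈1 ⟨
    x * y           ≤⟨ *-monoˡ-≤ (<⇒≤ 0<x) y≤0 ⟩
    x * 0#          ≈⟨ zeroʳ x ⟩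
    0#              ∎)
    where open ≤-Reasoning

  recip-pos : ∀ {x} (0<x : 0# < x) → 0# < recip x 0<x
  recip-pos 0<x = inverse-pos 0<x (recip-inverseʳ 0<x)

  x<x+e : ∀ {x e} → 0# < e → x < x + e
  x<x+e {x} {e} 0<e = ≤-by-gap e (<⇒≤ 0<e) refl , λ x≈x+e → pos⇒≉0 0<e (begin
    e             ≈⟨ solve 2 (λ x e → e := (x :+ e) :- x) refl x e ⟩
    (x + e) - x   ≈⟨ +-congʳ x≈x+e ⟨
    x - x         ≈⟨ -‿inverseʳ x ⟩
    0#            ∎)
    where open ≈-Reasoning

  -- This stands in for limits ε → 0. Only ε below 1 has to be treated, since estimates such as ε *
  -- ε ≤ ε hold only there.
  ≤-limit : ∀ {x y} K → 0# ≤ K → (∀ ε → 0# < ε → ε < 1# → x ≤ y + ε * K) → x ≤ y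
  ≤-limit {x} {y} K 0≤K x≤y+εK with em {x ≤ y}
  ... | yes x≤y = x≤y
  ... | no x≰y = contradiction ds≤dK (<⇒≱ dK<ds)
    where
    d = x - y
    0<d : 0# < d
    0<d = gap-pos (≰⇒> x≰y)
    -- If d = x - y is positive, then ε = d / (d + K + 1) satisfies ε K < d; the summand 1 keeps ε
    -- below 1 even for K = 0.
    s = d + (K + 1#)
    0<s : 0# < s
    0<s = +-pos-nonneg 0<d (+-nonneg 0≤K 0≤1)
    r = recip s 0<s
    ε = d * r
    ε<1 : ε < 1#
    ε<1 = <-respʳ (recip-inverseʳ 0<s) (<-respʳ (sym (distribʳ r d (K + 1#)))
      (x<x+e (*-pos (<-respʳ (+-comm 1# K) (+-pos-nonneg 0<1 0≤K)) (recip-pos 0<s))))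
    ds≤dK : d * s ≤ d * K
    ds≤dK = begin
      d * s                 ≤⟨ *-monoʳ-≤ (<⇒≤ 0<s) (begin
        x - y                 ≤⟨ +-monoˡ-≤ _ _ (- y) (x≤y+εK ε (*-pos 0<d (recip-pos 0<s)) ε<1) ⟩
        (y + ε * K) - y       ≈⟨ solve 2 (λ y e → (y :+ e) :- y := e) refl y (ε * K) ⟩
        ε * K                 ∎) ⟩
      ((d * r) * K) * s     ≈⟨ solve 4 (λ d r K s → ((d :* r) :* K) :* s := (d :* K) :* (s :* r)) refl d r K s ⟩
      (d * K) * (s * r)     ≈⟨ *-congˡ (recip-inverseʳ 0<s) ⟩
      (d * K) * 1#          ≈⟨ *-identityʳ _ ⟩
      d * K                 ∎
      where open ≤-Reasoning
    dK<ds : d * K < d * s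
    dK<ds = <-respʳ (solve 2 (λ d K → d :* K :+ d :* (d :+ con (1 , 0)) := d :* (d :+ (K :+ con (1 , 0)))) refl d K)
      (x<x+e (*-pos 0<d (+-pos-nonneg 0<d 0≤1)))

  -- Finite sums and products

  sum-mono : ∀ {m} {g h : Vector Carrier m} → (∀ i → g i ≤ h i) → sum g ≤ sum h
  sum-mono {zero}  g≤h = ≤-refl
  sum-mono {suc m} g≤h = +-mono-≤ (g≤h zero) (sum-mono (λ i → g≤h (suc i)))

  sum-zero : ∀ {m} {g : Vector Carrier m} → (∀ i → g i ≈ 0#) → sum g ≈ 0#
  sum-zero {m} g≈0 = trans (sum-cong-≋ g≈0) (sum-replicate-zero m)

  sum-nonneg : ∀ {m} {g : Vector Carrier m} → (∀ i → 0# ≤ g i) → 0# ≤ sum g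
  sum-nonneg {zero}  0≤g = ≤-refl
  sum-nonneg {suc m} 0≤g = +-nonneg (0≤g zero) (sum-nonneg (λ i → 0≤g (suc i)))

  term≤sum : ∀ {m} {g : Vector Carrier m} → (∀ i → 0# ≤ g i) → ∀ i → g i ≤ sum g
  term≤sum {suc m} {g} 0≤g zero    = ≤-by-gap _ (sum-nonneg (λ i → 0≤g (suc i))) refl
  term≤sum {suc m} {g} 0≤g (suc i) = ≤-trans (term≤sum (λ i → 0≤g (suc i)) i) (≤-by-gap _ (0≤g zero) (+-comm _ _))

  sum-pos : ∀ {m} {g : Vector Carrier (suc m)} → (∀ i → 0# < g i) → 0# < sum g
  sum-pos 0<g = +-pos-nonneg (0<g zero) (sum-nonneg (λ i → <⇒≤ (0<g (suc i))))

  sum-neg : ∀ {m} (g : Vector Carrier m) → sum (λ i → - g i) ≈ - sum g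
  sum-neg {zero}  g = solve 0 (con (0 , 0) := :- con (0 , 0)) refl
  sum-neg {suc m} g = trans (+-congˡ (sum-neg (λ i → g (suc i))))
    (solve 2 (λ x s → :- x :+ :- s := :- (x :+ s)) refl (g zero) (sum (λ i → g (suc i))))

  sum-difference : ∀ {m} (g h : Vector Carrier m) → sum (λ i → g i - h i) ≈ sum g - sum h
  sum-difference g h = trans (∑-distrib-+ g (λ i → - h i)) (+-congˡ (sum-neg h))

  product-cong : ∀ {m} {g h : Vector Carrier m} → (∀ i → g i ≈ h i) → product g ≈ product h
  product-cong {zero}  g≈h = refl
  product-cong {suc m} g≈h = *-cong (g≈h zero) (product-cong (λ i → g≈h (suc i)))

  product-nonneg : ∀ {m} {g : Vector Carrier m} → (∀ i → 0# ≤ g i) → 0# ≤ product g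
  product-nonneg {zero}  0≤g = 0≤1
  product-nonneg {suc m} 0≤g = *-nonneg (0≤g zero) (product-nonneg (λ i → 0≤g (suc i)))

  product-pos : ∀ {m} {g : Vector Carrier m} → (∀ i → 0# < g i) → 0# < product g
  product-pos {zero}  0<g = 0<1
  product-pos {suc m} 0<g = *-pos (0<g zero) (product-pos (λ i → 0<g (suc i)))

  product-mono : ∀ {m} {g h : Vector Carrier m} → (∀ i → 0# ≤ g i) → (∀ i → g i ≤ h i) → product g ≤ product h
  product-mono {zero}  0≤g g≤h = ≤-refl
  product-mono {suc m} 0≤g g≤h = *-mono-≤ (≤-trans (0≤g zero) (g≤h zero))
    (product-nonneg (λ i → 0≤g (suc i))) (g≤h zero) (product-mono (λ i → 0≤g (suc i)) (λ i → g≤h (suc i)))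

  product-distrib-* : ∀ {m} (g h : Vector Carrier m) → product (λ i → g i * h i) ≈ product g * product h
  product-distrib-* {zero}  g h = sym (*-identityˡ 1#)
  product-distrib-* {suc m} g h = trans (*-congˡ (product-distrib-* (λ i → g (suc i)) (λ i → h (suc i))))
    (solve 4 (λ a b c d → (a :* b) :* (c :* d) := (a :* c) :* (b :* d)) refl _ _ _ _)

  product-ones : ∀ {m} {g : Vector Carrier m} → (∀ i → g i ≈ 1#) → product g ≈ 1#
  product-ones {zero}  g≈1 = refl
  product-ones {suc m} g≈1 = trans (*-cong (g≈1 zero) (product-ones (λ i → g≈1 (suc i)))) (*-identityˡ 1#)

  product-single : ∀ {m} {g : Vector Carrier m} j → (∀ i → ¬ i ≡ j → g i ≈ 1#) → product g ≈ g j
  product-single zero    g≈1 = trans (*-congˡ (product-ones (λ i → g≈1 (suc i) λ ()))) (*-identityʳ _)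
  product-single (suc j) g≈1 = trans (*-cong (g≈1 zero λ ())
    (product-single j (λ i i≢j → g≈1 (suc i) λ { ≡.refl → i≢j ≡.refl }))) (*-identityˡ _)

  product-zero : ∀ {m} {g : Vector Carrier m} j → g j ≈ 0# → product g ≈ 0#
  product-zero zero    gj≈0 = trans (*-congʳ gj≈0) (zeroˡ _)
  product-zero (suc j) gj≈0 = trans (*-congˡ (product-zero j gj≈0)) (zeroʳ _)

  -- Powers, their tangents and integer logarithms

  ^-pos : ∀ {x} k → 0# < x → 0# < x ^ k
  ^-pos zero    0<x = 0<1
  ^-pos (suc k) 0<x = *-pos 0<x (^-pos k 0<x)

  ^-nonneg : ∀ {x} k → 0# ≤ x → 0# ≤ x ^ k
  ^-nonneg zero    0≤x = 0≤1
  ^-nonneg (suc k) 0≤x = *-nonneg 0≤x (^-nonneg k 0≤x)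

  ^-monoˡ-≤ : ∀ {x y} k → 0# ≤ x → x ≤ y → x ^ k ≤ y ^ k
  ^-monoˡ-≤ zero    0≤x x≤y = ≤-refl
  ^-monoˡ-≤ (suc k) 0≤x x≤y = *-mono-≤ (≤-trans 0≤x x≤y) (^-nonneg k 0≤x) x≤y (^-monoˡ-≤ k 0≤x x≤y)

  1^k≈1 : ∀ k → 1# ^ k ≈ 1#
  1^k≈1 zero    = refl
  1^k≈1 (suc k) = trans (*-identityˡ _) (1^k≈1 k)

  1≤z^k : ∀ {z} k → 1# ≤ z → 1# ≤ z ^ k
  1≤z^k k 1≤z = ≤-trans (≤-reflexive (sym (1^k≈1 k))) (^-monoˡ-≤ k 0≤1 1≤z)

  fromℕ-+ : ∀ k l → fromℕ (k ℕ.+ l) ≈ fromℕ k + fromℕ l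
  fromℕ-+ = ×-homo-+ 1#

  fromℕ-nonneg : ∀ k → 0# ≤ fromℕ k
  fromℕ-nonneg zero    = ≤-refl
  fromℕ-nonneg (suc k) = +-nonneg 0≤1 (fromℕ-nonneg k)

  fromℕ-suc-pos : ∀ k → 0# < fromℕ (suc k)
  fromℕ-suc-pos k = +-pos-nonneg 0<1 (fromℕ-nonneg k)

  -- Convexity of k ↦ t ^ k; this stands in for 1 + x ≤ exp x.
  power-above-tangent : ∀ {t} → 0# ≤ t → ∀ p q →
    t ^ q + (fromℕ p - fromℕ q) * (t ^ q * (t - 1#)) ≤ t ^ p
  power-above-tangent {t} 0≤t p q with ℕ.≤-total q p
  ... | inj₁ q≤p = ≡.subst (λ k → t ^ q + (fromℕ k - fromℕ q) * (t ^ q * (t - 1#)) ≤ t ^ k)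
                     (ℕ.m+[n∸m]≡n q≤p) (above (p ℕ.∸ q))
    where
    above : ∀ m → t ^ q + (fromℕ (q ℕ.+ m) - fromℕ q) * (t ^ q * (t - 1#)) ≤ t ^ (q ℕ.+ m)
    above zero = ≤-reflexive (trans (+-congˡ (trans (*-congʳ (trans
      (+-congʳ (reflexive (≡.cong fromℕ (ℕ.+-identityʳ q)))) (-‿inverseʳ _))) (zeroˡ _)))
      (trans (+-identityʳ _) (reflexive (≡.cong (t ^_) (≡.sym (ℕ.+-identityʳ q))))))
    above (suc m) = begin
      T + (fromℕ (q ℕ.+ suc m) - Q) * (T * (t - 1#))
        ≈⟨ +-congˡ (*-congʳ (+-congʳ (fromℕ-+ q (suc m)))) ⟩
      T + ((Q + (1# + M)) - Q) * (T * (t - 1#))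
        ≤⟨ ≤-by-gap ((T * M) * ((t - 1#) * (t - 1#)))
             (*-nonneg (*-nonneg (^-nonneg q 0≤t) (fromℕ-nonneg m)) (square-nonneg _))
             (solve 4 (λ T Q M t →
               (T :+ ((Q :+ (con (1 , 0) :+ M)) :- Q) :* (T :* (t :- con (1 , 0))))
                 :+ (T :* M) :* ((t :- con (1 , 0)) :* (t :- con (1 , 0)))
               := t :* (T :+ ((Q :+ M) :- Q) :* (T :* (t :- con (1 , 0))))) refl T Q M t) ⟩
      t * (T + ((Q + M) - Q) * (T * (t - 1#)))
        ≈⟨ *-congˡ (+-congˡ (*-congʳ (+-congʳ (fromℕ-+ q m)))) ⟨
      t * (T + (fromℕ (q ℕ.+ m) - Q) * (T * (t - 1#)))
        ≤⟨ *-monoˡ-≤ 0≤t (above m) ⟩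
      t ^ suc (q ℕ.+ m)
        ≡⟨ ≡.cong (t ^_) (≡.sym (ℕ.+-suc q m)) ⟩
      t ^ (q ℕ.+ suc m) ∎
      where
      open ≤-Reasoning
      T = t ^ q
      Q = fromℕ q
      M = fromℕ m
  ... | inj₂ p≤q = ≡.subst (λ k → t ^ k + (fromℕ p - fromℕ k) * (t ^ k * (t - 1#)) ≤ t ^ p)
                     (ℕ.m+[n∸m]≡n p≤q) (below (q ℕ.∸ p))
    where
    below : ∀ m → t ^ (p ℕ.+ m) + (fromℕ p - fromℕ (p ℕ.+ m)) * (t ^ (p ℕ.+ m) * (t - 1#)) ≤ t ^ p
    below zero = ≤-reflexive (trans (+-congˡ (trans (*-congʳ (trans
      (+-congˡ (-‿cong (reflexive (≡.cong fromℕ (ℕ.+-identityʳ p))))) (-‿inverseʳ _))) (zeroˡ _)))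
      (trans (+-identityʳ _) (reflexive (≡.cong (t ^_) (ℕ.+-identityʳ p)))))
    below (suc m) = begin
      t ^ (p ℕ.+ suc m) + (P - fromℕ (p ℕ.+ suc m)) * (t ^ (p ℕ.+ suc m) * (t - 1#))
        ≡⟨ ≡.cong (λ k → t ^ k + (P - fromℕ k) * (t ^ k * (t - 1#))) (ℕ.+-suc p m) ⟩
      t * T + (P - (1# + fromℕ (p ℕ.+ m))) * ((t * T) * (t - 1#))
        ≈⟨ +-congˡ (*-congʳ (+-congˡ (-‿cong (+-congˡ (fromℕ-+ p m))))) ⟩
      t * T + (P - (1# + (P + M))) * ((t * T) * (t - 1#))
        ≤⟨ ≤-by-gap ((T * (1# + M)) * ((t - 1#) * (t - 1#)))
             (*-nonneg (*-nonneg (^-nonneg (p ℕ.+ m) 0≤t) (fromℕ-nonneg (suc m))) (square-nonneg _))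
             (solve 4 (λ T P M t →
               (t :* T :+ (P :- (con (1 , 0) :+ (P :+ M))) :* ((t :* T) :* (t :- con (1 , 0))))
                 :+ (T :* (con (1 , 0) :+ M)) :* ((t :- con (1 , 0)) :* (t :- con (1 , 0)))
               := T :+ (P :- (P :+ M)) :* (T :* (t :- con (1 , 0)))) refl T P M t) ⟩
      T + (P - (P + M)) * (T * (t - 1#))
        ≈⟨ +-congˡ (*-congʳ (+-congˡ (-‿cong (fromℕ-+ p m)))) ⟨
      T + (P - fromℕ (p ℕ.+ m)) * (T * (t - 1#))
        ≤⟨ below m ⟩
      t ^ p ∎
      where
      open ≤-Reasoning
      T = t ^ (p ℕ.+ m)
      P = fromℕ p
      M = fromℕ m

  power-expansion : ∀ k → ∃[ K ] 0# ≤ K × (∀ h → 0# ≤ 1# + h → h ≤ 1# →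
    (1# + h) ^ k ≤ (1# + fromℕ k * h) + K * (h * h))
  power-expansion zero = 0# , ≤-refl , λ h _ _ →
    ≤-reflexive (solve 1 (λ h → con (1 , 0) := (con (1 , 0) :+ con (0 , 0) :* h) :+ con (0 , 0) :* (h :* h)) refl h)
  power-expansion (suc k) with power-expansion k
  ... | K , 0≤K , bound = fromℕ k + (K + K) , +-nonneg (fromℕ-nonneg k) (+-nonneg 0≤K 0≤K) , λ h 0≤1+h h≤1 → begin
      (1# + h) * (1# + h) ^ k
        ≤⟨ *-monoˡ-≤ 0≤1+h (bound h 0≤1+h h≤1) ⟩
      (1# + h) * ((1# + fromℕ k * h) + K * (h * h))
        ≤⟨ ≤-by-gap ((K * (h * h)) * (1# - h)) (*-nonneg (*-nonneg 0≤K (square-nonneg h)) (gap-nonneg h≤1))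
             (solve 3 (λ h k K →
               (con (1 , 0) :+ h) :* ((con (1 , 0) :+ k :* h) :+ K :* (h :* h))
                 :+ (K :* (h :* h)) :* (con (1 , 0) :- h)
               := (con (1 , 0) :+ (con (1 , 0) :+ k) :* h) :+ (k :+ (K :+ K)) :* (h :* h)) refl h (fromℕ k) K) ⟩
      (1# + fromℕ (suc k) * h) + (fromℕ k + (K + K)) * (h * h) ∎
    where open ≤-Reasoning

  -- If the powers of z had a supremum s, then s / z would bound them too, as each power is the next
  -- one divided by z; but s / z < s.
  powers-unbounded : ∀ {z} → 1# < z → ∀ x → ∃[ k ] x ≤ z ^ k
  powers-unbounded {z} 1<z x with em {∃[ k ] x ≤ z ^ k}
  ... | yes found = found
  ... | no bounded = contradiction s≤s*r (<⇒≱ sr<s)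
    where
    0<z = ≤-<-trans 0≤1 1<z
    r = recip z 0<z
    Power : Carrier → Set
    Power y = ∃[ k ] y ≈ z ^ k
    lub = supremum Power (1# , 0 , refl)
      (x , λ { y (k , y≈z^k) → ≤-trans (≤-reflexive y≈z^k) (<⇒≤ (≰⇒> λ x≤z^k → bounded (k , x≤z^k))) })
    s = proj₁ lub
    1≤s : 1# ≤ s
    1≤s = proj₁ (proj₂ lub) 1# (0 , refl)
    s≤s*r : s ≤ s * r
    s≤s*r = proj₂ (proj₂ lub) (s * r) λ { y (k , y≈z^k) → begin
      y                   ≈⟨ y≈z^k ⟩
      z ^ k               ≈⟨ *-identityˡ _ ⟨
      1# * z ^ k          ≈⟨ *-congʳ (recip-inverseˡ 0<z) ⟨
      (r * z) * z ^ k     ≈⟨ solve 3 (λ r z w → (r :* z) :* w := (z :* w) :* r) refl r z (z ^ k) ⟩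
      z ^ suc k * r       ≤⟨ *-monoʳ-≤ (<⇒≤ (recip-pos 0<z)) (proj₁ (proj₂ lub) (z ^ suc k) (suc k , refl)) ⟩
      s * r               ∎ }
      where open ≤-Reasoning
    sr<s : s * r < s
    sr<s = <-respʳ (begin
      s * r + (s * r) * (z - 1#)    ≈⟨ solve 3 (λ s r z → s :* r :+ (s :* r) :* (z :- con (1 , 0)) := s :* (r :* z)) refl s r z ⟩
      s * (r * z)                   ≈⟨ *-congˡ (recip-inverseˡ 0<z) ⟩
      s * 1#                        ≈⟨ *-identityʳ s ⟩
      s                             ∎)
      (x<x+e (*-pos (*-pos (<-≤-trans 0<1 1≤s) (recip-pos 0<z)) (gap-pos 1<z)))
      where open ≈-Reasoning

  floor-log : ∀ {z x} → 1# < z → 1# ≤ x → ∃[ a ] z ^ a ≤ x × x ≤ z ^ suc a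
  floor-log {z} {x} 1<z 1≤x = search (proj₁ bound) (proj₂ bound)
    where
    bound = powers-unbounded 1<z x
    search : ∀ k → x ≤ z ^ k → ∃[ a ] z ^ a ≤ x × x ≤ z ^ suc a
    search zero x≤1 = 0 , 1≤x , ≤-trans x≤1 (1≤z^k 1 (<⇒≤ 1<z))
    search (suc k) x≤z^1+k with em {x ≤ z ^ k}
    ... | yes x≤z^k = search k x≤z^k
    ... | no x≰z^k = k , <⇒≤ (≰⇒> x≰z^k) , x≤z^1+k

  -- Cluster points

  lower-minimum : ∀ {x y} → 0# < x → 0# < y → ∃[ z ] 0# < z × z ≤ x × z ≤ y
  lower-minimum {x} {y} 0<x 0<y with total x y
  ... | inj₁ x≤y = x , 0<x , ≤-refl , x≤y
  ... | inj₂ y≤x = y , 0<y , y≤x , ≤-refl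

  Close : Carrier → Carrier → Carrier → Set
  Close ε x y = x ≤ y + ε × y ≤ x + ε

  Close-mono : ∀ {ε ε′ x y} → ε ≤ ε′ → Close ε x y → Close ε′ x y
  Close-mono ε≤ε′ (x≤y+ε , y≤x+ε) =
    ≤-trans x≤y+ε (+-mono-≤ ≤-refl ε≤ε′) , ≤-trans y≤x+ε (+-mono-≤ ≤-refl ε≤ε′)

  -- Each coordinate of the cluster point is the lower limit of that coordinate
  -- along the family, refined so as to cluster in the earlier coordinates.
  cluster-point : ∀ {Y : Set} (F : Carrier → Y → Set) →
    (∀ {ε ε′ y} → ε ≤ ε′ → F ε y → F ε′ y) →
    (∀ ε → 0# < ε → ∃[ y ] F ε y) →
    ∀ {m} (φ : Fin m → Y → Carrier) K → (∀ i y → F 1# y → 0# ≤ φ i y × φ i y ≤ K) →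
    Σ[ z ∈ Vector Carrier m ] (∀ ε → 0# < ε → ∃[ y ] F ε y × (∀ i → Close ε (φ i y) (z i)))
  cluster-point F F-mono inhabited {zero} φ K bounds =
    (λ ()) , λ ε 0<ε → proj₁ (inhabited ε 0<ε) , proj₂ (inhabited ε 0<ε) , λ ()
  cluster-point {Y} F F-mono inhabited {suc m} φ K bounds = z , λ ε 0<ε → let (y , (Fεy , close₀) , close) = z-clusters ε 0<ε in
      y , Fεy , λ { zero → close₀ ; (suc i) → close i }
    where
    Eventual : Carrier → Set
    Eventual t = ∃[ ε ] 0# < ε × ε ≤ 1# × (∀ y → F ε y → t ≤ φ zero y)
    -- The value 0 is an eventual lower bound, and K bounds all of them because `F` is inhabited;
    -- both use `bounds`, which is why `Eventual` asks for ε ≤ 1.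
    liminf = supremum Eventual
      (0# , 1# , 0<1 , ≤-refl , λ y F1y → proj₁ (bounds zero y F1y))
      (K , λ { t (ε , 0<ε , ε≤1 , t≤φ) → let (y , Fεy) = inhabited ε 0<ε in
        ≤-trans (t≤φ y Fεy) (proj₂ (bounds zero y (F-mono ε≤1 Fεy))) })
    t₀ = proj₁ liminf

    frequently-below : ∀ ε → 0# < ε → ∀ δ → 0# < δ → δ ≤ 1# → ∃[ y ] F δ y × φ zero y ≤ t₀ + ε
    frequently-below ε 0<ε δ 0<δ δ≤1 with em {∃[ y ] F δ y × φ zero y ≤ t₀ + ε}
    ... | yes found = found
    ... | no none = contradiction
      (proj₁ (proj₂ liminf) (t₀ + ε) (δ , 0<δ , δ≤1 , λ y Fδy → <⇒≤ (≰⇒> λ φ≤ → none (y , Fδy , φ≤))))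
      (<⇒≱ (x<x+e 0<ε))

    eventually-above : ∀ ε → 0# < ε → ∃[ t ] Eventual t × t₀ ≤ t + ε
    eventually-above ε 0<ε with em {∃[ t ] Eventual t × t₀ ≤ t + ε}
    ... | yes found = found
    ... | no none = contradiction
      (proj₂ (proj₂ liminf) (t₀ - ε) λ t evt → begin
        t               ≈⟨ solve 2 (λ t e → t := (t :+ e) :- e) refl t ε ⟩
        (t + ε) - ε     ≤⟨ +-monoˡ-≤ _ _ (- ε) (<⇒≤ (≰⇒> λ t₀≤ → none (t , evt , t₀≤))) ⟩
        t₀ - ε          ∎)
      (<⇒≱ (<-respʳ (solve 2 (λ t e → (t :- e) :+ e := t) refl t₀ ε) (x<x+e 0<ε)))
      where open ≤-Reasoning

    F′ : Carrier → Y → Set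
    F′ ε y = F ε y × Close ε (φ zero y) t₀

    inhabited′ : ∀ ε → 0# < ε → ∃[ y ] F′ ε y
    -- The upper bound holds frequently and the lower one eventually, so below δ some y satisfies
    -- both; δ ≤ ε keeps `F ε`.
    inhabited′ ε 0<ε =
      let (t , (ε₁ , 0<ε₁ , ε₁≤1 , t≤φ) , t₀≤t+ε) = eventually-above ε 0<ε
          (δ , 0<δ , δ≤ε , δ≤ε₁) = lower-minimum 0<ε 0<ε₁
          (y , Fδy , φ≤) = frequently-below ε 0<ε δ 0<δ (≤-trans δ≤ε₁ ε₁≤1)
      in y , F-mono δ≤ε Fδy , φ≤ , ≤-trans t₀≤t+ε (+-monoˡ-≤ _ _ ε (t≤φ y (F-mono δ≤ε₁ Fδy)))

    refined = cluster-point F′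
      (λ ε≤ε′ (Fεy , close) → F-mono ε≤ε′ Fεy , Close-mono ε≤ε′ close)
      inhabited′ (λ i → φ (suc i)) K (λ i y F′1y → bounds (suc i) y (proj₁ F′1y))

    z : Vector Carrier (suc m)
    z zero    = t₀
    z (suc i) = proj₁ refined i

    z-clusters = proj₂ refined

  -- The weighted AM-GM inequality

  monomial-* : ∀ {n} (α : Exponent n) (x y : Vector Carrier n) →
    monomial ℝ α (λ j → x j * y j) ≈ monomial ℝ α x * monomial ℝ α y
  monomial-* α x y = trans (product-cong (λ j → ^-distrib-* (x j) (y j) (lookup α j)))
    (product-distrib-* (λ j → x j ^ lookup α j) (λ j → y j ^ lookup α j))

  monomial-ones : ∀ {n} (α : Exponent n) {x : Vector Carrier n} → (∀ j → x j ≈ 1#) → monomial ℝ α x ≈ 1#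
  monomial-ones α x≈1 = product-ones (λ j → trans (^-congˡ (lookup α j) (x≈1 j)) (1^k≈1 (lookup α j)))

  monomial-pos : ∀ {n} (α : Exponent n) {x : Vector Carrier n} → (∀ j → 0# < x j) → 0# < monomial ℝ α x
  monomial-pos α 0<x = product-pos (λ j → ^-pos (lookup α j) (0<x j))

  monomial-mono : ∀ {n} (α : Exponent n) {x y : Vector Carrier n} →
    (∀ j → 0# ≤ x j) → (∀ j → x j ≤ y j) → monomial ℝ α x ≤ monomial ℝ α y
  monomial-mono α 0≤x x≤y = product-mono (λ j → ^-nonneg (lookup α j) (0≤x j))
    (λ j → ^-monoˡ-≤ (lookup α j) (0≤x j) (x≤y j))

  -- The inverses are stored, so that Laurent monomials are products of ordinary ones and
  -- `reciprocal` is a mere swap.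
  record PositivePoint (n : ℕ) : Set where
    field
      point inverses : Vector Carrier n
      point-pos      : ∀ j → 0# < point j
      inverses-pos   : ∀ j → 0# < inverses j
      point*inverses : ∀ j → point j * inverses j ≈ 1#

  open PositivePoint

  fromPositive : ∀ {n} (x : Vector Carrier n) → (∀ j → 0# < x j) → PositivePoint n
  fromPositive x 0<x = record
    { point          = x
    ; inverses       = λ j → recip (x j) (0<x j)
    ; point-pos      = 0<x
    ; inverses-pos   = λ j → recip-pos (0<x j)
    ; point*inverses = λ j → recip-inverseʳ (0<x j)
    }

  infixl 7 _⊛_
  _⊛_ : ∀ {n} → PositivePoint n → PositivePoint n → PositivePoint n
  x ⊛ y = record
    { point          = λ j → point x j * point y j
    ; inverses       = λ j → inverses x j * inverses y j
    ; point-pos      = λ j → *-pos (point-pos x j) (point-pos y j)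
    ; inverses-pos   = λ j → *-pos (inverses-pos x j) (inverses-pos y j)
    ; point*inverses = λ j → trans
        (solve 4 (λ a b c d → (a :* b) :* (c :* d) := (a :* c) :* (b :* d)) refl
          (point x j) (point y j) (inverses x j) (inverses y j))
        (trans (*-cong (point*inverses x j) (point*inverses y j)) (*-identityˡ 1#))
    }

  reciprocal : ∀ {n} → PositivePoint n → PositivePoint n
  reciprocal x = record
    { point          = inverses x
    ; inverses       = point x
    ; point-pos      = inverses-pos x
    ; inverses-pos   = point-pos x
    ; point*inverses = λ j → trans (*-comm _ _) (point*inverses x j)
    }

  -- The Laurent monomial x ^ (α - β).
  ratio : ∀ {n} → Exponent n → Exponent n → PositivePoint n → Carrier
  ratio α β x = monomial ℝ α (point x) * monomial ℝ β (inverses x)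

  monomial-inverse : ∀ {n} (α : Exponent n) (x : PositivePoint n) →
    monomial ℝ α (point x) * monomial ℝ α (inverses x) ≈ 1#
  monomial-inverse α x = trans (sym (monomial-* α (point x) (inverses x))) (monomial-ones α (point*inverses x))

  ratio-pos : ∀ {n} (α β : Exponent n) x → 0# < ratio α β x
  ratio-pos α β x = *-pos (monomial-pos α (point-pos x)) (monomial-pos β (inverses-pos x))

  ratio-⊛ : ∀ {n} (α β : Exponent n) x y → ratio α β (x ⊛ y) ≈ ratio α β x * ratio α β y
  ratio-⊛ α β x y = trans
    (*-cong (monomial-* α (point x) (point y)) (monomial-* β (inverses x) (inverses y)))
    (solve 4 (λ a b c d → (a :* b) :* (c :* d) := (a :* c) :* (b :* d)) refl _ _ _ _)

  ratio-reciprocal : ∀ {n} (α β : Exponent n) x → ratio α β x * ratio α β (reciprocal x) ≈ 1#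
  ratio-reciprocal α β x = trans
    (solve 4 (λ a b c d → (a :* b) :* (c :* d) := (a :* c) :* (d :* b)) refl _ _ _ _)
    (trans (*-cong (monomial-inverse α x) (monomial-inverse β x)) (*-identityˡ 1#))

  ratio*monomial : ∀ {n} (α β : Exponent n) x → ratio α β x * monomial ℝ β (point x) ≈ monomial ℝ α (point x)
  ratio*monomial α β x = trans (*-assoc _ _ _)
    (trans (*-congˡ (trans (*-comm _ _) (monomial-inverse β x))) (*-identityʳ _))

  total-degree : ∀ {n} → Vector ℕ n → ℕ
  total-degree = Vector.foldr ℕ._+_ 0

  fromℕ-total-degree : ∀ {n} (e : Vector ℕ n) → fromℕ (total-degree e) ≈ sum (λ j → fromℕ (e j))
  fromℕ-total-degree {zero}  e = refl
  fromℕ-total-degree {suc n} e = trans (fromℕ-+ (e zero) _) (+-congˡ (fromℕ-total-degree (λ j → e (suc j))))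

  product-powers : ∀ {n} z (e : Vector ℕ n) → product (λ j → z ^ e j) ≈ z ^ total-degree e
  product-powers {zero}  z e = refl
  product-powers {suc n} z e = trans (*-congˡ (product-powers z (λ j → e (suc j)))) (sym (^-homo-* z (e zero) _))

  monomial-powers : ∀ {n} z (α : Exponent n) (e : Vector ℕ n) →
    monomial ℝ α (λ j → z ^ e j) ≈ z ^ total-degree (λ j → e j ℕ.* lookup α j)
  monomial-powers z α e = trans (product-cong (λ j → ^-assocʳ z (e j) (lookup α j)))
    (product-powers z (λ j → e j ℕ.* lookup α j))

  -- β is the barycentre of the weights, with the total mass multiplied out: weights need not be
  -- normalised and may all vanish.
  Balanced : ∀ {n m} → Vector (Exponent n) m → Vector Carrier m → Exponent n → Set
  Balanced v w β = ∀ j → sum (λ i → w i * fromℕ (lookup (v i) j)) ≈ sum w * fromℕ (lookup β j)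

  -- The first moment of `v - β` vanishes, hence so does the integral of every linear form in it. In
  -- the application k consists of the rounded logarithms of a point.
  balanced-linear : ∀ {n m} (v : Vector (Exponent n) m) {w : Vector Carrier m} {β : Exponent n} → Balanced v w β →
    ∀ (k : Vector Carrier n) →
    sum (λ i → w i * sum (λ j → k j * (fromℕ (lookup (v i) j) - fromℕ (lookup β j)))) ≈ 0#
  balanced-linear v {w} {β} balanced k = begin
    sum (λ i → w i * sum (λ j → k j * (V i j - B j)))
      ≈⟨ sum-cong-≋ (λ i → *-distribˡ-sum (w i) (λ j → k j * (V i j - B j))) ⟩
    sum (λ i → sum (λ j → w i * (k j * (V i j - B j))))
      ≈⟨ ∑-comm (λ i j → w i * (k j * (V i j - B j))) ⟩
    sum (λ j → sum (λ i → w i * (k j * (V i j - B j))))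
      ≈⟨ sum-zero (λ j → begin
        sum (λ i → w i * (k j * (V i j - B j)))
          ≈⟨ sum-cong-≋ (λ i → solve 4 (λ w k V B → w :* (k :* (V :- B)) := k :* (w :* V :- w :* B)) refl (w i) (k j) (V i j) (B j)) ⟩
        sum (λ i → k j * (w i * V i j - w i * B j))
          ≈⟨ *-distribˡ-sum (k j) (λ i → w i * V i j - w i * B j) ⟨
        k j * sum (λ i → w i * V i j - w i * B j)
          ≈⟨ *-congˡ (sum-difference (λ i → w i * V i j) (λ i → w i * B j)) ⟩
        k j * (sum (λ i → w i * V i j) - sum (λ i → w i * B j))
          ≈⟨ *-congˡ (+-cong (balanced j) (-‿cong (sym (*-distribʳ-sum (B j) w)))) ⟩
        k j * (sum w * B j - sum w * B j)
          ≈⟨ trans (*-congˡ (-‿inverseʳ _)) (zeroʳ _) ⟩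
        0# ∎) ⟩
    0# ∎
    where
    open ≈-Reasoning
    V = λ i j → fromℕ (lookup (v i) j)
    B = λ j → fromℕ (lookup β j)

  -- Rounding the logarithms of the coordinates of x to multiples of log z.
  record Rounding {n} (z : Carrier) (x : Vector Carrier n) : Set where
    field
      shift : ℕ
      log   : Vector ℕ n
      lower : ∀ j → z ^ log j ≤ z ^ shift * x j
      upper : ∀ j → z ^ shift * x j ≤ z ^ suc (log j)

  round : ∀ {n z} → 1# < z → (x : PositivePoint n) → Rounding z (point x)
  round {z = z} 1<z x = record
    { shift = B
    ; log   = λ j → proj₁ (floor-log 1<z (1≤z^B*x j))
    ; lower = λ j → proj₁ (proj₂ (floor-log 1<z (1≤z^B*x j)))
    ; upper = λ j → proj₂ (proj₂ (floor-log 1<z (1≤z^B*x j)))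
    }
    where
    open ≤-Reasoning
    -- The sum bounds every 1 / x_j, so one power z ^ B raises all coordinates to at least 1, and
    -- their rounded logarithms are naturals.
    bound = powers-unbounded 1<z (sum (inverses x))
    B = proj₁ bound
    1≤z^B*x : ∀ j → 1# ≤ z ^ B * point x j
    1≤z^B*x j = begin
      1#                          ≈⟨ point*inverses x j ⟨
      point x j * inverses x j    ≈⟨ *-comm _ _ ⟩
      inverses x j * point x j    ≤⟨ *-monoʳ-≤ (<⇒≤ (point-pos x j))
                                       (≤-trans (term≤sum (λ i → <⇒≤ (inverses-pos x i)) j) (proj₂ bound)) ⟩
      z ^ B * point x j           ∎

  module _ {n} {z : Carrier} (1<z : 1# < z) (x : PositivePoint n) (R : Rounding z (point x)) (β : Exponent n) where
    open Rounding R

    private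
      0<z = ≤-<-trans 0≤1 1<z
      degree = total-degree (lookup β)

      shifted rounded : Exponent n → ℕ
      shifted α = total-degree (λ j → shift ℕ.* lookup α j)
      rounded α = total-degree (λ j → log j ℕ.* lookup α j)

      shifted-monomial : ∀ α → monomial ℝ α (λ j → z ^ shift * point x j) ≈ z ^ shifted α * monomial ℝ α (point x)
      shifted-monomial α = trans (monomial-* α (λ _ → z ^ shift) (point x)) (*-congʳ (monomial-powers z α (λ _ → shift)))

      rounded-lower : ∀ α → z ^ rounded α ≤ z ^ shifted α * monomial ℝ α (point x)
      rounded-lower α = begin
        z ^ rounded α                                 ≈⟨ monomial-powers z α log ⟨
        monomial ℝ α (λ j → z ^ log j)                ≤⟨ monomial-mono α (λ j → ^-nonneg (log j) (<⇒≤ 0<z)) lower ⟩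
        monomial ℝ α (λ j → z ^ shift * point x j)    ≈⟨ shifted-monomial α ⟩
        z ^ shifted α * monomial ℝ α (point x)        ∎
        where open ≤-Reasoning

      -- Rounding loses at most a factor z in each coordinate, hence z ^ |β| in x ^ β. The monomials
      -- x ^ α lose nothing, as they are estimated from below.
      rounded-upper : z ^ shifted β * monomial ℝ β (point x) ≤ z ^ degree * z ^ rounded β
      rounded-upper = begin
        z ^ shifted β * monomial ℝ β (point x)
          ≈⟨ shifted-monomial β ⟨
        monomial ℝ β (λ j → z ^ shift * point x j)
          ≤⟨ monomial-mono β (λ j → <⇒≤ (*-pos (^-pos shift 0<z) (point-pos x j))) upper ⟩
        monomial ℝ β (λ j → z * z ^ log j)
          ≈⟨ monomial-* β (λ _ → z) (λ j → z ^ log j) ⟩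
        monomial ℝ β (λ _ → z) * monomial ℝ β (λ j → z ^ log j)
          ≈⟨ *-cong (product-powers z (lookup β)) (monomial-powers z β log) ⟩
        z ^ degree * z ^ rounded β ∎
        where open ≤-Reasoning

    slope : Vector Carrier n
    slope j = fromℕ (log j) - fromℕ shift

    -- The logarithm of x ^ (α - β) to base z, with the logarithms of the coordinates rounded down.
    displacement : Exponent n → Carrier
    displacement α = sum (λ j → slope j * (fromℕ (lookup α j) - fromℕ (lookup β j)))

    private
      -- The rounded logarithms may be negative. Multiplying crosswise by the shifts leaves a
      -- difference of two natural exponents, as `power-above-tangent` needs it.
      displacement-rounded : ∀ α → fromℕ (shifted β ℕ.+ rounded α) - fromℕ (shifted α ℕ.+ rounded β) ≈ displacement α
      displacement-rounded α = begin
        fromℕ (shifted β ℕ.+ rounded α) - fromℕ (shifted α ℕ.+ rounded β)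
          ≈⟨ +-cong (expand β α) (-‿cong (expand α β)) ⟩
        sum (term β α) - sum (term α β)
          ≈⟨ sum-difference (term β α) (term α β) ⟨
        sum (λ j → term β α j - term α β j)
          ≈⟨ sum-cong-≋ (λ j → solve 4 (λ S L a b → (S :* b :+ L :* a) :- (S :* a :+ L :* b) := (L :- S) :* (a :- b)) refl
               (fromℕ shift) (fromℕ (log j)) (fromℕ (lookup α j)) (fromℕ (lookup β j))) ⟩
        displacement α ∎
        where
        open ≈-Reasoning
        term : Exponent n → Exponent n → Vector Carrier n
        term γ δ j = fromℕ shift * fromℕ (lookup γ j) + fromℕ (log j) * fromℕ (lookup δ j)
        expand : ∀ γ δ → fromℕ (shifted γ ℕ.+ rounded δ) ≈ sum (term γ δ)
        expand γ δ = begin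
          fromℕ (shifted γ ℕ.+ rounded δ)
            ≈⟨ fromℕ-+ (shifted γ) (rounded δ) ⟩
          fromℕ (shifted γ) + fromℕ (rounded δ)
            ≈⟨ +-cong (fromℕ-total-degree (λ j → shift ℕ.* lookup γ j)) (fromℕ-total-degree (λ j → log j ℕ.* lookup δ j)) ⟩
          sum (λ j → fromℕ (shift ℕ.* lookup γ j)) + sum (λ j → fromℕ (log j ℕ.* lookup δ j))
            ≈⟨ ∑-distrib-+ (λ j → fromℕ (shift ℕ.* lookup γ j)) (λ j → fromℕ (log j ℕ.* lookup δ j)) ⟨
          sum (λ j → fromℕ (shift ℕ.* lookup γ j) + fromℕ (log j ℕ.* lookup δ j))
            ≈⟨ sum-cong-≋ (λ j → +-cong (×1-homo-* shift (lookup γ j)) (×1-homo-* (log j) (lookup δ j))) ⟩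
          sum (term γ δ) ∎

      monomial-above-tangent : ∀ α →
        monomial ℝ β (point x) * (1# + displacement α * (z - 1#)) ≤ z ^ degree * monomial ℝ α (point x)
      monomial-above-tangent α with total 0# (1# + displacement α * (z - 1#))
      -- A nonpositive tangent value needs no estimate; in the other case its sign allows
      -- `rounded-upper` to be multiplied by it.
      ... | inj₂ T≤0 = ≤-trans (*-monoˡ-≤ (<⇒≤ (monomial-pos β (point-pos x))) T≤0) (≤-trans (≤-reflexive (zeroʳ _))
              (<⇒≤ (*-pos (^-pos degree 0<z) (monomial-pos α (point-pos x)))))
      ... | inj₁ 0≤T = *-cancelˡ-≤ (*-pos (^-pos (shifted α) 0<z) (^-pos (shifted β) 0<z)) (begin
        (A * B) * (xβ * T)
          ≈⟨ solve 4 (λ A B x T → (A :* B) :* (x :* T) := A :* ((B :* x) :* T)) refl A B xβ T ⟩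
        A * ((B * xβ) * T)
          ≤⟨ *-monoˡ-≤ (^-nonneg (shifted α) (<⇒≤ 0<z)) (*-monoʳ-≤ 0≤T rounded-upper) ⟩
        A * ((N * Cβ) * T)
          ≈⟨ solve 5 (λ A N C d z → A :* ((N :* C) :* (con (1 , 0) :+ d :* (z :- con (1 , 0))))
               := N :* (A :* C :+ d :* ((A :* C) :* (z :- con (1 , 0))))) refl A N Cβ (displacement α) z ⟩
        N * (A * Cβ + displacement α * ((A * Cβ) * (z - 1#)))
          ≈⟨ *-congˡ (+-cong (^-homo-* z (shifted α) (rounded β)) (*-cong (displacement-rounded α)
               (*-congʳ (^-homo-* z (shifted α) (rounded β))))) ⟨
        N * (z ^ q + (fromℕ p - fromℕ q) * (z ^ q * (z - 1#)))
          ≤⟨ *-monoˡ-≤ (^-nonneg degree (<⇒≤ 0<z)) (power-above-tangent (<⇒≤ 0<z) p q) ⟩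
        N * z ^ p
          ≈⟨ *-congˡ (^-homo-* z (shifted β) (rounded α)) ⟩
        N * (B * z ^ rounded α)
          ≤⟨ *-monoˡ-≤ (^-nonneg degree (<⇒≤ 0<z)) (*-monoˡ-≤ (^-nonneg (shifted β) (<⇒≤ 0<z)) (rounded-lower α)) ⟩
        N * (B * (A * xα))
          ≈⟨ solve 4 (λ N B A x → N :* (B :* (A :* x)) := (A :* B) :* (N :* x)) refl N B A xα ⟩
        (A * B) * (N * xα) ∎)
        where
        open ≤-Reasoning
        p = shifted β ℕ.+ rounded α
        q = shifted α ℕ.+ rounded β
        T = 1# + displacement α * (z - 1#)
        A = z ^ shifted α
        B = z ^ shifted β
        Cβ = z ^ rounded β
        N = z ^ degree
        xα = monomial ℝ α (point x)
        xβ = monomial ℝ β (point x)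

    ratio-above-tangent : ∀ α → 1# + displacement α * (z - 1#) ≤ z ^ degree * ratio α β x
    ratio-above-tangent α = begin
      T                                                       ≈⟨ *-identityˡ T ⟨
      1# * T                                                  ≈⟨ *-congʳ (monomial-inverse β x) ⟨
      (xβ * x⁻β) * T                                          ≈⟨ solve 3 (λ a b t → (a :* b) :* t := (a :* t) :* b) refl xβ x⁻β T ⟩
      (xβ * T) * x⁻β                                          ≤⟨ *-monoʳ-≤ (<⇒≤ (monomial-pos β (inverses-pos x))) (monomial-above-tangent α) ⟩
      (z ^ degree * monomial ℝ α (point x)) * x⁻β             ≈⟨ *-assoc _ _ _ ⟩
      z ^ degree * ratio α β x                                ∎
      where
      open ≤-Reasoning
      T = 1# + displacement α * (z - 1#)
      xβ = monomial ℝ β (point x)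
      x⁻β = monomial ℝ β (inverses x)

  -- In the weighted sum of the tangent bounds the linear parts cancel, as w is balanced. What
  -- remains is Σ w ≤ z ^ N A. The rounding of x changes with z, but N = |β| does not, so the error
  -- factor tends to 1.
  weighted-AM-GM : ∀ {n m} (v : Vector (Exponent n) m) {w : Vector Carrier m} {β : Exponent n} →
    (∀ i → 0# ≤ w i) → Balanced v w β → ∀ x → sum w ≤ sum (λ i → w i * ratio (v i) β x)
  weighted-AM-GM {n} {m} v {w} {β} 0≤w balanced x =
    ≤-limit (A * (fromℕ N + K)) (*-nonneg 0≤A (+-nonneg (fromℕ-nonneg N) 0≤K)) estimate
    where
    N = total-degree (lookup β)
    A = sum (λ i → w i * ratio (v i) β x)
    0≤A : 0# ≤ A
    0≤A = sum-nonneg (λ i → *-nonneg (0≤w i) (<⇒≤ (ratio-pos (v i) β x)))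
    K = proj₁ (power-expansion N)
    0≤K = proj₁ (proj₂ (power-expansion N))

    estimate : ∀ ε → 0# < ε → ε < 1# → sum w ≤ A + ε * (A * (fromℕ N + K))
    estimate ε 0<ε ε<1 = begin
      sum w
        ≈⟨ trans (+-congˡ (trans (*-congʳ (balanced-linear v {β = β} balanced (slope 1<z x R β))) (zeroˡ _))) (+-identityʳ _) ⟨
      sum w + sum (λ i → w i * δ i) * (z - 1#)
        ≈⟨ +-congˡ (*-distribʳ-sum (z - 1#) (λ i → w i * δ i)) ⟩
      sum w + sum (λ i → (w i * δ i) * (z - 1#))
        ≈⟨ ∑-distrib-+ w (λ i → (w i * δ i) * (z - 1#)) ⟨
      sum (λ i → w i + (w i * δ i) * (z - 1#))
        ≈⟨ sum-cong-≋ (λ i → solve 3 (λ w d z → w :+ (w :* d) :* (z :- con (1 , 0)) := w :* (con (1 , 0) :+ d :* (z :- con (1 , 0)))) refl (w i) (δ i) z) ⟩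
      sum (λ i → w i * (1# + δ i * (z - 1#)))
        ≤⟨ sum-mono (λ i → *-monoˡ-≤ (0≤w i) (ratio-above-tangent 1<z x R β (v i))) ⟩
      sum (λ i → w i * (z ^ N * ratio (v i) β x))
        ≈⟨ sum-cong-≋ (λ i → solve 3 (λ w z r → w :* (z :* r) := z :* (w :* r)) refl (w i) (z ^ N) (ratio (v i) β x)) ⟩
      sum (λ i → z ^ N * (w i * ratio (v i) β x))
        ≈⟨ *-distribˡ-sum (z ^ N) (λ i → w i * ratio (v i) β x) ⟨
      z ^ N * A
        ≤⟨ *-monoʳ-≤ 0≤A (proj₂ (proj₂ (power-expansion N)) ε (<⇒≤ (+-pos-nonneg 0<1 (<⇒≤ 0<ε))) (<⇒≤ ε<1)) ⟩
      ((1# + fromℕ N * ε) + K * (ε * ε)) * A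
        ≤⟨ ≤-by-gap (((K * ε) * (1# - ε)) * A)
             (*-nonneg (*-nonneg (*-nonneg 0≤K (<⇒≤ 0<ε)) (gap-nonneg (<⇒≤ ε<1))) 0≤A)
             (solve 4 (λ N K e A → ((con (1 , 0) :+ N :* e) :+ K :* (e :* e)) :* A :+ ((K :* e) :* (con (1 , 0) :- e)) :* A
               := A :+ e :* (A :* (N :+ K))) refl (fromℕ N) K ε A) ⟩
      A + ε * (A * (fromℕ N + K)) ∎
      where
      open ≤-Reasoning
      z = 1# + ε
      1<z = x<x+e 0<ε
      R = round 1<z x
      δ = λ i → displacement 1<z x R β (v i)

  -- First-order conditions and minimisers in the closure

  -- At t = 1 both sides equal Σ w, so their derivatives agree there. `first-order` bounds t ^ b
  -- from below by its tangent and t ^ a_i from above to second order; t = 1 - ε and t = 1 + ε give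
  -- the two inequalities up to ε K.
  stationary : ∀ {m} (w : Vector Carrier m) (a : Vector ℕ m) b → (∀ i → 0# ≤ w i) →
    (∀ t → 0# < t → sum w * t ^ b ≤ sum (λ i → w i * t ^ a i)) →
    sum (λ i → w i * fromℕ (a i)) ≈ sum w * fromℕ b
  stationary w a b 0≤w minimal = antisym
    (≤-limit K 0≤K λ ε 0<ε ε<1 → *-cancelˡ-≤ 0<ε (begin
      ε * A                               ≈⟨ solve 3 (λ e A WB → e :* A := ((:- e) :* WB) :+ (e :* A :+ e :* WB)) refl ε A WB ⟩
      (- ε) * WB + (ε * A + ε * WB)       ≤⟨ +-monoˡ-≤ _ _ _ (first-order (- ε) (gap-pos ε<1)
                                               (≤-trans (neg-nonpos (<⇒≤ 0<ε)) 0≤1)) ⟩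
      ((- ε) * A + (- ε * - ε) * K) + (ε * A + ε * WB)
                                          ≈⟨ solve 4 (λ e A WB K → ((:- e) :* A :+ (:- e :* :- e) :* K) :+ (e :* A :+ e :* WB) := e :* (WB :+ e :* K)) refl ε A WB K ⟩
      ε * (WB + ε * K)                    ∎))
    (≤-limit K 0≤K λ ε 0<ε ε<1 → *-cancelˡ-≤ 0<ε (begin
      ε * WB                              ≤⟨ first-order ε (+-pos-nonneg 0<1 (<⇒≤ 0<ε)) (<⇒≤ ε<1) ⟩
      ε * A + (ε * ε) * K                 ≈⟨ solve 3 (λ e A K → e :* A :+ (e :* e) :* K := e :* (A :+ e :* K)) refl ε A K ⟩
      ε * (A + ε * K)                     ∎))
    where
    open ≤-Reasoning
    W = sum w
    WB = W * fromℕ b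
    A = sum (λ i → w i * fromℕ (a i))
    Kᵢ = λ i → proj₁ (power-expansion (a i))
    K = sum (λ i → w i * Kᵢ i)
    0≤K : 0# ≤ K
    0≤K = sum-nonneg λ i → *-nonneg (0≤w i) (proj₁ (proj₂ (power-expansion (a i))))

    first-order : ∀ h → 0# < 1# + h → h ≤ 1# → h * WB ≤ h * A + (h * h) * K
    first-order h 0<t h≤1 = begin
      h * WB
        ≈⟨ solve 3 (λ h W b → h :* (W :* b) := :- W :+ W :* (con (1 , 0) :+ (b :- con (0 , 0)) :* (con (1 , 0) :* ((con (1 , 0) :+ h) :- con (1 , 0))))) refl h W (fromℕ b) ⟩
      -- This shape is the left-hand side of `power-above-tangent` at q = 0.
      - W + W * (1# + (fromℕ b - 0#) * (1# * ((1# + h) - 1#)))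
        ≤⟨ +-mono-≤ ≤-refl (*-monoˡ-≤ (sum-nonneg 0≤w) (power-above-tangent (<⇒≤ 0<t) b 0)) ⟩
      - W + W * (1# + h) ^ b
        ≤⟨ +-mono-≤ ≤-refl (minimal (1# + h) 0<t) ⟩
      - W + sum (λ i → w i * (1# + h) ^ a i)
        ≤⟨ +-mono-≤ ≤-refl (sum-mono (λ i → *-monoˡ-≤ (0≤w i) (proj₂ (proj₂ (power-expansion (a i))) h (<⇒≤ 0<t) h≤1))) ⟩
      - W + sum (λ i → w i * ((1# + fromℕ (a i) * h) + Kᵢ i * (h * h)))
        ≈⟨ +-congˡ (sum-cong-≋ (λ i → solve 4 (λ w a K h → w :* ((con (1 , 0) :+ a :* h) :+ K :* (h :* h)) := w :+ (h :* (w :* a) :+ (h :* h) :* (w :* K))) refl (w i) (fromℕ (a i)) (Kᵢ i) h)) ⟩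
      - W + sum (λ i → w i + (h * (w i * fromℕ (a i)) + (h * h) * (w i * Kᵢ i)))
        ≈⟨ +-congˡ (trans (∑-distrib-+ w _) (+-congˡ (trans (∑-distrib-+ (λ i → h * (w i * fromℕ (a i))) _)
             (sym (+-cong (*-distribˡ-sum h (λ i → w i * fromℕ (a i))) (*-distribˡ-sum (h * h) (λ i → w i * Kᵢ i))))))) ⟩
      - W + (W + (h * A + (h * h) * K))
        ≈⟨ solve 2 (λ W s → :- W :+ (W :+ s) := s) refl W (h * A + (h * h) * K) ⟩
      h * A + (h * h) * K ∎

  coordinate : ∀ {n} → Fin n → Carrier → Vector Carrier n
  coordinate j t i with i ≟ᶠ j
  ... | yes _ = t
  ... | no  _ = 1#

  coordinate-at : ∀ {n} (j : Fin n) t → coordinate j t j ≡ t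
  coordinate-at j t with j ≟ᶠ j
  ... | yes _   = ≡.refl
  ... | no  j≢j = contradiction ≡.refl j≢j

  coordinate-off : ∀ {n} (j : Fin n) t i → ¬ i ≡ j → coordinate j t i ≡ 1#
  coordinate-off j t i i≢j with i ≟ᶠ j
  ... | yes i≡j = contradiction i≡j i≢j
  ... | no  _   = ≡.refl

  coordinate-pos : ∀ {n} (j : Fin n) {t} → 0# < t → ∀ i → 0# < coordinate j t i
  coordinate-pos j 0<t i with i ≟ᶠ j
  ... | yes _ = 0<t
  ... | no  _ = 0<1

  monomial-coordinate : ∀ {n} (α : Exponent n) j t → monomial ℝ α (coordinate j t) ≈ t ^ lookup α j
  monomial-coordinate α j t = trans
    (product-single j (λ i i≢j → trans (^-congˡ (lookup α i) (reflexive (coordinate-off j t i i≢j))) (1^k≈1 (lookup α i))))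
    (^-congˡ (lookup α j) (reflexive (coordinate-at j t)))

  -- Varying a single coordinate suffices: the point with t at j and 1 elsewhere, and multiplication
  -- by t ^ β_j, lead to one variable.
  minimal-at-one⇒balanced : ∀ {n m} (v : Vector (Exponent n) m) (w : Vector Carrier m) (β : Exponent n) → (∀ i → 0# ≤ w i) →
    (∀ x → sum w ≤ sum (λ i → w i * ratio (v i) β x)) → Balanced v w β
  minimal-at-one⇒balanced v w β 0≤w minimal j = stationary w (λ i → lookup (v i) j) (lookup β j) 0≤w λ t 0<t →
    let x = fromPositive (coordinate j t) (coordinate-pos j 0<t) in begin
      sum w * t ^ lookup β j
        ≤⟨ *-monoʳ-≤ (^-nonneg (lookup β j) (<⇒≤ 0<t)) (minimal x) ⟩
      sum (λ i → w i * ratio (v i) β x) * t ^ lookup β j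
        ≈⟨ *-distribʳ-sum _ (λ i → w i * ratio (v i) β x) ⟩
      sum (λ i → (w i * ratio (v i) β x) * t ^ lookup β j)
        ≈⟨ sum-cong-≋ (λ i → trans (*-assoc _ _ _) (*-congˡ (trans (*-congˡ (sym (monomial-coordinate β j t)))
             (trans (ratio*monomial (v i) β x) (monomial-coordinate (v i) j t))))) ⟩
      sum (λ i → w i * t ^ lookup (v i) j) ∎
    where open ≤-Reasoning

  -- A minimiser of Σ c x ^ (v - β) over the positive orthant need not exist, but
  -- one does in the closure of the set of points (x ^ (v i - β))ᵢ, and that set is
  -- invariant under scaling x.
  record ClosureMinimiser {n m} (v : Vector (Exponent n) m) (c : Vector Carrier m) (β : Exponent n) (D : Carrier) : Set where
    field
      minimiser   : Vector Carrier m
      nonneg      : ∀ i → 0# ≤ minimiser i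
      approximate : ∀ ε → 0# < ε → ∃[ x ] (∀ i → Close ε (ratio (v i) β x) (minimiser i))
      bound       : D ≤ sum (λ i → c i * minimiser i)
      minimal     : ∀ x → sum (λ i → c i * minimiser i) ≤ sum (λ i → (c i * minimiser i) * ratio (v i) β x)

  closure-minimiser : ∀ {n m} (v : Vector (Exponent n) m) (c : Vector Carrier m) (β : Exponent n) D →
    (∀ i → 0# < c i) → (∀ x → D ≤ sum (λ i → c i * ratio (v i) β x)) → ClosureMinimiser v c β D
  closure-minimiser {n} {m} v c β D 0<c lower-bound = record
    { minimiser   = z
    ; nonneg      = λ i → ≤-limit 1# 0≤1 λ ε 0<ε _ → let (x , _ , close) = near ε 0<ε in
        ≤-trans (<⇒≤ (ratio-pos (v i) β x)) (≤-trans (proj₁ (close i)) (+-mono-≤ ≤-refl (≤-reflexive (sym (*-identityʳ ε)))))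
    ; approximate = λ ε 0<ε → let (x , _ , close) = near ε 0<ε in x , close
    ; bound       = ≤-trans (proj₁ (proj₂ infimum) D lower-bound) M≤value-z
    ; minimal     = λ x → ≤-trans value-z≤M (M≤value-z*ratio x)
    }
    where
    open ≤-Reasoning
    value : PositivePoint n → Carrier
    value x = sum (λ i → c i * ratio (v i) β x)

    one : PositivePoint n
    one = fromPositive (λ _ → 1#) (λ _ → 0<1)

    infimum = supremum (λ t → ∀ x → t ≤ value x) (D , lower-bound) (value one , λ t t≤value → t≤value one)
    M = proj₁ infimum

    M≤value : ∀ x → M ≤ value x
    M≤value x = proj₂ (proj₂ infimum) (value x) (λ t t≤value → t≤value x)

    almost-minimal : ∀ ε → 0# < ε → ∃[ x ] value x ≤ M + ε
    almost-minimal ε 0<ε with em {∃[ x ] value x ≤ M + ε}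
    ... | yes found = found
    ... | no none = contradiction (proj₁ (proj₂ infimum) (M + ε) (λ x → <⇒≤ (≰⇒> λ value≤ → none (x , value≤))))
                      (<⇒≱ (x<x+e 0<ε))

    c⁻¹ : Vector Carrier m
    c⁻¹ i = recip (c i) (0<c i)

    -- Compactness comes from c i > 0: where the value is at most M + 1, so is each term. The sum is
    -- one bound for all i, as `cluster-point` requires.
    ratio-bounded : ∀ i x → value x ≤ M + 1# → ratio (v i) β x ≤ sum (λ i → c⁻¹ i * (M + 1#))
    ratio-bounded i x value≤ = begin
      ratio (v i) β x
        ≈⟨ *-identityˡ _ ⟨
      1# * ratio (v i) β x
        ≈⟨ *-congʳ (recip-inverseˡ (0<c i)) ⟨
      (c⁻¹ i * c i) * ratio (v i) β x
        ≈⟨ *-assoc _ _ _ ⟩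
      c⁻¹ i * (c i * ratio (v i) β x)
        ≤⟨ *-monoˡ-≤ (<⇒≤ (recip-pos (0<c i)))
             (≤-trans (term≤sum (λ i → *-nonneg (<⇒≤ (0<c i)) (<⇒≤ (ratio-pos (v i) β x))) i) value≤) ⟩
      c⁻¹ i * (M + 1#)
        ≤⟨ term≤sum (λ i → *-nonneg (<⇒≤ (recip-pos (0<c i)))
             (≤-trans (sum-nonneg (λ i → *-nonneg (<⇒≤ (0<c i)) (<⇒≤ (ratio-pos (v i) β x)))) value≤)) i ⟩
      sum (λ i → c⁻¹ i * (M + 1#)) ∎

    cluster = cluster-point (λ ε x → value x ≤ M + ε) (λ ε≤ε′ value≤ → ≤-trans value≤ (+-mono-≤ ≤-refl ε≤ε′))
      almost-minimal (λ i x → ratio (v i) β x) (sum (λ i → c⁻¹ i * (M + 1#)))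
      (λ i x value≤ → <⇒≤ (ratio-pos (v i) β x) , ratio-bounded i x value≤)
    z = proj₁ cluster
    near = proj₂ cluster

    sum-near : ∀ {a b w : Vector Carrier m} ε → (∀ i → 0# ≤ w i) → (∀ i → a i ≤ b i + ε) →
      sum (λ i → w i * a i) ≤ sum (λ i → w i * b i) + ε * sum w
    sum-near {a} {b} {w} ε 0≤w a≤b+ε = begin
      sum (λ i → w i * a i)                     ≤⟨ sum-mono (λ i → *-monoˡ-≤ (0≤w i) (a≤b+ε i)) ⟩
      sum (λ i → w i * (b i + ε))               ≈⟨ sum-cong-≋ (λ i → solve 3 (λ w b e → w :* (b :+ e) := w :* b :+ e :* w) refl (w i) (b i) ε) ⟩
      sum (λ i → w i * b i + ε * w i)           ≈⟨ ∑-distrib-+ (λ i → w i * b i) (λ i → ε * w i) ⟩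
      sum (λ i → w i * b i) + sum (λ i → ε * w i) ≈⟨ +-congˡ (*-distribˡ-sum ε w) ⟨
      sum (λ i → w i * b i) + ε * sum w         ∎

    0≤c = λ i → <⇒≤ (0<c i)

    M≤value-z : M ≤ sum (λ i → c i * z i)
    M≤value-z = ≤-limit (sum c) (sum-nonneg 0≤c) λ ε 0<ε _ → let (x , _ , close) = near ε 0<ε in
      ≤-trans (M≤value x) (sum-near ε 0≤c (λ i → proj₁ (close i)))

    value-z≤M : sum (λ i → c i * z i) ≤ M
    value-z≤M = ≤-limit (1# + sum c) (+-nonneg 0≤1 (sum-nonneg 0≤c)) λ ε 0<ε _ → let (x , value≤ , close) = near ε 0<ε in begin
      sum (λ i → c i * z i)       ≤⟨ sum-near ε 0≤c (λ i → proj₂ (close i)) ⟩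
      value x + ε * sum c         ≤⟨ +-monoˡ-≤ _ _ _ value≤ ⟩
      (M + ε) + ε * sum c         ≈⟨ solve 3 (λ M e C → (M :+ e) :+ e :* C := M :+ e :* (con (1 , 0) :+ C)) refl M ε (sum c) ⟩
      M + ε * (1# + sum c)        ∎

    -- If the ratios at y approximate z, those at x ⊛ y are their products with the ratios at x. The
    -- lower bound M at x ⊛ y then passes to the limit in y.
    M≤value-z*ratio : ∀ x → M ≤ sum (λ i → (c i * z i) * ratio (v i) β x)
    M≤value-z*ratio x = ≤-limit (sum r) (sum-nonneg 0≤r) λ ε 0<ε _ → let (y , _ , close) = near ε 0<ε in begin
      M
        ≤⟨ M≤value (x ⊛ y) ⟩
      sum (λ i → c i * ratio (v i) β (x ⊛ y))
        ≈⟨ sum-cong-≋ (λ i → trans (*-congˡ (ratio-⊛ (v i) β x y)) (sym (*-assoc _ _ _))) ⟩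
      sum (λ i → r i * ratio (v i) β y)
        ≤⟨ sum-near ε 0≤r (λ i → proj₁ (close i)) ⟩
      sum (λ i → r i * z i) + ε * sum r
        ≈⟨ +-congʳ (sum-cong-≋ (λ i → solve 3 (λ c r z → (c :* r) :* z := (c :* z) :* r) refl (c i) (ratio (v i) β x) (z i))) ⟩
      sum (λ i → (c i * z i) * ratio (v i) β x) + ε * sum r ∎
      where
      r : Vector Carrier m
      r i = c i * ratio (v i) β x
      0≤r : ∀ i → 0# ≤ r i
      0≤r i = *-nonneg (0≤c i) (<⇒≤ (ratio-pos (v i) β x))

  -- AM-GM at x / y, as the ratios at y tend to z.
  recentred-AM-GM : ∀ {n m} (v : Vector (Exponent n) m) {w : Vector Carrier m} {β : Exponent n} {z u : Vector Carrier m} →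
    (∀ i → 0# ≤ w i) → Balanced v w β → (∀ i → 0# ≤ u i) → (∀ i → z i * u i ≈ 1#) →
    (∀ ε → 0# < ε → ∃[ x ] (∀ i → Close ε (ratio (v i) β x) (z i))) →
    ∀ x → sum w ≤ sum (λ i → (w i * u i) * ratio (v i) β x)
  recentred-AM-GM {m = m} v {w} {β} {z} {u} 0≤w balanced 0≤u zu≈1 near x =
    ≤-limit (sum u * sum w) (*-nonneg (sum-nonneg 0≤u) (sum-nonneg 0≤w)) λ ε 0<ε _ →
    estimate ε 0<ε
    where
    open ≤-Reasoning
    S = sum w
    U = sum u
    L = sum (λ i → (w i * u i) * ratio (v i) β x)
    0≤S = sum-nonneg 0≤w
    0≤L : 0# ≤ L
    0≤L = sum-nonneg (λ i → *-nonneg (*-nonneg (0≤w i) (0≤u i)) (<⇒≤ (ratio-pos (v i) β x)))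

    estimate : ∀ ε → 0# < ε → S ≤ L + ε * (U * S)
    estimate ε 0<ε with total 0# (1# - ε * U)
    -- Here ε U ≥ 1, and the error term alone is at least S.
    ... | inj₂ 1-εU≤0 = ≤-by-gap (L + (- (1# - ε * U)) * S) (+-nonneg 0≤L (*-nonneg (neg-nonneg 1-εU≤0) 0≤S))
            (solve 4 (λ S L e U → S :+ (L :+ (:- (con (1 , 0) :- e :* U)) :* S) := L :+ e :* (U :* S)) refl S L ε U)
    ... | inj₁ 0≤1-εU = begin
      S
        ≈⟨ solve 3 (λ S e U → S := (con (1 , 0) :- e :* U) :* S :+ e :* (U :* S)) refl S ε U ⟩
      (1# - ε * U) * S + ε * (U * S)
        ≤⟨ +-monoˡ-≤ _ _ _ (*-monoˡ-≤ 0≤1-εU (weighted-AM-GM v {β = β} 0≤w balanced (x ⊛ reciprocal y))) ⟩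
      (1# - ε * U) * sum (λ i → w i * ratio (v i) β (x ⊛ reciprocal y)) + ε * (U * S)
        ≈⟨ +-congʳ (*-distribˡ-sum (1# - ε * U) (λ i → w i * ratio (v i) β (x ⊛ reciprocal y))) ⟩
      sum (λ i → (1# - ε * U) * (w i * ratio (v i) β (x ⊛ reciprocal y))) + ε * (U * S)
        ≤⟨ +-monoˡ-≤ _ _ _ (sum-mono termwise) ⟩
      L + ε * (U * S) ∎
      where
      y = proj₁ (near ε 0<ε)
      close = proj₂ (near ε 0<ε)
      p = λ i → ratio (v i) β y
      q = λ i → ratio (v i) β (reciprocal y)
      0≤q = λ i → <⇒≤ (ratio-pos (v i) β (reciprocal y))

      -- From z ≤ p + ε follows 1 - ε u ≤ p u, since z u = 1; multiplication by q = 1 / p leaves u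
      -- on the right. No lower bound on p is involved.
      q-bound : ∀ i → (1# - ε * U) * q i ≤ u i
      q-bound i = begin
        (1# - ε * U) * q i
          ≤⟨ *-monoʳ-≤ (0≤q i) (≤-by-gap (ε * (U - u i)) (*-nonneg (<⇒≤ 0<ε) (gap-nonneg (term≤sum 0≤u i)))
               (solve 3 (λ e U u → (con (1 , 0) :- e :* U) :+ e :* (U :- u) := con (1 , 0) :- e :* u) refl ε U (u i))) ⟩
        (1# - ε * u i) * q i
          ≈⟨ *-congʳ (+-congʳ (zu≈1 i)) ⟨
        (z i * u i - ε * u i) * q i
          ≤⟨ *-monoʳ-≤ (0≤q i) (+-monoˡ-≤ _ _ _ (*-monoʳ-≤ (0≤u i) (proj₂ (close i)))) ⟩
        ((p i + ε) * u i - ε * u i) * q i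
          ≈⟨ solve 4 (λ p e u q → ((p :+ e) :* u :- e :* u) :* q := (p :* q) :* u) refl (p i) ε (u i) (q i) ⟩
        (p i * q i) * u i
          ≈⟨ trans (*-congʳ (ratio-reciprocal (v i) β y)) (*-identityˡ (u i)) ⟩
        u i ∎

      termwise : ∀ i → (1# - ε * U) * (w i * ratio (v i) β (x ⊛ reciprocal y)) ≤ (w i * u i) * ratio (v i) β x
      termwise i = begin
        (1# - ε * U) * (w i * ratio (v i) β (x ⊛ reciprocal y))
          ≈⟨ *-congˡ (*-congˡ (ratio-⊛ (v i) β x (reciprocal y))) ⟩
        (1# - ε * U) * (w i * (ratio (v i) β x * q i))
          ≈⟨ solve 4 (λ d w r q → d :* (w :* (r :* q)) := (w :* (d :* q)) :* r) refl (1# - ε * U) (w i) (ratio (v i) β x) (q i) ⟩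
        (w i * ((1# - ε * U) * q i)) * ratio (v i) β x
          ≤⟨ *-monoʳ-≤ (<⇒≤ (ratio-pos (v i) β x)) (*-monoˡ-≤ (0≤w i) (q-bound i)) ⟩
        (w i * u i) * ratio (v i) β x ∎

  -- Carathéodory decomposition

  ∑ᴸ : ∀ {A : Set} → (A → Carrier) → List A → Carrier
  ∑ᴸ g []       = 0#
  ∑ᴸ g (x ∷ xs) = g x + ∑ᴸ g xs

  ∑ᴸ-++ : ∀ {A : Set} (g : A → Carrier) xs ys → ∑ᴸ g (xs ++ ys) ≈ ∑ᴸ g xs + ∑ᴸ g ys
  ∑ᴸ-++ g []       ys = sym (+-identityˡ _)
  ∑ᴸ-++ g (x ∷ xs) ys = trans (+-congˡ (∑ᴸ-++ g xs ys)) (sym (+-assoc _ _ _))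

  ∑ᴸ-cong : ∀ {A : Set} {g h : A → Carrier} → (∀ x → g x ≈ h x) → ∀ xs → ∑ᴸ g xs ≈ ∑ᴸ h xs
  ∑ᴸ-cong g≈h []       = refl
  ∑ᴸ-cong g≈h (x ∷ xs) = +-cong (g≈h x) (∑ᴸ-cong g≈h xs)

  ∑ᴸ-map : ∀ {A B : Set} (g : B → Carrier) (k : A → B) xs → ∑ᴸ g (map k xs) ≈ ∑ᴸ (λ x → g (k x)) xs
  ∑ᴸ-map g k []       = refl
  ∑ᴸ-map g k (x ∷ xs) = +-congˡ (∑ᴸ-map g k xs)

  *-distribˡ-∑ᴸ : ∀ {A : Set} t (g : A → Carrier) xs → t * ∑ᴸ g xs ≈ ∑ᴸ (λ x → t * g x) xs
  *-distribˡ-∑ᴸ t g []       = zeroʳ t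
  *-distribˡ-∑ᴸ t g (x ∷ xs) = trans (distribˡ _ _ _) (+-congˡ (*-distribˡ-∑ᴸ t g xs))

  argmax : ∀ {m} (g : Vector Carrier (suc m)) → ∃[ i ] (∀ j → g j ≤ g i)
  argmax {zero}  g = zero , λ { zero → ≤-refl }
  argmax {suc m} g with argmax (λ i → g (suc i))
  ... | i , g≤gi with total (g zero) (g (suc i))
  ...   | inj₁ g0≤gi = suc i , λ { zero → g0≤gi ; (suc j) → g≤gi j }
  ...   | inj₂ gi≤g0 = zero , λ { zero → ≤-refl ; (suc j) → ≤-trans (g≤gi j) gi≤g0 }

  positive-entry : ∀ {m} (μ : Vector Carrier m) → sum μ ≈ 0# → ∃[ i ] ¬ μ i ≈ 0# → ∃[ i ] 0# < μ i
  positive-entry μ sum≈0 (i , μi≉0) with em {∃[ i ] 0# < μ i}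
  ... | yes found = found
  ... | no none = contradiction (antisym (μ≤0 i) (begin
      0#                              ≈⟨ sum≈0 ⟨
      sum μ                           ≈⟨ solve 2 (λ m s → s := m :+ (:- m :- :- s)) refl (μ i) (sum μ) ⟩
      μ i + (- μ i - - sum μ)         ≈⟨ +-congˡ (+-congˡ (-‿cong (sum-neg μ))) ⟨
      μ i + (- μ i - sum (λ i → - μ i)) ≤⟨ +-mono-≤ ≤-refl (+-monoˡ-≤ _ _ _ (term≤sum (λ i → neg-nonneg (μ≤0 i)) i)) ⟩
      μ i + (sum (λ i → - μ i) - sum (λ i → - μ i)) ≈⟨ trans (+-congˡ (-‿inverseʳ _)) (+-identityʳ _) ⟩
      μ i                             ∎)) μi≉0
    where
    open ≤-Reasoning
    μ≤0 : ∀ i → μ i ≤ 0#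
    μ≤0 i = ≮⇒≥ λ 0<μi → none (i , 0<μi)

  -- The ratio test: for t = 1 / max (μ i / ν i), a coordinate attaining the maximum is among the
  -- first to reach zero.
  maximal-step : ∀ {m} (ν μ : Vector Carrier (suc m)) → (∀ i → 0# < ν i) → ∃[ i ] 0# < μ i →
    ∃[ t ] 0# < t × (∀ i → 0# ≤ ν i - t * μ i) × ∃[ i ] ν i - t * μ i ≈ 0#
  maximal-step ν μ 0<ν (i₀ , 0<μi₀) = t , recip-pos 0<rᵢ , nonneg , i , (begin
      ν i - t * μ i                   ≈⟨ +-congˡ (-‿cong (*-congˡ (r*ν≈μ i))) ⟨
      ν i - t * (r i * ν i)           ≈⟨ +-congˡ (-‿cong (*-assoc _ _ _)) ⟨
      ν i - (t * r i) * ν i           ≈⟨ +-congˡ (-‿cong (trans (*-congʳ (recip-inverseˡ 0<rᵢ)) (*-identityˡ _))) ⟩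
      ν i - ν i                       ≈⟨ -‿inverseʳ _ ⟩
      0#                              ∎)
    where
    open ≈-Reasoning
    r = λ i → μ i * recip (ν i) (0<ν i)
    r*ν≈μ : ∀ i → r i * ν i ≈ μ i
    r*ν≈μ i = trans (*-assoc _ _ _) (trans (*-congˡ (recip-inverseˡ (0<ν i))) (*-identityʳ _))
    i = proj₁ (argmax r)
    r≤rᵢ = proj₂ (argmax r)
    0<rᵢ : 0# < r i
    0<rᵢ = <-≤-trans (*-pos 0<μi₀ (recip-pos (0<ν i₀))) (r≤rᵢ i₀)
    t = recip (r i) 0<rᵢ
    nonneg : ∀ j → 0# ≤ ν j - t * μ j
    nonneg j = ≤-trans (*-nonneg (<⇒≤ (0<ν j)) (gap-nonneg (*-monoˡ-≤ (<⇒≤ (recip-pos 0<rᵢ)) (r≤rᵢ j)))) (≤-reflexive (begin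
      ν j * (t * r i - t * r j)       ≈⟨ *-congˡ (+-congʳ (recip-inverseˡ 0<rᵢ)) ⟩
      ν j * (1# - t * r j)            ≈⟨ solve 3 (λ n t r → n :* (con (1 , 0) :- t :* r) := n :- t :* (r :* n)) refl (ν j) t (r j) ⟩
      ν j - t * (r j * ν j)           ≈⟨ +-congˡ (-‿cong (*-congˡ (r*ν≈μ j))) ⟩
      ν j - t * μ j                   ∎))

  sum-step : ∀ {m} (ν μ : Vector Carrier m) t (g : Vector Carrier m) →
    sum (λ i → (ν i - t * μ i) * g i) ≈ sum (λ i → ν i * g i) - t * sum (λ i → μ i * g i)
  sum-step ν μ t g = trans
    (sum-cong-≋ (λ i → solve 4 (λ n t m g → (n :- t :* m) :* g := n :* g :- t :* (m :* g)) refl (ν i) t (μ i) (g i)))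
    (trans (sum-difference (λ i → ν i * g i) (λ i → t * (μ i * g i)))
      (+-congˡ (-‿cong (sym (*-distribˡ-sum t (λ i → μ i * g i))))))

  balanced-step : ∀ {n m} (v : Vector (Exponent n) m) (ν μ : Vector Carrier m) (β : Exponent n) t → Balanced v ν β →
    sum μ ≈ 0# → (∀ j → sum (λ i → μ i * fromℕ (lookup (v i) j)) ≈ 0#) → Balanced v (λ i → ν i - t * μ i) β
  balanced-step v ν μ β t balanced sum≈0 dot≈0 j = begin
    sum (λ i → (ν i - t * μ i) * V i)                 ≈⟨ sum-step ν μ t V ⟩
    sum (λ i → ν i * V i) - t * sum (λ i → μ i * V i) ≈⟨ +-cong (balanced j) (-‿cong (*-congˡ (dot≈0 j))) ⟩
    sum ν * B - t * 0#                                ≈⟨ +-congˡ (-‿cong (zeroʳ t)) ⟩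
    sum ν * B - 0#                                    ≈⟨ solve 2 (λ s B → s :* B :- con (0 , 0) := (s :- con (0 , 0)) :* B) refl (sum ν) B ⟩
    (sum ν - 0#) * B                                  ≈⟨ *-congʳ (+-congˡ (-‿cong (trans (*-congˡ sum≈0) (zeroʳ t)))) ⟨
    (sum ν - t * sum μ) * B                           ≈⟨ *-congʳ (+-congˡ (-‿cong (*-distribˡ-sum t μ))) ⟩
    (sum ν - sum (λ i → t * μ i)) * B                 ≈⟨ *-congʳ (sum-difference ν (λ i → t * μ i)) ⟨
    sum (λ i → ν i - t * μ i) * B                     ∎
    where
    open ≈-Reasoning
    V = λ i → fromℕ (lookup (v i) j)
    B = fromℕ (lookup β j)

  balanced-scale : ∀ {n m} (v : Vector (Exponent n) m) (ν : Vector Carrier m) (β : Exponent n) t →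
    Balanced v ν β → Balanced v (λ i → t * ν i) β
  balanced-scale v ν β t balanced j = begin
    sum (λ i → (t * ν i) * V i)       ≈⟨ sum-cong-≋ (λ i → *-assoc t (ν i) (V i)) ⟩
    sum (λ i → t * (ν i * V i))       ≈⟨ *-distribˡ-sum t (λ i → ν i * V i) ⟨
    t * sum (λ i → ν i * V i)         ≈⟨ *-congˡ (balanced j) ⟩
    t * (sum ν * B)                   ≈⟨ *-assoc _ _ _ ⟨
    (t * sum ν) * B                   ≈⟨ *-congʳ (*-distribˡ-sum t ν) ⟩
    sum (λ i → t * ν i) * B           ∎
    where
    open ≈-Reasoning
    V = λ i → fromℕ (lookup (v i) j)
    B = fromℕ (lookup β j)

  affine-dependence : ∀ {n m} (v : Vector (Exponent n) m) → ¬ AffinelyIndependent ℝ v →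
    Σ[ μ ∈ Vector Carrier m ] sum μ ≈ 0# × (∀ j → sum (λ i → μ i * fromℕ (lookup (v i) j)) ≈ 0#) × ∃[ i ] ¬ μ i ≈ 0#
  affine-dependence {m = m} v dependent
    with em {Σ[ μ ∈ Vector Carrier m ] sum μ ≈ 0# × (∀ j → sum (λ i → μ i * fromℕ (lookup (v i) j)) ≈ 0#) × ∃[ i ] ¬ μ i ≈ 0#}
  ... | yes found = found
  ... | no none = contradiction independent dependent
    where
    independent : AffinelyIndependent ℝ v
    independent μ sum≈0 dot≈0 i with em {μ i ≈ 0#}
    ... | yes μi≈0 = μi≈0
    ... | no μi≉0 = contradiction (μ , sum≈0 , dot≈0 , i , μi≉0) none

  -- Weights sit on labels rather than on exponents, so that information about a label survives the
  -- decomposition. In the application Q says that the minimiser is positive at the label.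
  module Carathéodory {n} {X : Set} (e : X → Exponent n) (Q : X → Set) (β : Exponent n) where

    record Part : Set where
      field
        size        : ℕ
        label       : Vector X (suc size)
        independent : AffinelyIndependent ℝ (λ i → e (label i))
        weight      : Vector Carrier (suc size)
        weight-pos  : ∀ i → 0# < weight i
        balanced    : Balanced (λ i → e (label i)) weight β
        label-Q     : ∀ i → Q (label i)

      integral : (X → Carrier) → Carrier
      integral h = sum (λ i → weight i * h (label i))

    open Part

    -- Equality of measures, tested against all functions: parts may share labels, and no weights
    -- have to be matched one by one.
    Decomposition : ∀ {m} → Vector X m → Vector Carrier m → Set
    Decomposition l ν = Σ[ ps ∈ List Part ] (∀ h → sum (λ i → ν i * h (l i)) ≈ ∑ᴸ (λ p → integral p h) ps)

    Decomposable : ℕ → Set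
    Decomposable m = ∀ (l : Vector X m) (ν : Vector Carrier m) → (∀ i → 0# ≤ ν i) →
      Balanced (λ i → e (l i)) ν β → (∀ i → 0# < ν i → Q (l i)) → Decomposition l ν

    private
      scale : ∀ t → 0# < t → Part → Part
      scale t 0<t p = record
        { size        = size p
        ; label       = label p
        ; independent = independent p
        ; weight      = λ i → t * weight p i
        ; weight-pos  = λ i → *-pos 0<t (weight-pos p i)
        ; balanced    = balanced-scale (λ i → e (label p i)) (weight p) β t (balanced p)
        ; label-Q     = label-Q p
        }

      integral-scale : ∀ t (0<t : 0# < t) h ps →
        ∑ᴸ (λ p → integral p h) (map (scale t 0<t) ps) ≈ t * ∑ᴸ (λ p → integral p h) ps
      integral-scale t 0<t h ps = trans (∑ᴸ-map _ _ ps) (trans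
        (∑ᴸ-cong (λ p → trans (sum-cong-≋ {suc (size p)} (λ i → *-assoc t (weight p i) (h (label p i)))) (sym (*-distribˡ-sum t (λ i → weight p i * h (label p i))))) ps)
        (sym (*-distribˡ-∑ᴸ t _ ps)))

      drop-zero : ∀ {m} → Decomposable m → ∀ (l : Vector X (suc m)) (ν : Vector Carrier (suc m)) → (∀ i → 0# ≤ ν i) →
        Balanced (λ i → e (l i)) ν β → (∀ i → 0# < ν i → Q (l i)) → ∃[ i ] ν i ≈ 0# → Decomposition l ν
      drop-zero decompose l ν 0≤ν bal ν-Q (k , νk≈0) =
        proj₁ rest , λ h → trans (remove h) (proj₂ rest h)
        where
        remove : ∀ (h : X → Carrier) → sum (λ i → ν i * h (l i)) ≈ sum (λ i → removeAt ν k i * h (removeAt l k i))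
        remove h = trans (sum-remove {i = k} (λ i → ν i * h (l i)))
          (trans (+-congʳ (trans (*-congʳ νk≈0) (zeroˡ _))) (+-identityˡ _))
        rest = decompose (removeAt l k) (removeAt ν k) (λ i → 0≤ν _)
          (λ j → trans (sym (remove (λ x → fromℕ (lookup (e x) j)))) (trans (bal j)
            (*-congʳ (trans (sum-remove {i = k} ν) (trans (+-congʳ νk≈0) (+-identityˡ _))))))
          (λ i → ν-Q _)

    -- Moving along an affine dependence in either direction until a weight
    -- vanishes gives two endpoints of which ν is a convex combination.
    decompose : ∀ {m} → Decomposable m
    decompose {zero}  l ν 0≤ν bal ν-Q = [] , λ h → refl
    decompose {suc m} l ν 0≤ν bal ν-Q with em {∃[ i ] ν i ≈ 0#}
    ... | yes zero-entry = drop-zero decompose l ν 0≤ν bal ν-Q zero-entry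
    ... | no no-zero with em {AffinelyIndependent ℝ (λ i → e (l i))}
    ...   | yes indep = record
              { size        = m
              ; label       = l
              ; independent = indep
              ; weight      = ν
              ; weight-pos  = 0<ν
              ; balanced    = bal
              ; label-Q     = λ i → ν-Q i (0<ν i)
              } ∷ [] , λ h → sym (+-identityʳ _)
      where
      0<ν : ∀ i → 0# < ν i
      0<ν i = 0≤ν i , λ 0≈νi → no-zero (i , sym 0≈νi)
    ...   | no dep = map (scale (r * s) 0<rs) (proj₁ part₁) ++ map (scale (r * t) 0<rt) (proj₁ part₂) , λ h → begin
        sum (λ i → ν i * h (l i))
          ≈⟨ *-identityˡ _ ⟨
        1# * sum (λ i → ν i * h (l i))
          ≈⟨ *-congʳ (recip-inverseˡ 0<s+t) ⟨
        (r * (s + t)) * sum (λ i → ν i * h (l i))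
          ≈⟨ solve 5 (λ r s t N M → (r :* (s :+ t)) :* N := (r :* s) :* (N :- t :* M) :+ (r :* t) :* (N :- s :* (:- M))) refl
               r s t (sum (λ i → ν i * h (l i))) (sum (λ i → μ i * h (l i))) ⟩
        (r * s) * (sum (λ i → ν i * h (l i)) - t * sum (λ i → μ i * h (l i)))
          + (r * t) * (sum (λ i → ν i * h (l i)) - s * - sum (λ i → μ i * h (l i)))
          ≈⟨ +-cong (*-congˡ (sum-step ν μ t (λ i → h (l i))))
               (*-congˡ (trans (sum-step ν (λ i → - μ i) s (λ i → h (l i))) (+-congˡ (-‿cong (*-congˡ (neg-dot (λ i → h (l i)))))))) ⟨
        (r * s) * sum (λ i → (ν i - t * μ i) * h (l i)) + (r * t) * sum (λ i → (ν i - s * - μ i) * h (l i))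
          ≈⟨ +-cong (*-congˡ (proj₂ part₁ h)) (*-congˡ (proj₂ part₂ h)) ⟩
        (r * s) * ∑ᴸ (λ p → integral p h) (proj₁ part₁) + (r * t) * ∑ᴸ (λ p → integral p h) (proj₁ part₂)
          ≈⟨ +-cong (integral-scale (r * s) 0<rs h (proj₁ part₁)) (integral-scale (r * t) 0<rt h (proj₁ part₂)) ⟨
        ∑ᴸ (λ p → integral p h) (map (scale (r * s) 0<rs) (proj₁ part₁)) + ∑ᴸ (λ p → integral p h) (map (scale (r * t) 0<rt) (proj₁ part₂))
          ≈⟨ ∑ᴸ-++ _ (map (scale (r * s) 0<rs) (proj₁ part₁)) _ ⟨
        ∑ᴸ (λ p → integral p h) (map (scale (r * s) 0<rs) (proj₁ part₁) ++ map (scale (r * t) 0<rt) (proj₁ part₂)) ∎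
      where
      open ≈-Reasoning
      0<ν : ∀ i → 0# < ν i
      0<ν i = 0≤ν i , λ 0≈νi → no-zero (i , sym 0≈νi)
      dependence = affine-dependence (λ i → e (l i)) dep
      μ = proj₁ dependence
      sum≈0 = proj₁ (proj₂ dependence)
      dot≈0 = proj₁ (proj₂ (proj₂ dependence))
      nonzero = proj₂ (proj₂ (proj₂ dependence))

      neg-dot : ∀ (g : Vector Carrier (suc m)) → sum (λ i → - μ i * g i) ≈ - sum (λ i → μ i * g i)
      neg-dot g = trans (sum-cong-≋ (λ i → solve 2 (λ m g → :- m :* g := :- (m :* g)) refl (μ i) (g i))) (sum-neg (λ i → μ i * g i))

      neg-sum≈0 : sum (λ i → - μ i) ≈ 0#
      neg-sum≈0 = trans (sum-neg μ) (trans (-‿cong sum≈0) (solve 0 (:- con (0 , 0) := con (0 , 0)) refl))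

      neg-dot≈0 : ∀ j → sum (λ i → - μ i * fromℕ (lookup (e (l i)) j)) ≈ 0#
      neg-dot≈0 j = trans (neg-dot (λ i → fromℕ (lookup (e (l i)) j)))
        (trans (-‿cong (dot≈0 j)) (solve 0 (:- con (0 , 0) := con (0 , 0)) refl))

      neg-nonzero : ∃[ i ] ¬ - μ i ≈ 0#
      neg-nonzero = proj₁ nonzero , λ -μ≈0 → proj₂ nonzero
        (trans (solve 1 (λ m → m := :- (:- m)) refl _) (trans (-‿cong -μ≈0) (solve 0 (:- con (0 , 0) := con (0 , 0)) refl)))

      -- The endpoints are ν - t μ and ν + s μ. Since s (ν - t μ) + t (ν + s μ) = (s + t) ν, they
      -- are weighted by s / (s + t) and t / (s + t).
      forward = maximal-step ν μ 0<ν (positive-entry μ sum≈0 nonzero)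
      backward = maximal-step ν (λ i → - μ i) 0<ν (positive-entry (λ i → - μ i) neg-sum≈0 neg-nonzero)
      t = proj₁ forward
      s = proj₁ backward
      0<t = proj₁ (proj₂ forward)
      0<s = proj₁ (proj₂ backward)
      0<s+t : 0# < s + t
      0<s+t = +-pos-nonneg 0<s (<⇒≤ 0<t)
      r = recip (s + t) 0<s+t
      0<rs = *-pos (recip-pos 0<s+t) 0<s
      0<rt = *-pos (recip-pos 0<s+t) 0<t

      part₁ = drop-zero decompose l (λ i → ν i - t * μ i) (proj₁ (proj₂ (proj₂ forward)))
        (balanced-step (λ i → e (l i)) ν μ β t bal sum≈0 dot≈0) (λ i _ → ν-Q i (0<ν i)) (proj₂ (proj₂ (proj₂ forward)))
      part₂ = drop-zero decompose l (λ i → ν i - s * - μ i) (proj₁ (proj₂ (proj₂ backward)))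
        (balanced-step (λ i → e (l i)) ν (λ i → - μ i) β s bal neg-sum≈0 neg-dot≈0)
        (λ i _ → ν-Q i (0<ν i)) (proj₂ (proj₂ (proj₂ backward)))

  -- Polynomials as signed measures on exponents

  _≟ᵉ_ : ∀ {n} → DecidableEquality (Exponent n)
  _≟ᵉ_ = Vec.≡-dec ℕ._≟_

  coeff-here : ∀ {n} a (α : Exponent n) p → coeff ℝ ((a , α) ∷ p) α ≈ a + coeff ℝ p α
  coeff-here a α p with α ≟ᵉ α
  ... | yes _   = refl
  ... | no  α≢α = contradiction ≡.refl α≢α

  coeff-there : ∀ {n} a {γ α : Exponent n} p → ¬ γ ≡ α → coeff ℝ ((a , γ) ∷ p) α ≈ coeff ℝ p α
  coeff-there a {γ} {α} p γ≢α with γ ≟ᵉ α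
  ... | yes γ≡α = contradiction γ≡α γ≢α
  ... | no  _   = refl

  coeff-++ : ∀ {n} (p q : Polynomial ℝ n) α → coeff ℝ (p ++ q) α ≈ coeff ℝ p α + coeff ℝ q α
  coeff-++ []            q α = sym (+-identityˡ _)
  coeff-++ ((a , γ) ∷ p) q α with γ ≟ᵉ α
  ... | yes _ = trans (+-congˡ (coeff-++ p q α)) (sym (+-assoc _ _ _))
  ... | no  _ = coeff-++ p q α

  exponents : ∀ {n} → Polynomial ℝ n → List (Exponent n)
  exponents p = List.deduplicate _≟ᵉ_ (map proj₂ p)

  exponents-unique : ∀ {n} (p : Polynomial ℝ n) → Unique (exponents p)
  exponents-unique p = Unique.deduplicate-! _≟ᵉ_ (map proj₂ p)

  coeff-∉ : ∀ {n} (p : Polynomial ℝ n) {α} → α ∉ map proj₂ p → coeff ℝ p α ≈ 0#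
  coeff-∉ []            α∉ = refl
  coeff-∉ ((a , γ) ∷ p) {α} α∉ = trans (coeff-there a {γ} p (λ { ≡.refl → α∉ (here ≡.refl) })) (coeff-∉ p (λ α∈ → α∉ (there α∈)))

  supp⊆exponents : ∀ {n} (p : Polynomial ℝ n) {α} → Supp ℝ p α → α ∈ exponents p
  supp⊆exponents p {α} p[α]≉0 with em {α ∈ map proj₂ p}
  ... | yes α∈ = ∈-deduplicate⁺ _≟ᵉ_ α∈
  ... | no  α∉ = contradiction (coeff-∉ p α∉) p[α]≉0

  ∑ᴸ-cong-∈ : ∀ {A : Set} {g h : A → Carrier} xs → (∀ {x} → x ∈ xs → g x ≈ h x) → ∑ᴸ g xs ≈ ∑ᴸ h xs
  ∑ᴸ-cong-∈ []       g≈h = refl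
  ∑ᴸ-cong-∈ (x ∷ xs) g≈h = +-cong (g≈h (here ≡.refl)) (∑ᴸ-cong-∈ xs (λ x∈xs → g≈h (there x∈xs)))

  ∑ᴸ-zero : ∀ {A : Set} (g : A → Carrier) xs → (∀ {x} → x ∈ xs → g x ≈ 0#) → ∑ᴸ g xs ≈ 0#
  ∑ᴸ-zero g []       g≈0 = refl
  ∑ᴸ-zero g (x ∷ xs) g≈0 = trans (+-cong (g≈0 (here ≡.refl)) (∑ᴸ-zero g xs (λ x∈xs → g≈0 (there x∈xs)))) (+-identityˡ _)

  ∑ᴸ-+ : ∀ {A : Set} (g h : A → Carrier) xs → ∑ᴸ (λ x → g x + h x) xs ≈ ∑ᴸ g xs + ∑ᴸ h xs
  ∑ᴸ-+ g h []       = sym (+-identityˡ _)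
  ∑ᴸ-+ g h (x ∷ xs) = trans (+-congˡ (∑ᴸ-+ g h xs))
    (solve 4 (λ a b c d → (a :+ b) :+ (c :+ d) := (a :+ c) :+ (b :+ d)) refl (g x) (h x) (∑ᴸ g xs) (∑ᴸ h xs))

  -- Evaluation is the pairing with monomials and coefficient extraction the pairing with an
  -- indicator, so an identity for all h covers both.
  ⟪_,_⟫ : ∀ {n} → Polynomial ℝ n → (Exponent n → Carrier) → Carrier
  ⟪ p , h ⟫ = ∑ᴸ (λ (a , α) → a * h α) p

  eval-as-integral : ∀ {n} (p : Polynomial ℝ n) x → eval ℝ p x ≈ ⟪ p , (λ α → monomial ℝ α x) ⟫
  eval-as-integral []            x = refl
  eval-as-integral ((a , α) ∷ p) x = +-congˡ (eval-as-integral p x)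

  indicator : ∀ {n} → Exponent n → Exponent n → Carrier
  indicator α γ with γ ≟ᵉ α
  ... | yes _ = 1#
  ... | no  _ = 0#

  coeff-as-integral : ∀ {n} (p : Polynomial ℝ n) α → coeff ℝ p α ≈ ⟪ p , indicator α ⟫
  coeff-as-integral []            α = refl
  coeff-as-integral ((a , γ) ∷ p) α with γ ≟ᵉ α
  ... | yes _ = +-cong (sym (*-identityʳ a)) (coeff-as-integral p α)
  ... | no  _ = trans (coeff-as-integral p α) (sym (trans (+-congʳ (zeroʳ a)) (+-identityˡ _)))

  private
    head-term : ∀ {n} a (γ : Exponent n) p (h : Exponent n → Carrier) {U} → Unique U → γ ∈ U →
      ∑ᴸ (λ α → coeff ℝ ((a , γ) ∷ p) α * h α) U ≈ a * h γ + ∑ᴸ (λ α → coeff ℝ p α * h α) U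
    head-term a γ p h {α ∷ U} (α≢U ∷ _) (here ≡.refl) = trans
      (+-cong (*-congʳ (coeff-here a γ p)) (∑ᴸ-cong-∈ U (λ δ∈U → *-congʳ (coeff-there a p (All.lookup α≢U δ∈U)))))
      (solve 4 (λ a c h s → (a :+ c) :* h :+ s := a :* h :+ (c :* h :+ s)) refl a (coeff ℝ p γ) (h γ) (∑ᴸ (λ α → coeff ℝ p α * h α) U))
    head-term a γ p h {α ∷ U} (α≢U ∷ U!) (there γ∈U) = trans
      (+-cong (*-congʳ (coeff-there a {γ} p (λ { ≡.refl → All.lookup α≢U γ∈U ≡.refl }))) (head-term a γ p h U! γ∈U))
      (solve 3 (λ x y z → x :+ (y :+ z) := y :+ (x :+ z)) refl _ (a * h γ) _)

  -- Terms with equal exponents are collected. U may contain exponents that do not occur in p, so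
  -- that one U can serve two polynomials.
  integral-over : ∀ {n} (p : Polynomial ℝ n) (h : Exponent n → Carrier) {U} → Unique U → (∀ {γ} → γ ∈ map proj₂ p → γ ∈ U) →
    ⟪ p , h ⟫ ≈ ∑ᴸ (λ α → coeff ℝ p α * h α) U
  integral-over []            h {U} U! p⊆U = sym (∑ᴸ-zero _ U (λ _ → zeroˡ _))
  integral-over ((a , γ) ∷ p) h U! p⊆U = trans (+-congˡ (integral-over p h U! (λ γ∈ → p⊆U (there γ∈))))
    (sym (head-term a γ p h U! (p⊆U (here ≡.refl))))

  integral-cong : ∀ {n} {p q : Polynomial ℝ n} → _≋_ ℝ p q → ∀ h → ⟪ p , h ⟫ ≈ ⟪ q , h ⟫
  integral-cong {p = p} {q} p≋q h = begin
    ⟪ p , h ⟫                         ≈⟨ integral-over p h U! (λ γ∈ → ∈-deduplicate⁺ _≟ᵉ_ (∈-++⁺ˡ γ∈)) ⟩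
    ∑ᴸ (λ α → coeff ℝ p α * h α) U    ≈⟨ ∑ᴸ-cong (λ α → *-congʳ (p≋q α)) U ⟩
    ∑ᴸ (λ α → coeff ℝ q α * h α) U    ≈⟨ integral-over q h U! (λ γ∈ → ∈-deduplicate⁺ _≟ᵉ_ (∈-++⁺ʳ (map proj₂ p) γ∈)) ⟨
    ⟪ q , h ⟫                         ∎
    where
    open ≈-Reasoning
    U = List.deduplicate _≟ᵉ_ (map proj₂ p ++ map proj₂ q)
    U! : Unique U
    U! = Unique.deduplicate-! _≟ᵉ_ (map proj₂ p ++ map proj₂ q)

  eval-cong : ∀ {n} {p q : Polynomial ℝ n} → _≋_ ℝ p q → ∀ x → eval ℝ p x ≈ eval ℝ q x
  eval-cong {p = p} {q} p≋q x = trans (eval-as-integral p x)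
    (trans (integral-cong {p = p} {q} p≋q (λ α → monomial ℝ α x)) (sym (eval-as-integral q x)))

  eval-++ : ∀ {n} (p q : Polynomial ℝ n) x → eval ℝ (p ++ q) x ≈ eval ℝ p x + eval ℝ q x
  eval-++ []            q x = sym (+-identityˡ _)
  eval-++ ((a , α) ∷ p) q x = trans (+-congˡ (eval-++ p q x)) (sym (+-assoc _ _ _))

  scaleᴾ : ∀ {n} → Carrier → Polynomial ℝ n → Polynomial ℝ n
  scaleᴾ t = map (λ (a , α) → t * a , α)

  coeff-scaleᴾ : ∀ {n} t (p : Polynomial ℝ n) α → coeff ℝ (scaleᴾ t p) α ≈ t * coeff ℝ p α
  coeff-scaleᴾ t []            α = sym (zeroʳ t)
  coeff-scaleᴾ t ((a , γ) ∷ p) α with γ ≟ᵉ α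
  ... | yes _ = trans (+-congˡ (coeff-scaleᴾ t p α)) (sym (distribˡ t a _))
  ... | no  _ = coeff-scaleᴾ t p α

  eval-scaleᴾ : ∀ {n} t (p : Polynomial ℝ n) x → eval ℝ (scaleᴾ t p) x ≈ t * eval ℝ p x
  eval-scaleᴾ t []            x = sym (zeroʳ t)
  eval-scaleᴾ t ((a , α) ∷ p) x = trans (+-cong (*-assoc t a _) (eval-scaleᴾ t p x)) (sym (distribˡ t _ _))

  tabulate-integral : ∀ {n m} (c : Vector Carrier m) (v : Vector (Exponent n) m) h →
    ⟪ tabulate (λ i → c i , v i) , h ⟫ ≈ sum (λ i → c i * h (v i))
  tabulate-integral {m = zero}  c v h = refl
  tabulate-integral {m = suc m} c v h = +-congˡ (tabulate-integral (λ i → c (suc i)) (λ i → v (suc i)) h)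

  -- The same list as `circuitForm`, but without a simplex: the squares of an AGE polynomial may be
  -- affinely dependent.
  vertices-and-inner : ∀ {n m} → Vector Carrier m → Vector (Exponent n) m → Exponent n → Carrier → Polynomial ℝ n
  vertices-and-inner c v β d = tabulate (λ i → c i , v i) ++ [ (- d , β) ]

  form-integral : ∀ {n m} (c : Vector Carrier m) (v : Vector (Exponent n) m) β d h →
    ⟪ vertices-and-inner c v β d , h ⟫ ≈ sum (λ i → c i * h (v i)) - d * h β
  form-integral c v β d h = trans (∑ᴸ-++ _ (tabulate (λ i → c i , v i)) _) (+-cong (tabulate-integral c v h)
    (trans (+-identityʳ _) (solve 2 (λ d h → :- d :* h := :- (d :* h)) refl d (h β))))

  form-nonneg⇒ : ∀ {n m} (c : Vector Carrier m) (v : Vector (Exponent n) m) β d →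
    Nonnegative ℝ (vertices-and-inner c v β d) → ∀ x → d * monomial ℝ β x ≤ sum (λ i → c i * monomial ℝ (v i) x)
  form-nonneg⇒ c v β d nonneg x = ≤-by-gap _ (nonneg x)
    (trans (+-congˡ (trans (eval-as-integral (vertices-and-inner c v β d) x) (form-integral c v β d _))) (solve 2 (λ a b → a :+ (b :- a) := b) refl _ _))

  form-nonneg⇐ : ∀ {n m} (c : Vector Carrier m) (v : Vector (Exponent n) m) β d →
    (∀ x → d * monomial ℝ β x ≤ sum (λ i → c i * monomial ℝ (v i) x)) → Nonnegative ℝ (vertices-and-inner c v β d)
  form-nonneg⇐ c v β d bound x = ≤-trans (gap-nonneg (bound x))
    (≤-reflexive (sym (trans (eval-as-integral (vertices-and-inner c v β d) x) (form-integral c v β d _))))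

  -- Signs and absolute values

  -- Oddness is recorded as a sign, the form in which the reflection of a coordinate uses it.
  even-or-odd-power : ∀ k → 2 ∣ k ⊎ (- 1#) ^ k ≈ - 1#
  even-or-odd-power zero = inj₁ (2 ∣0)
  even-or-odd-power (suc zero) = inj₂ (*-identityʳ _)
  even-or-odd-power (suc (suc k)) with even-or-odd-power k
  ... | inj₁ 2∣k = inj₁ (∣m∣n⇒∣m+n (∣-refl {2}) 2∣k)
  ... | inj₂ odd = inj₂ (trans (*-congˡ (*-congˡ odd)) (solve 0 (:- con (1 , 0) :* (:- con (1 , 0) :* (:- con (1 , 0))) := :- con (1 , 0)) refl))

  UpToSign : Carrier → Carrier → Set
  UpToSign x y = x ≈ y ⊎ x ≈ - y

  UpToSign-* : ∀ {x y x′ y′} → UpToSign x y → UpToSign x′ y′ → UpToSign (x * x′) (y * y′)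
  UpToSign-* (inj₁ x≈y)  (inj₁ x′≈y′)  = inj₁ (*-cong x≈y x′≈y′)
  UpToSign-* (inj₁ x≈y)  (inj₂ x′≈-y′) = inj₂ (trans (*-cong x≈y x′≈-y′) (solve 2 (λ y z → y :* :- z := :- (y :* z)) refl _ _))
  UpToSign-* (inj₂ x≈-y) (inj₁ x′≈y′)  = inj₂ (trans (*-cong x≈-y x′≈y′) (solve 2 (λ y z → :- y :* z := :- (y :* z)) refl _ _))
  UpToSign-* (inj₂ x≈-y) (inj₂ x′≈-y′) = inj₁ (trans (*-cong x≈-y x′≈-y′) (solve 2 (λ y z → :- y :* :- z := y :* z) refl _ _))

  UpToSign-^ : ∀ {x y} k → UpToSign x y → UpToSign (x ^ k) (y ^ k)
  UpToSign-^ zero    x≈±y = inj₁ refl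
  UpToSign-^ (suc k) x≈±y = UpToSign-* x≈±y (UpToSign-^ k x≈±y)

  UpToSign-product : ∀ {m} {g h : Vector Carrier m} → (∀ j → UpToSign (g j) (h j)) → UpToSign (product g) (product h)
  UpToSign-product {zero}  g≈±h = inj₁ refl
  UpToSign-product {suc m} g≈±h = UpToSign-* (g≈±h zero) (UpToSign-product (λ j → g≈±h (suc j)))

  even-power-sign : ∀ {x y k} → 2 ∣ k → UpToSign x y → x ^ k ≈ y ^ k
  even-power-sign {k = k} (divides q ≡.refl) (inj₁ x≈y) = ^-congˡ k x≈y
  even-power-sign {x} {y} {k} (divides q ≡.refl) (inj₂ x≈-y) = begin
    x ^ (q ℕ.* 2)     ≈⟨ ^-assocʳ′ x ⟩
    (x ^ 2) ^ q       ≈⟨ ^-congˡ q (trans (*-cong x≈-y (*-congʳ x≈-y)) (solve 1 (λ y → :- y :* (:- y :* con (1 , 0)) := y :* (y :* con (1 , 0))) refl y)) ⟩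
    (y ^ 2) ^ q       ≈⟨ ^-assocʳ′ y ⟨
    y ^ (q ℕ.* 2)     ∎
    where
    open ≈-Reasoning
    ^-assocʳ′ : ∀ z → z ^ (q ℕ.* 2) ≈ (z ^ 2) ^ q
    ^-assocʳ′ z = trans (reflexive (≡.cong (z ^_) (ℕ.*-comm q 2))) (sym (^-assocʳ z 2 q))

  odd-coordinate : ∀ {n} (α : Exponent n) → ¬ IsEven α → ∃[ j ] (- 1#) ^ lookup α j ≈ - 1#
  odd-coordinate α odd with em {∃[ j ] (- 1#) ^ lookup α j ≈ - 1#}
  ... | yes found = found
  ... | no none = contradiction
    (VecAll.lookup⁻ (λ j → [ (λ 2∣αj → 2∣αj) , (λ eq → contradiction (j , eq) none) ]′ (even-or-odd-power (lookup α j)))) odd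

  even-monomial-sign : ∀ {n} (α : Exponent n) {x y : Vector Carrier n} → IsEven α → (∀ j → UpToSign (x j) (y j)) →
    monomial ℝ α x ≈ monomial ℝ α y
  even-monomial-sign α even x≈±y = product-cong (λ j → even-power-sign (VecAll.lookup⁺ even j) (x≈±y j))

  absolute-value : ∀ x → ∃[ y ] 0# ≤ y × UpToSign x y
  absolute-value x with total 0# x
  ... | inj₁ 0≤x = x , 0≤x , inj₁ refl
  ... | inj₂ x≤0 = - x , neg-nonneg x≤0 , inj₂ (solve 1 (λ x → x := :- (:- x)) refl x)

  even-monomial-nonneg : ∀ {n} (α : Exponent n) → IsEven α → ∀ x → 0# ≤ monomial ℝ α x
  even-monomial-nonneg α even x = ≤-trans
    (product-nonneg (λ j → ^-nonneg (lookup α j) (proj₁ (proj₂ (absolute-value (x j))))))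
    (≤-reflexive (sym (even-monomial-sign α even (λ j → proj₂ (proj₂ (absolute-value (x j)))))))

  positive-monomials⇒ : ∀ {n m} (v : Vector (Exponent n) m) (c : Vector Carrier m) (β : Exponent n) s →
    (∀ x → (∀ j → 0# < x j) → s * monomial ℝ β x ≤ sum (λ i → c i * monomial ℝ (v i) x)) →
    ∀ x → s ≤ sum (λ i → c i * ratio (v i) β x)
  positive-monomials⇒ v c β s bound x = begin
    s
      ≈⟨ trans (*-congˡ (monomial-inverse β x)) (*-identityʳ s) ⟨
    s * (monomial ℝ β (point x) * monomial ℝ β (inverses x))
      ≈⟨ *-assoc _ _ _ ⟨
    (s * monomial ℝ β (point x)) * monomial ℝ β (inverses x)
      ≤⟨ *-monoʳ-≤ (<⇒≤ (monomial-pos β (inverses-pos x))) (bound (point x) (point-pos x)) ⟩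
    sum (λ i → c i * monomial ℝ (v i) (point x)) * monomial ℝ β (inverses x)
      ≈⟨ *-distribʳ-sum _ (λ i → c i * monomial ℝ (v i) (point x)) ⟩
    sum (λ i → (c i * monomial ℝ (v i) (point x)) * monomial ℝ β (inverses x))
      ≈⟨ sum-cong-≋ (λ i → *-assoc (c i) (monomial ℝ (v i) (point x)) (monomial ℝ β (inverses x))) ⟩
    sum (λ i → c i * ratio (v i) β x) ∎
    where open ≤-Reasoning

  positive-monomials⇐ : ∀ {n m} (v : Vector (Exponent n) m) (c : Vector Carrier m) (β : Exponent n) s →
    (∀ x → s ≤ sum (λ i → c i * ratio (v i) β x)) →
    ∀ x → (∀ j → 0# < x j) → s * monomial ℝ β x ≤ sum (λ i → c i * monomial ℝ (v i) x)
  positive-monomials⇐ v c β s bound x 0<x = begin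
    s * monomial ℝ β x
      ≤⟨ *-monoʳ-≤ (<⇒≤ (monomial-pos β 0<x)) (bound X) ⟩
    sum (λ i → c i * ratio (v i) β X) * monomial ℝ β x
      ≈⟨ *-distribʳ-sum _ (λ i → c i * ratio (v i) β X) ⟩
    sum (λ i → (c i * ratio (v i) β X) * monomial ℝ β x)
      ≈⟨ sum-cong-≋ (λ i → trans (*-assoc (c i) (ratio (v i) β X) (monomial ℝ β x)) (*-congˡ (ratio*monomial (v i) β X))) ⟩
    sum (λ i → c i * monomial ℝ (v i) x) ∎
    where
    open ≤-Reasoning
    X = fromPositive x 0<x

  -- Negating a coordinate at which β is odd changes the sign of x ^ β and fixes all even monomials.
  flipped-bound : ∀ {n m} (v : Vector (Exponent n) m) (c : Vector Carrier m) (β : Exponent n) d →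
    (∀ i → IsEven (v i)) → ¬ IsEven β →
    (∀ x → d * monomial ℝ β x ≤ sum (λ i → c i * monomial ℝ (v i) x)) →
    ∀ x → - d * monomial ℝ β x ≤ sum (λ i → c i * monomial ℝ (v i) x)
  flipped-bound {n} v c β d even odd bound x = begin
    - d * monomial ℝ β x
      ≈⟨ solve 2 (λ d m → :- d :* m := d :* (:- con (1 , 0) :* m)) refl d (monomial ℝ β x) ⟩
    d * (- 1# * monomial ℝ β x)
      ≈⟨ *-congˡ (*-congʳ (trans (monomial-coordinate β j (- 1#)) (proj₂ (odd-coordinate β odd)))) ⟨
    d * (monomial ℝ β (coordinate j (- 1#)) * monomial ℝ β x)
      ≈⟨ *-congˡ (monomial-* β (coordinate j (- 1#)) x) ⟨
    d * monomial ℝ β (λ k → coordinate j (- 1#) k * x k)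
      ≤⟨ bound (λ k → coordinate j (- 1#) k * x k) ⟩
    sum (λ i → c i * monomial ℝ (v i) (λ k → coordinate j (- 1#) k * x k))
      ≈⟨ sum-cong-≋ (λ i → *-congˡ (even-monomial-sign (v i) (even i) sign)) ⟩
    sum (λ i → c i * monomial ℝ (v i) x) ∎
    where
    open ≤-Reasoning
    j = proj₁ (odd-coordinate β odd)
    sign : ∀ k → UpToSign (coordinate j (- 1#) k * x k) (x k)
    sign k with k ≟ᶠ j
    ... | yes _ = inj₂ (solve 1 (λ x → :- con (1 , 0) :* x := :- x) refl (x k))
    ... | no  _ = inj₁ (*-identityˡ (x k))

  0^suc≈0 : ∀ {x} k → x ≈ 0# → ¬ k ≡ 0 → x ^ k ≈ 0#
  0^suc≈0 zero    x≈0 k≢0 = contradiction ≡.refl k≢0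
  0^suc≈0 (suc k) x≈0 k≢0 = trans (*-congʳ x≈0) (zeroˡ _)

  fromℕ≈0⇒≡0 : ∀ k → fromℕ k ≈ 0# → k ≡ 0
  fromℕ≈0⇒≡0 zero    _  = ≡.refl
  fromℕ≈0⇒≡0 (suc k) eq = contradiction eq (pos⇒≉0 (fromℕ-suc-pos k))

  bound-everywhere : ∀ {n m} (v : Vector (Exponent n) m) (w c : Vector Carrier m) (β : Exponent n) s d →
    (∀ i → IsEven (v i)) → (∀ i → 0# < w i) → Balanced v w β → (∀ i → 0# ≤ c i) → d ≤ s → - d ≤ s →
    (∀ x → s ≤ sum (λ i → c i * ratio (v i) β x)) →
    ∀ x → d * monomial ℝ β x ≤ sum (λ i → c i * monomial ℝ (v i) x)
  bound-everywhere {n} {m} v w c β s d even 0<w balanced 0≤c d≤s -d≤s bound x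
    with em {∃[ j ] x j ≈ 0# × ¬ lookup β j ≡ 0}
  ... | yes (j , xj≈0 , βj≢0) = begin
      d * monomial ℝ β x                      ≈⟨ *-congˡ (product-zero j (0^suc≈0 (lookup β j) xj≈0 βj≢0)) ⟩
      d * 0#                                  ≈⟨ zeroʳ d ⟩
      0#                                      ≤⟨ sum-nonneg (λ i → *-nonneg (0≤c i) (even-monomial-nonneg (v i) (even i) x)) ⟩
      sum (λ i → c i * monomial ℝ (v i) x)    ∎
    where open ≤-Reasoning
  -- The exponents vanish wherever x does, so zero coordinates may be replaced by 1.
  ... | no none = begin
      d * monomial ℝ β x                      ≤⟨ signed (UpToSign-product β-sign) ⟩
      s * monomial ℝ β y                      ≤⟨ positive-monomials⇐ v c β s bound y 0<y ⟩
      sum (λ i → c i * monomial ℝ (v i) y)    ≈⟨ sum-cong-≋ (λ i → *-congˡ (product-cong (v-sign i))) ⟨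
      sum (λ i → c i * monomial ℝ (v i) x)    ∎
    where
    open ≤-Reasoning
    nonzero-magnitude : ∀ t → ∃[ y ] 0# < y × (UpToSign t y ⊎ t ≈ 0#)
    nonzero-magnitude t with absolute-value t
    ... | y , 0≤y , t≈±y with 0≤⇒0<⊎≈0 0≤y
    ...   | inj₁ 0<y = y , 0<y , inj₁ t≈±y
    ...   | inj₂ y≈0 = 1# , 0<1 , inj₂ ([ (λ t≈y → trans t≈y y≈0) ,
              (λ t≈-y → trans t≈-y (trans (-‿cong y≈0) (solve 0 (:- con (0 , 0) := con (0 , 0)) refl))) ]′ t≈±y)
    y : Vector Carrier n
    y j = proj₁ (nonzero-magnitude (x j))
    0<y = λ j → proj₁ (proj₂ (nonzero-magnitude (x j)))

    βj≡0 : ∀ j → x j ≈ 0# → lookup β j ≡ 0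
    βj≡0 j xj≈0 with lookup β j ℕ.≟ 0
    ... | yes eq = eq
    ... | no neq = contradiction (j , xj≈0 , neq) none

    vj≡0 : ∀ i j → x j ≈ 0# → lookup (v i) j ≡ 0
    vj≡0 i j xj≈0 = fromℕ≈0⇒≡0 (lookup (v i) j) (x*y≈0⇒y≈0 (pos⇒≉0 (0<w i)) (antisym
      (≤-trans (term≤sum (λ i → *-nonneg (<⇒≤ (0<w i)) (fromℕ-nonneg (lookup (v i) j))) i)
        (≤-reflexive (trans (balanced j) (trans (*-congˡ (reflexive (≡.cong fromℕ (βj≡0 j xj≈0)))) (zeroʳ _)))))
      (*-nonneg (<⇒≤ (0<w i)) (fromℕ-nonneg (lookup (v i) j)))))

    zeroth-powers : ∀ {s t k} → k ≡ 0 → s ^ k ≈ t ^ k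
    zeroth-powers ≡.refl = refl

    β-sign : ∀ j → UpToSign (x j ^ lookup β j) (y j ^ lookup β j)
    β-sign j with proj₂ (proj₂ (nonzero-magnitude (x j)))
    ... | inj₁ x≈±y = UpToSign-^ (lookup β j) x≈±y
    ... | inj₂ xj≈0 = inj₁ (zeroth-powers (βj≡0 j xj≈0))

    v-sign : ∀ i j → x j ^ lookup (v i) j ≈ y j ^ lookup (v i) j
    v-sign i j with proj₂ (proj₂ (nonzero-magnitude (x j)))
    ... | inj₁ x≈±y = even-power-sign (VecAll.lookup⁺ (even i) j) x≈±y
    ... | inj₂ xj≈0 = zeroth-powers (vj≡0 i j xj≈0)

    signed : UpToSign (monomial ℝ β x) (monomial ℝ β y) → d * monomial ℝ β x ≤ s * monomial ℝ β y
    signed (inj₁ x^β≈y^β)  = ≤-trans (≤-reflexive (*-congˡ x^β≈y^β)) (*-monoʳ-≤ (<⇒≤ (monomial-pos β 0<y)) d≤s)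
    signed (inj₂ x^β≈-y^β) = ≤-trans (≤-reflexive (trans (*-congˡ x^β≈-y^β) (solve 2 (λ d m → d :* :- m := :- d :* m) refl d _)))
      (*-monoʳ-≤ (<⇒≤ (monomial-pos β 0<y)) -d≤s)

  -- From AGE polynomials to circuits

  terms : ∀ {n} → (Exponent n → Carrier) → List (Exponent n) → Polynomial ℝ n
  terms g = map (λ α → g α , α)

  coeff-terms-∉ : ∀ {n} (g : Exponent n → Carrier) {U α} → α ∉ U → coeff ℝ (terms g U) α ≈ 0#
  coeff-terms-∉ g {[]}    α∉U = refl
  coeff-terms-∉ g {γ ∷ U} α∉U = trans (coeff-there (g γ) {γ} (terms g U) (λ { ≡.refl → α∉U (here ≡.refl) }))
    (coeff-terms-∉ g {U} (λ α∈U → α∉U (there α∈U)))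

  coeff-terms-∈ : ∀ {n} (g : Exponent n → Carrier) {U α} → Unique U → α ∈ U → coeff ℝ (terms g U) α ≈ g α
  coeff-terms-∈ g {α ∷ U} (α≢U ∷ _) (here ≡.refl) = trans (coeff-here (g α) α (terms g U))
    (trans (+-congˡ (coeff-terms-∉ g {U} (λ α∈U → All.lookup α≢U α∈U ≡.refl))) (+-identityʳ _))
  coeff-terms-∈ g {γ ∷ U} (γ≢U ∷ U!) (there α∈U) = trans
    (coeff-there (g γ) {γ} (terms g U) (All.lookup γ≢U α∈U)) (coeff-terms-∈ g U! α∈U)

  integral-concat : ∀ {n} (ps : List (Polynomial ℝ n)) h → ⟪ concat ps , h ⟫ ≈ ∑ᴸ (λ p → ⟪ p , h ⟫) ps
  integral-concat []       h = refl
  integral-concat (p ∷ ps) h = trans (∑ᴸ-++ _ p (concat ps)) (+-congˡ (integral-concat ps h))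

  -- Nothing ties β to the squares, and its coefficient may have either sign. For fixed β these
  -- polynomials are therefore closed under addition and include zero.
  record AGE {n} (β : Exponent n) (p : Polynomial ℝ n) : Set where
    field
      off-nonneg : ∀ α → ¬ α ≡ β → 0# ≤ coeff ℝ p α
      off-odd    : ∀ α → ¬ α ≡ β → ¬ IsEven α → coeff ℝ p α ≈ 0#
      nonneg     : Nonnegative ℝ p

  open AGE

  -- A total form of division, with value 0 unless z > 0; z * u is then the indicator of z > 0.
  pseudo-inverse : ∀ z → ∃[ u ] 0# ≤ u × (0# < z → z * u ≈ 1#) × (z * u ≈ 1# ⊎ z * u ≈ 0#)
  pseudo-inverse z with em {0# < z}
  ... | yes 0<z = recip z 0<z , <⇒≤ (recip-pos 0<z) , (λ _ → recip-inverseʳ 0<z) , inj₁ (recip-inverseʳ 0<z)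
  ... | no  0≮z = 0# , ≤-refl , (λ 0<z → contradiction 0<z 0≮z) , inj₂ (zeroʳ z)

  module _ {n} (f : Polynomial ℝ n) where

    PositiveCircuit : Summand ℝ f → Set
    PositiveCircuit s = (∀ i → 0# < Summand.c s i) × Nonnegative ℝ (Summand.poly s)

    IsResidue : Carrier × Exponent n → Set
    IsResidue (e , α) = 0# < e × Λ ℝ f α

    -- `SameSupportSONC` before the indexing by pairs (β , Δ). Several circuits may share a simplex,
    -- which makes the property additive.
    Decomposed : Polynomial ℝ n → Set
    Decomposed p = Σ[ ss ∈ List (Summand ℝ f) ] Σ[ es ∈ Polynomial ℝ n ]
      All PositiveCircuit ss × All IsResidue es × _≋_ ℝ p (concat (map Summand.poly ss) ++ es)

    -- Residues need strictly positive coefficients, whereas the squares that arise may have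
    -- coefficient zero.
    prune : (es : Polynomial ℝ n) → All (λ (e , α) → 0# ≤ e × (¬ e ≈ 0# → Λ ℝ f α)) es →
      Σ[ es′ ∈ Polynomial ℝ n ] All IsResidue es′ × _≋_ ℝ es es′
    prune [] [] = [] , [] , λ α → refl
    prune ((e , γ) ∷ es) ((0≤e , e-Λ) ∷ es-Λ) with prune es es-Λ | 0≤⇒0<⊎≈0 0≤e
    ... | es′ , es′-Λ , es≋es′ | inj₁ 0<e = (e , γ) ∷ es′ , (0<e , e-Λ (pos⇒≉0 0<e)) ∷ es′-Λ , same
      where
      same : _≋_ ℝ ((e , γ) ∷ es) ((e , γ) ∷ es′)
      same α with γ ≟ᵉ α
      ... | yes _ = +-congˡ (es≋es′ α)
      ... | no  _ = es≋es′ α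
    ... | es′ , es′-Λ , es≋es′ | inj₂ e≈0 = es′ , es′-Λ , same
      where
      same : _≋_ ℝ ((e , γ) ∷ es) es′
      same α with γ ≟ᵉ α
      ... | yes _ = trans (+-congʳ e≈0) (trans (+-identityˡ _) (es≋es′ α))
      ... | no  _ = es≋es′ α

    decompose-monomials : ∀ p → (∀ α → 0# ≤ coeff ℝ p α) → (∀ α → Supp ℝ p α → Λ ℝ f α) → Decomposed p
    decompose-monomials p 0≤p supp⊆Λ = [] , proj₁ pruned , [] , proj₁ (proj₂ pruned) ,
      λ α → trans (canonical α) (proj₂ (proj₂ pruned) α)
      where
      pruned = prune (terms (coeff ℝ p) (exponents p)) (All.map⁺ (All.universal (λ α → 0≤p α , supp⊆Λ α) (exponents p)))
      canonical : _≋_ ℝ p (terms (coeff ℝ p) (exponents p))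
      canonical α with em {α ∈ exponents p}
      ... | yes α∈ = sym (coeff-terms-∈ (coeff ℝ p) (exponents-unique p) α∈)
      ... | no  α∉ with em {coeff ℝ p α ≈ 0#}
      ...   | yes p[α]≈0 = trans p[α]≈0 (sym (coeff-terms-∉ (coeff ℝ p) α∉))
      ...   | no  p[α]≉0 = contradiction (supp⊆exponents p p[α]≉0) α∉

    module _ {β : Exponent n} (β∈Γ : Γ ℝ f β) {m} (v : Vector (Exponent n) m) (v-Λ : ∀ x → Λ ℝ f (v x)) where

      module FromParts (z : Vector Carrier m) where

        open Carathéodory v (λ x → 0# < z x) β

        module _
          (c u : Vector Carrier m) (0<c : ∀ x → 0# < c x) (0≤u : ∀ x → 0# ≤ u x)
          (zu≈1-on-support : ∀ x → 0# < z x → z x * u x ≈ 1#) (zu≈1⊎zu≈0 : ∀ x → z x * u x ≈ 1# ⊎ z x * u x ≈ 0#)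
          (near : ∀ ε → 0# < ε → ∃[ y ] (∀ x → Close ε (ratio (v x) β y) (z x)))
          (κ : Carrier) (κ≤1 : κ ≤ 1#) (-κ≤1 : - κ ≤ 1#)
          (parts : List Part)
          (parts-integral : ∀ h → sum (λ x → (c x * z x) * h x) ≈ ∑ᴸ (λ P → Part.integral P h) parts)
          where

          private
            ν : Vector Carrier m
            ν x = c x * z x
            M = sum ν

            module _ (P : Part) where
              open Part P
              s = sum weight
              0<s : 0# < s
              0<s = sum-pos weight-pos
              r = recip s 0<s

              vertices : Vector (Exponent n) (suc size)
              vertices i = v (label i)

              circuit-coeffs : Vector Carrier (suc size)
              circuit-coeffs i = weight i * u (label i)

              zu≈1 : ∀ i → z (label i) * u (label i) ≈ 1#
              zu≈1 i = zu≈1-on-support (label i) (label-Q i)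

              toSummand : Summand ℝ f
              toSummand = record
                { β   = β
                ; Δ   = record { dim = size ; vertex = vertices ; affinelyIndependent = independent }
                ; β∈Γ = β∈Γ
                ; Δ∈  = ((λ i → r * weight i) , (λ i → *-pos (recip-pos 0<s) (weight-pos i)) ,
                         trans (sym (*-distribˡ-sum r weight)) (recip-inverseˡ 0<s) ,
                         λ j → trans (balanced-scale vertices weight β r balanced j)
                           (trans (*-congʳ (trans (sym (*-distribˡ-sum r weight)) (recip-inverseˡ 0<s))) (*-identityˡ _))) ,
                        λ i → v-Λ (label i)
                ; c   = circuit-coeffs
                -- As |κ| ≤ 1, AM-GM with total weight s permits this inner coefficient. The masses
                -- s add up to M, and these coefficients to M κ.
                ; d   = s * κ
                }

              toSummand-positive : PositiveCircuit toSummand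
              toSummand-positive = 0<circuit-coeffs , form-nonneg⇐ circuit-coeffs vertices β (s * κ)
                (bound-everywhere vertices weight circuit-coeffs β s (s * κ) (λ i → proj₁ (proj₂ (v-Λ (label i)))) weight-pos balanced
                  (λ i → <⇒≤ (0<circuit-coeffs i))
                  (scaled-≤ κ≤1)
                  (≤-trans (≤-reflexive (solve 2 (λ s k → :- (s :* k) := s :* :- k) refl s κ)) (scaled-≤ -κ≤1))
                  (recentred-AM-GM vertices {β = β} (λ i → <⇒≤ (weight-pos i)) balanced (λ i → 0≤u (label i)) zu≈1
                    (λ ε 0<ε → proj₁ (near ε 0<ε) , λ i → proj₂ (near ε 0<ε) (label i))))
                where
                0<circuit-coeffs : ∀ i → 0# < circuit-coeffs i
                0<circuit-coeffs i = *-pos (weight-pos i) (inverse-pos (label-Q i) (zu≈1 i))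
                scaled-≤ : ∀ {e} → e ≤ 1# → s * e ≤ s
                scaled-≤ e≤1 = ≤-trans (*-monoˡ-≤ (<⇒≤ 0<s) e≤1) (≤-reflexive (*-identityʳ s))

              toSummand-integral : ∀ h → ⟪ Summand.poly toSummand , h ⟫ ≈
                integral (λ x → u x * h (v x)) + integral (λ _ → 1#) * - (κ * h β)
              toSummand-integral h = trans (form-integral circuit-coeffs vertices β (s * κ) h)
                (+-cong (sum-cong-≋ (λ i → *-assoc (weight i) (u (label i)) (h (vertices i))))
                  (trans (solve 3 (λ s k h → :- ((s :* k) :* h) := s :* :- (k :* h)) refl s κ (h β))
                    (*-congʳ (sum-cong-≋ (λ i → sym (*-identityʳ (weight i)))))))

            -- The terms at which the minimiser vanishes take part in no circuit.
            leftover : Vector Carrier m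
            leftover x = c x * (1# - z x * u x)

            leftover-nonneg : ∀ x → 0# ≤ leftover x
            leftover-nonneg x = *-nonneg (<⇒≤ (0<c x))
              ([ (λ zu≈1 → ≤-reflexive (sym (trans (+-congˡ (-‿cong zu≈1)) (-‿inverseʳ 1#)))) ,
                 (λ zu≈0 → ≤-trans 0≤1 (≤-reflexive (sym (trans (+-congˡ (-‿cong zu≈0))
                   (solve 0 (con (1 , 0) :- con (0 , 0) := con (1 , 0)) refl))))) ]′
                (zu≈1⊎zu≈0 x))

            residue = prune (tabulate (λ x → leftover x , v x)) (All.tabulate⁺ (λ x → leftover-nonneg x , λ _ → v-Λ x))

            circuits-integral : ∀ h → ⟪ concat (map Summand.poly (map toSummand parts)) , h ⟫ ≈
              sum (λ x → ν x * (u x * h (v x))) + M * - (κ * h β)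
            circuits-integral h = begin
              ⟪ concat (map Summand.poly (map toSummand parts)) , h ⟫
                ≈⟨ integral-concat (map Summand.poly (map toSummand parts)) h ⟩
              ∑ᴸ (λ q → ⟪ q , h ⟫) (map Summand.poly (map toSummand parts))
                ≈⟨ trans (∑ᴸ-map (λ q → ⟪ q , h ⟫) Summand.poly (map toSummand parts)) (∑ᴸ-map (λ s → ⟪ Summand.poly s , h ⟫) toSummand parts) ⟩
              ∑ᴸ (λ P → ⟪ Summand.poly (toSummand P) , h ⟫) parts
                ≈⟨ ∑ᴸ-cong (λ P → toSummand-integral P h) parts ⟩
              ∑ᴸ (λ P → Part.integral P (λ x → u x * h (v x)) + Part.integral P (λ _ → 1#) * k) parts
                ≈⟨ ∑ᴸ-+ (λ P → Part.integral P (λ x → u x * h (v x))) (λ P → Part.integral P (λ _ → 1#) * k) parts ⟩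
              ∑ᴸ (λ P → Part.integral P (λ x → u x * h (v x))) parts + ∑ᴸ (λ P → Part.integral P (λ _ → 1#) * k) parts
                ≈⟨ +-cong (sym (parts-integral (λ x → u x * h (v x))))
                     (trans (∑ᴸ-cong (λ P → *-comm _ k) parts) (trans (sym (*-distribˡ-∑ᴸ k _ parts)) (*-comm k _))) ⟩
              sum (λ x → ν x * (u x * h (v x))) + ∑ᴸ (λ P → Part.integral P (λ _ → 1#)) parts * k
                ≈⟨ +-congˡ (*-congʳ (trans (sym (parts-integral (λ _ → 1#))) (sum-cong-≋ (λ x → *-identityʳ (ν x))))) ⟩
              sum (λ x → ν x * (u x * h (v x))) + M * k ∎
              where
              open ≈-Reasoning
              k = - (κ * h β)

            -- The identity c = (c z) u + c (1 - z u) splits each square into its share in the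
            -- circuits and the leftover.
            total-integral : ∀ h → ⟪ vertices-and-inner c v β (M * κ) , h ⟫ ≈ ⟪ concat (map Summand.poly (map toSummand parts)) ++ proj₁ residue , h ⟫
            total-integral h = begin
              ⟪ vertices-and-inner c v β (M * κ) , h ⟫
                ≈⟨ form-integral c v β (M * κ) h ⟩
              sum (λ x → c x * h (v x)) - (M * κ) * h β
                ≈⟨ +-congʳ (sum-cong-≋ (λ x → solve 4 (λ c z u h → c :* h := (c :* z) :* (u :* h) :+ (c :* (con (1 , 0) :- z :* u)) :* h) refl
                     (c x) (z x) (u x) (h (v x)))) ⟩
              sum (λ x → ν x * (u x * h (v x)) + leftover x * h (v x)) - (M * κ) * h β
                ≈⟨ +-congʳ (∑-distrib-+ (λ x → ν x * (u x * h (v x))) (λ x → leftover x * h (v x))) ⟩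
              (sum (λ x → ν x * (u x * h (v x))) + sum (λ x → leftover x * h (v x))) - (M * κ) * h β
                ≈⟨ solve 5 (λ a b M k h → (a :+ b) :- (M :* k) :* h := (a :+ M :* :- (k :* h)) :+ b) refl
                     (sum (λ x → ν x * (u x * h (v x)))) (sum (λ x → leftover x * h (v x))) M κ (h β) ⟩
              (sum (λ x → ν x * (u x * h (v x))) + M * - (κ * h β)) + sum (λ x → leftover x * h (v x))
                ≈⟨ +-cong (circuits-integral h) (trans (sym (integral-cong {p = tabulate (λ x → leftover x , v x)} {proj₁ residue} (proj₂ (proj₂ residue)) h))
                     (tabulate-integral leftover v h)) ⟨
              ⟪ concat (map Summand.poly (map toSummand parts)) , h ⟫ + ⟪ proj₁ residue , h ⟫
                ≈⟨ ∑ᴸ-++ _ (concat (map Summand.poly (map toSummand parts))) (proj₁ residue) ⟨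
              ⟪ concat (map Summand.poly (map toSummand parts)) ++ proj₁ residue , h ⟫ ∎
              where open ≈-Reasoning

          decomposition : Decomposed (vertices-and-inner c v β (M * κ))
          decomposition = map toSummand parts , proj₁ residue ,
            All.map⁺ (All.universal toSummand-positive parts) , proj₁ (proj₂ residue) ,
            λ α → trans (coeff-as-integral (vertices-and-inner c v β (M * κ)) α) (trans (total-integral (indicator α))
              (sym (coeff-as-integral (concat (map Summand.poly (map toSummand parts)) ++ proj₁ residue) α)))

      -- In the applications D is |d|. The value M at the minimiser is at least D > 0, so κ = d / M
      -- exists and has absolute value at most 1. The coefficient M κ agrees with d only up to
      -- `_≈_`, hence d′.
      decompose-form : ∀ c d D → (∀ x → 0# < c x) → 0# < D → d ≤ D → - d ≤ D →
        ClosureMinimiser v c β D → Σ[ d′ ∈ Carrier ] d′ ≈ d × Decomposed (vertices-and-inner c v β d′)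
      decompose-form c d D 0<c 0<D d≤D -d≤D optimum = M * κ , M*κ≈d ,
        FromParts.decomposition z c (λ x → proj₁ (pseudo-inverse (z x))) 0<c
          (λ x → proj₁ (proj₂ (pseudo-inverse (z x))))
          (λ x → proj₁ (proj₂ (proj₂ (pseudo-inverse (z x)))))
          (λ x → proj₂ (proj₂ (proj₂ (pseudo-inverse (z x)))))
          approximate κ (scaled-≤1 d≤D)
          (≤-trans (≤-reflexive (solve 2 (λ d r → :- (d :* r) := :- d :* r) refl d (recip M 0<M))) (scaled-≤1 -d≤D))
          (proj₁ parts) (proj₂ parts)
        where
        open ClosureMinimiser optimum using (approximate; bound; minimal) renaming (minimiser to z; nonneg to 0≤z)

        ν : Vector Carrier m
        ν x = c x * z x
        0≤ν : ∀ x → 0# ≤ ν x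
        0≤ν x = *-nonneg (<⇒≤ (0<c x)) (0≤z x)

        ν-pos⇒z-pos : ∀ x → 0# < ν x → 0# < z x
        ν-pos⇒z-pos x 0<νx with 0≤⇒0<⊎≈0 (0≤z x)
        ... | inj₁ 0<z = 0<z
        ... | inj₂ z≈0 = contradiction (trans (*-congˡ z≈0) (zeroʳ _)) (pos⇒≉0 0<νx)

        M = sum ν
        0<M : 0# < M
        0<M = <-≤-trans 0<D bound

        κ = d * recip M 0<M

        open Carathéodory v (λ x → 0# < z x) β

        M*κ≈d : M * κ ≈ d
        M*κ≈d = trans (solve 3 (λ M d r → M :* (d :* r) := d :* (M :* r)) refl M d (recip M 0<M))
          (trans (*-congˡ (recip-inverseʳ 0<M)) (*-identityʳ d))

        scaled-≤1 : ∀ {e} → e ≤ D → e * recip M 0<M ≤ 1#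
        scaled-≤1 e≤D = ≤-trans (*-monoʳ-≤ (<⇒≤ (recip-pos 0<M)) (≤-trans e≤D bound)) (≤-reflexive (recip-inverseʳ 0<M))

        parts : Decomposition (λ x → x) ν
        parts = decompose (λ x → x) ν 0≤ν (minimal-at-one⇒balanced v ν β 0≤ν minimal) ν-pos⇒z-pos

      -- A negative d occurs only if β is not even, and then the reflection of a coordinate supplies
      -- the bound with - d.
      decompose-nonnegative-form : ∀ c d → (∀ x → 0# < c x) → ¬ d ≈ 0# → (IsEven β → 0# ≤ d) →
        Nonnegative ℝ (vertices-and-inner c v β d) → Σ[ d′ ∈ Carrier ] d′ ≈ d × Decomposed (vertices-and-inner c v β d′)
      decompose-nonnegative-form c d 0<c d≉0 even⇒0≤d nonneg = by-sign (total 0# d)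
        where
        optimum : ∀ D → (∀ x → D * monomial ℝ β x ≤ sum (λ i → c i * monomial ℝ (v i) x)) → ClosureMinimiser v c β D
        optimum D D-bound = closure-minimiser v c β D 0<c (positive-monomials⇒ v c β D (λ x _ → D-bound x))

        0<-d : d ≤ 0# → 0# < - d
        0<-d d≤0 = neg-nonneg d≤0 , λ 0≈-d → d≉0 (trans (solve 1 (λ x → x := :- (:- x)) refl d)
          (trans (-‿cong (sym 0≈-d)) (solve 0 (:- con (0 , 0) := con (0 , 0)) refl)))

        by-sign : 0# ≤ d ⊎ d ≤ 0# → Σ[ d′ ∈ Carrier ] d′ ≈ d × Decomposed (vertices-and-inner c v β d′)
        by-sign (inj₁ 0≤d) = decompose-form c d d 0<c (0≤d , λ 0≈d → d≉0 (sym 0≈d)) ≤-refl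
                         (≤-trans (neg-nonpos 0≤d) 0≤d) (optimum d (form-nonneg⇒ c v β d nonneg))
        by-sign (inj₂ d≤0) = decompose-form c d (- d) 0<c (0<-d d≤0) (≤-trans d≤0 (<⇒≤ (0<-d d≤0))) ≤-refl
                         (optimum (- d) (flipped-bound v c β d (λ x → proj₁ (proj₂ (v-Λ x)))
                           (λ even → d≉0 (antisym d≤0 (even⇒0≤d even))) (form-nonneg⇒ c v β d nonneg)))

    Decomposed-resp : ∀ p q → _≋_ ℝ p q → Decomposed q → Decomposed p
    Decomposed-resp p q p≋q (ss , es , ss-positive , es-Λ , q≋) = ss , es , ss-positive , es-Λ , λ α → trans (p≋q α) (q≋ α)

    module _ {β : Exponent n} (β∈Γ : Γ ℝ f β) (p : Polynomial ℝ n) (age : AGE β p)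
             (off-Λ : ∀ α → ¬ α ≡ β → Supp ℝ p α → Λ ℝ f α) (p[β]≈f[β] : coeff ℝ p β ≈ coeff ℝ f β) where

      private
        Vertex : Exponent n → Set
        Vertex α = ¬ α ≡ β × 0# < coeff ℝ p α

        U = filter (λ α → em {Vertex α}) (exponents p)

        U! : Unique U
        U! = Unique.filter⁺ (λ α → em {Vertex α}) (exponents-unique p)

        U-properties : ∀ {α} → α ∈ U → Vertex α
        U-properties α∈U = proj₂ (∈-filter⁻ (λ α → em {Vertex α}) {xs = exponents p} α∈U)

        v : Vector (Exponent n) (List.length U)
        v = List.lookup U

        c : Vector Carrier (List.length U)
        c x = coeff ℝ p (v x)

        0<c : ∀ x → 0# < c x
        0<c x = proj₂ (U-properties (∈-lookup x))

        v-Λ : ∀ x → Λ ℝ f (v x)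
        v-Λ x = off-Λ (v x) (proj₁ (U-properties (∈-lookup x))) (pos⇒≉0 (0<c x))

        outside : ∀ {α} → ¬ α ≡ β → α ∉ U → coeff ℝ p α ≈ 0#
        outside {α} α≢β α∉U with 0≤⇒0<⊎≈0 (off-nonneg age α α≢β)
        ... | inj₂ p[α]≈0 = p[α]≈0
        ... | inj₁ 0<p[α] = contradiction
          (∈-filter⁺ (λ α → em {Vertex α}) (supp⊆exponents p (pos⇒≉0 0<p[α])) (α≢β , 0<p[α])) α∉U

        tabulate-terms : tabulate (λ x → c x , v x) ≡ terms (coeff ℝ p) U
        tabulate-terms = ≡.trans (≡.sym (List.map-tabulate (List.lookup U) (λ α → coeff ℝ p α , α)))
          (≡.cong (terms (coeff ℝ p)) (List.tabulate-lookup U))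

        p≋form : ∀ d → d ≈ - coeff ℝ p β → _≋_ ℝ p (vertices-and-inner c v β d)
        p≋form d d≈ α = trans (go α) (sym (trans (coeff-++ (tabulate (λ x → c x , v x)) [ (- d , β) ] α)
            (+-congʳ (reflexive (≡.cong (λ q → coeff ℝ q α) tabulate-terms)))))
          where
          go : ∀ α → coeff ℝ p α ≈ coeff ℝ (terms (coeff ℝ p) U) α + coeff ℝ [ (- d , β) ] α
          go α with α ≟ᵉ β
          ... | yes ≡.refl = sym (trans
            (+-cong (coeff-terms-∉ (coeff ℝ p) (λ β∈U → proj₁ (U-properties β∈U) ≡.refl)) (coeff-here (- d) β []))
            (trans (+-congˡ (+-congʳ (-‿cong d≈))) (solve 1 (λ x → con (0 , 0) :+ (:- (:- x) :+ con (0 , 0)) := x) refl (coeff ℝ p β))))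
          ... | no α≢β with em {α ∈ U}
          ...   | yes α∈U = sym (trans (+-cong (coeff-terms-∈ (coeff ℝ p) U! α∈U) (coeff-there (- d) {β} [] (λ { ≡.refl → α≢β ≡.refl }))) (+-identityʳ _))
          ...   | no α∉U = trans (outside α≢β α∉U) (sym (trans
            (+-cong (coeff-terms-∉ (coeff ℝ p) α∉U) (coeff-there (- d) {β} [] (λ { ≡.refl → α≢β ≡.refl }))) (+-identityʳ _)))

        -p[β]≉0 : ¬ - coeff ℝ p β ≈ 0#
        -p[β]≉0 eq = proj₁ β∈Γ (trans (sym p[β]≈f[β]) (trans (solve 1 (λ x → x := :- (:- x)) refl (coeff ℝ p β))
          (trans (-‿cong eq) (solve 0 (:- con (0 , 0) := con (0 , 0)) refl))))

        even⇒0≤-p[β] : IsEven β → 0# ≤ - coeff ℝ p β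
        even⇒0≤-p[β] even = neg-nonneg (≮⇒≥ λ 0<p[β] → proj₂ β∈Γ (proj₁ β∈Γ , even , <-respʳ p[β]≈f[β] 0<p[β]))

      decompose-circuits : Decomposed p
      decompose-circuits =
        let form = vertices-and-inner c v β (- coeff ℝ p β)
            (d , d≈ , decomposed) = decompose-nonnegative-form β∈Γ v v-Λ c (- coeff ℝ p β) 0<c -p[β]≉0 even⇒0≤-p[β]
              (λ x → ≤-trans (nonneg age x) (≤-reflexive (eval-cong {p = p} {form} (p≋form (- coeff ℝ p β) refl) x)))
        in Decomposed-resp p (vertices-and-inner c v β d) (p≋form d d≈) decomposed

  -- Elimination of exponents

  ∑ᴸ-nonneg : ∀ {A : Set} (g : A → Carrier) xs → (∀ {x} → x ∈ xs → 0# ≤ g x) → 0# ≤ ∑ᴸ g xs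
  ∑ᴸ-nonneg g []       0≤g = ≤-refl
  ∑ᴸ-nonneg g (x ∷ xs) 0≤g = +-nonneg (0≤g (here ≡.refl)) (∑ᴸ-nonneg g xs (λ x∈xs → 0≤g (there x∈xs)))

  term≤∑ᴸ : ∀ {A : Set} (g : A → Carrier) xs → (∀ {x} → x ∈ xs → 0# ≤ g x) → ∀ {x} → x ∈ xs → g x ≤ ∑ᴸ g xs
  term≤∑ᴸ g (x ∷ xs) 0≤g (here ≡.refl) = ≤-by-gap _ (∑ᴸ-nonneg g xs (λ x∈xs → 0≤g (there x∈xs))) refl
  term≤∑ᴸ g (x ∷ xs) 0≤g (there y∈xs) = ≤-trans (term≤∑ᴸ g xs (λ x∈xs → 0≤g (there x∈xs)) y∈xs)
    (≤-by-gap _ (0≤g (here ≡.refl)) (+-comm _ _))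

  -- The entry k is silenced in g′ instead of being removed from the list, so that all sums keep
  -- running over the same list.
  ∑ᴸ-split : ∀ {A : Set} {g g′ : A → Carrier} {k xs} → Unique xs → k ∈ xs → g′ k ≈ 0# → (∀ x → ¬ x ≡ k → g′ x ≈ g x) →
    ∑ᴸ g xs ≈ g k + ∑ᴸ g′ xs
  ∑ᴸ-split {g = g} {g′} {xs = k ∷ xs} (k≢xs ∷ _) (here ≡.refl) g′k≈0 g′≈g = +-congˡ (trans
    (∑ᴸ-cong-∈ xs (λ {x} x∈xs → sym (g′≈g x (λ { ≡.refl → All.lookup k≢xs x∈xs ≡.refl }))))
    (sym (trans (+-congʳ g′k≈0) (+-identityˡ _))))
  ∑ᴸ-split {g = g} {g′} {k} {x ∷ xs} (x≢xs ∷ xs!) (there k∈xs) g′k≈0 g′≈g = trans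
    (+-cong (sym (g′≈g x (λ { ≡.refl → All.lookup x≢xs k∈xs ≡.refl }))) (∑ᴸ-split {g = g} {g′} xs! k∈xs g′k≈0 g′≈g))
    (solve 3 (λ a b c → a :+ (b :+ c) := b :+ (a :+ c)) refl (g′ x) (g k) (∑ᴸ g′ xs))

  override : ∀ {n} {A : Set} → Exponent n → A → (Exponent n → A) → Exponent n → A
  override k x g β with β ≟ᵉ k
  ... | yes _ = x
  ... | no  _ = g β

  override-at : ∀ {n} {A : Set} (k : Exponent n) {x : A} {g : Exponent n → A} → override k x g k ≡ x
  override-at k with k ≟ᵉ k
  ... | yes _   = ≡.refl
  ... | no  k≢k = contradiction ≡.refl k≢k

  override-off : ∀ {n} {A : Set} {k β : Exponent n} {x : A} {g : Exponent n → A} → ¬ β ≡ k → override k x g β ≡ g β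
  override-off {k = k} {β} β≢k with β ≟ᵉ k
  ... | yes β≡k = contradiction β≡k β≢k
  ... | no  _   = ≡.refl

  AGE-++ : ∀ {n} {β : Exponent n} p q → AGE β p → AGE β q → AGE β (p ++ q)
  AGE-++ p q age-p age-q = record
    { off-nonneg = λ α α≢β → ≤-trans (+-nonneg (off-nonneg age-p α α≢β) (off-nonneg age-q α α≢β)) (≤-reflexive (sym (coeff-++ p q α)))
    ; off-odd    = λ α α≢β odd → trans (coeff-++ p q α) (trans (+-cong (off-odd age-p α α≢β odd) (off-odd age-q α α≢β odd)) (+-identityˡ _))
    ; nonneg     = λ x → ≤-trans (+-nonneg (nonneg age-p x) (nonneg age-q x)) (≤-reflexive (sym (eval-++ p q x)))
    }

  AGE-[] : ∀ {n} (β : Exponent n) → AGE β []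
  AGE-[] β = record { off-nonneg = λ _ _ → ≤-refl ; off-odd = λ _ _ _ → refl ; nonneg = λ _ → ≤-refl }

  nonnegative-circuit-AGE : ∀ {n} (p : Polynomial ℝ n) → IsNonnegativeCircuit ℝ p → ∃[ β ] AGE β p
  nonnegative-circuit-AGE {n} p ((𝒜 , c , β , d , trellis , 0<c , _ , p≋form) , nonneg) = β , record
    { off-nonneg = λ α α≢β → ≤-trans (vertices-nonneg α (tabulate term) (All.tabulate⁺ {f = term} (λ i → <⇒≤ (0<c i)))) (≤-reflexive (sym (off-coeff α α≢β)))
    ; off-odd    = λ α α≢β odd → trans (off-coeff α α≢β) (vertices-odd α odd (tabulate term) (All.tabulate⁺ {f = term} trellis))
    ; nonneg     = nonneg
    }
    where
    term : Fin (suc (Simplex.dim 𝒜)) → Carrier × Exponent n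
    term i = c i , Simplex.vertex 𝒜 i

    off-coeff : ∀ α → ¬ α ≡ β → coeff ℝ p α ≈ coeff ℝ (tabulate term) α
    off-coeff α α≢β = trans (p≋form α) (trans (coeff-++ (tabulate term) [ (- d , β) ] α)
      (trans (+-congˡ (coeff-there (- d) {β} [] (λ { ≡.refl → α≢β ≡.refl }))) (+-identityʳ _)))

    vertices-nonneg : ∀ α (q : Polynomial ℝ n) → All (λ (a , _) → 0# ≤ a) q → 0# ≤ coeff ℝ q α
    vertices-nonneg α []            []            = ≤-refl
    vertices-nonneg α ((a , γ) ∷ q) (0≤a ∷ 0≤q) with γ ≟ᵉ α
    ... | yes _ = +-nonneg 0≤a (vertices-nonneg α q 0≤q)
    ... | no  _ = vertices-nonneg α q 0≤q

    vertices-odd : ∀ α → ¬ IsEven α → (q : Polynomial ℝ n) → All (λ (_ , γ) → IsEven γ) q → coeff ℝ q α ≈ 0#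
    vertices-odd α odd []            []              = refl
    vertices-odd α odd ((a , γ) ∷ q) (even ∷ even-q) with γ ≟ᵉ α
    ... | yes ≡.refl = contradiction even odd
    ... | no  _      = vertices-odd α odd q even-q

  -- Quantifying over B spares the induction from deciding whether the inner exponent of a new
  -- circuit is already listed.
  Gathered : ∀ {n} → Polynomial ℝ n → Set
  Gathered {n} f = Σ[ βs ∈ List (Exponent n) ] Σ[ G ∈ (Exponent n → Polynomial ℝ n) ]
    (∀ β → AGE β (G β)) ×
    (∀ {B} → Unique B → (∀ {β} → β ∈ βs → β ∈ B) → ∀ α → coeff ℝ f α ≈ ∑ᴸ (λ β → coeff ℝ (G β) α) B)

  gather : ∀ {n} (ps : List (Polynomial ℝ n)) → All (IsNonnegativeCircuit ℝ) ps → Gathered (concat ps)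
  gather []       []               = [] , (λ _ → []) , AGE-[] , λ {B} _ _ α → sym (∑ᴸ-zero _ B (λ _ → refl))
  gather {n} (p ∷ ps) (circuit ∷ circuits) with gather ps circuits
  ... | βs , G , G-AGE , G-total = β₀ ∷ βs , (λ β → piece β ++ G β) , (λ β → AGE-++ (piece β) (G β) (piece-AGE β) (G-AGE β)) ,
      λ {B} B! βs⊆B α → begin
        coeff ℝ (p ++ concat ps) α
          ≈⟨ coeff-++ p (concat ps) α ⟩
        coeff ℝ p α + coeff ℝ (concat ps) α
          ≈⟨ +-cong (sym (trans (∑ᴸ-split {g = λ β → coeff ℝ (piece β) α} {λ _ → 0#} B! (βs⊆B (here ≡.refl)) refl
               (λ β β≢β₀ → sym (reflexive (≡.cong (λ q → coeff ℝ q α) (override-off {x = p} {λ _ → []} β≢β₀)))))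
               (trans (+-cong (reflexive (≡.cong (λ q → coeff ℝ q α) (override-at β₀))) (∑ᴸ-zero _ B (λ _ → refl))) (+-identityʳ _))))
               (G-total B! (λ β∈βs → βs⊆B (there β∈βs)) α) ⟩
        ∑ᴸ (λ β → coeff ℝ (piece β) α) B + ∑ᴸ (λ β → coeff ℝ (G β) α) B
          ≈⟨ ∑ᴸ-+ _ _ B ⟨
        ∑ᴸ (λ β → coeff ℝ (piece β) α + coeff ℝ (G β) α) B
          ≈⟨ ∑ᴸ-cong (λ β → coeff-++ (piece β) (G β) α) B ⟨
        ∑ᴸ (λ β → coeff ℝ (piece β ++ G β) α) B ∎
    where
    open ≈-Reasoning
    β₀ = proj₁ (nonnegative-circuit-AGE p circuit)

    piece : Exponent n → Polynomial ℝ n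
    piece = override β₀ p (λ _ → [])

    piece-AGE : ∀ β → AGE β (piece β)
    piece-AGE β with β ≟ᵉ β₀
    ... | yes ≡.refl = proj₂ (nonnegative-circuit-AGE p circuit)
    ... | no  _      = AGE-[] β

  module Elimination {n} (f : Polynomial ℝ n) {B : List (Exponent n)} (B! : Unique B) where

    record Family (G : Exponent n → Polynomial ℝ n) : Set where
      field
        age   : ∀ β → AGE β (G β)
        total-coeff : ∀ α → coeff ℝ f α ≈ ∑ᴸ (λ β → coeff ℝ (G β) α) B

    open Family

    -- An exponent in Λ(f) may stay a vertex, and only G k has to lose its negative term; any other
    -- exponent must leave all other members. Members outside B do not enter the total, so nothing
    -- is asked of them.
    record Processed (k : Exponent n) (G : Exponent n → Polynomial ℝ n) : Set where
      field
        inner-nonneg : Λ ℝ f k → 0# ≤ coeff ℝ (G k) k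
        not-vertex   : ¬ Λ ℝ f k → ∀ {β} → β ∈ B → ¬ β ≡ k → coeff ℝ (G β) k ≈ 0#

    open Processed

    even∉Λ⇒nonpos : ∀ {k} → ¬ Λ ℝ f k → IsEven k → coeff ℝ f k ≤ 0#
    even∉Λ⇒nonpos k∉Λ even = ≮⇒≥ λ 0<f[k] → k∉Λ (pos⇒≉0 0<f[k] , even , 0<f[k])

    -- For even k the coefficients at k are nonnegative and add up to f_k ≤ 0, so each is zero
    -- without any shift. For k outside B the hypothesis on G k is vacuous.
    nonneg-inner⇒not-vertex : ∀ {G k} → Family G → (k ∈ B → 0# ≤ coeff ℝ (G k) k) →
      ¬ Λ ℝ f k → ∀ {β} → β ∈ B → ¬ β ≡ k → coeff ℝ (G β) k ≈ 0#
    nonneg-inner⇒not-vertex {G} {k} family inner k∉Λ {β} β∈B β≢k with em {IsEven k}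
    ... | no  odd  = off-odd (age family β) k (λ k≡β → β≢k (≡.sym k≡β)) odd
    ... | yes even = antisym
      (≤-trans (term≤∑ᴸ (λ γ → coeff ℝ (G γ) k) B coeff-nonneg β∈B)
        (≤-trans (≤-reflexive (sym (total-coeff family k))) (even∉Λ⇒nonpos k∉Λ even)))
      (coeff-nonneg β∈B)
      where
      coeff-nonneg : ∀ {γ} → γ ∈ B → 0# ≤ coeff ℝ (G γ) k
      coeff-nonneg {γ} γ∈B with k ≟ᵉ γ
      ... | yes ≡.refl = inner γ∈B
      ... | no  k≢γ    = off-nonneg (age family γ) k k≢γ

    -- A multiple of G k is added to the members using k as a vertex, so as to
    -- cancel k there, or to use up G k, whichever comes first.
    module Step {G : Exponent n → Polynomial ℝ n} (family : Family G) {k : Exponent n} (k∈B : k ∈ B)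
                (a<0 : coeff ℝ (G k) k < 0#) where

      a = coeff ℝ (G k) k

      b : Exponent n → Carrier
      b = override k 0# (λ β → coeff ℝ (G β) k)

      b-at : b k ≈ 0#
      b-at = reflexive (override-at k)

      b-off : ∀ β → ¬ β ≡ k → b β ≈ coeff ℝ (G β) k
      b-off β β≢k = reflexive (override-off β≢k)

      b-nonneg : ∀ β → 0# ≤ b β
      b-nonneg β with β ≟ᵉ k
      ... | yes _   = ≤-refl
      ... | no  β≢k = off-nonneg (age family β) k (λ k≡β → β≢k (≡.sym k≡β))

      S = ∑ᴸ b B

      f[k]≈a+S : coeff ℝ f k ≈ a + S
      f[k]≈a+S = trans (total-coeff family k) (∑ᴸ-split B! k∈B b-at b-off)

      0<-a : 0# < - a
      0<-a = <-respʳ (+-identityˡ (- a)) (gap-pos a<0)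

      -- The multiplier 1 / max (S , - a) is the largest r for which both 1 - r S, the share of G k
      -- that remains, and 1 + r a, the factor of the coefficients at k, are nonnegative; one of
      -- them becomes zero.
      maximum : ∃[ M ] S ≤ M × - a ≤ M × (M ≈ S ⊎ M ≈ - a)
      maximum with total S (- a)
      ... | inj₁ S≤-a = - a , S≤-a , ≤-refl , inj₂ refl
      ... | inj₂ -a≤S = S , ≤-refl , -a≤S , inj₁ refl

      M = proj₁ maximum
      S≤M = proj₁ (proj₂ maximum)
      -a≤M = proj₁ (proj₂ (proj₂ maximum))
      0<M = <-≤-trans 0<-a -a≤M
      r = recip M 0<M
      0≤r = <⇒≤ (recip-pos 0<M)

      -- G k pays for what the other members receive: the entries over B add up to 0, which
      -- preserves the total.
      τ : Exponent n → Carrier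
      τ = override k (- (r * S)) (λ β → r * b β)

      τ-at : τ k ≈ - (r * S)
      τ-at = reflexive (override-at k)

      τ-off : ∀ β → ¬ β ≡ k → τ β ≈ r * b β
      τ-off β β≢k = reflexive (override-off β≢k)

      τ-sum : ∑ᴸ τ B ≈ 0#
      τ-sum = trans (∑ᴸ-split {g′ = λ β → r * b β} B! k∈B (trans (*-congˡ b-at) (zeroʳ r)) (λ β β≢k → sym (τ-off β β≢k)))
        (trans (+-cong τ-at (sym (*-distribˡ-∑ᴸ r b B))) (-‿inverseˡ (r * S)))

      rS≤1 : r * S ≤ 1#
      rS≤1 = ≤-trans (*-monoˡ-≤ 0≤r S≤M) (≤-reflexive (recip-inverseˡ 0<M))

      -ra≤1 : 0# ≤ 1# + r * a
      -ra≤1 = ≤-trans (gap-nonneg (≤-trans (*-monoˡ-≤ 0≤r -a≤M) (≤-reflexive (recip-inverseˡ 0<M))))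
        (≤-reflexive (solve 2 (λ r a → con (1 , 0) :- r :* :- a := con (1 , 0) :+ r :* a) refl r a))

      G′ : Exponent n → Polynomial ℝ n
      G′ β = G β ++ scaleᴾ (τ β) (G k)

      coeff-G′ : ∀ β α → coeff ℝ (G′ β) α ≈ coeff ℝ (G β) α + τ β * coeff ℝ (G k) α
      coeff-G′ β α = trans (coeff-++ (G β) _ α) (+-congˡ (coeff-scaleᴾ (τ β) (G k) α))

      eval-G′ : ∀ β x → eval ℝ (G′ β) x ≈ eval ℝ (G β) x + τ β * eval ℝ (G k) x
      eval-G′ β x = trans (eval-++ (G β) _ x) (+-congˡ (eval-scaleᴾ (τ β) (G k) x))

      remaining : ∀ y → y + τ k * y ≈ (1# - r * S) * y
      remaining y = trans (+-congˡ (*-congʳ τ-at)) (solve 2 (λ t y → y :+ :- t :* y := (con (1 , 0) :- t) :* y) refl (r * S) y)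

      coeff-at-k : ∀ β → ¬ β ≡ k → coeff ℝ (G′ β) k ≈ b β * (1# + r * a)
      coeff-at-k β β≢k = trans (coeff-G′ β k) (trans (+-cong (sym (b-off β β≢k)) (*-congʳ (τ-off β β≢k)))
        (solve 3 (λ b r a → b :+ (r :* b) :* a := b :* (con (1 , 0) :+ r :* a)) refl (b β) r a))

      off-τ-nonneg : ∀ β → ¬ β ≡ k → 0# ≤ τ β
      off-τ-nonneg β β≢k = ≤-trans (*-nonneg 0≤r (b-nonneg β)) (≤-reflexive (sym (τ-off β β≢k)))

      age′ : ∀ β → AGE β (G′ β)
      age′ β = by-cases (β ≟ᵉ k)
        where
        by-cases : Dec (β ≡ k) → AGE β (G′ β)
        by-cases (yes ≡.refl) = record
          { off-nonneg = λ α α≢k → ≤-trans (*-nonneg (gap-nonneg rS≤1) (off-nonneg (age family k) α α≢k))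
              (≤-reflexive (sym (trans (coeff-G′ k α) (remaining _))))
          ; off-odd    = λ α α≢k odd → trans (coeff-G′ k α) (trans (remaining _)
              (trans (*-congˡ (off-odd (age family k) α α≢k odd)) (zeroʳ _)))
          ; nonneg     = λ x → ≤-trans (*-nonneg (gap-nonneg rS≤1) (nonneg (age family k) x))
              (≤-reflexive (sym (trans (eval-G′ k x) (remaining _))))
          }
        by-cases (no β≢k) = record
          { off-nonneg = off-nonneg′
          ; off-odd    = off-odd′
          ; nonneg     = λ x → ≤-trans (+-nonneg (nonneg (age family β) x) (*-nonneg (off-τ-nonneg β β≢k) (nonneg (age family k) x)))
              (≤-reflexive (sym (eval-G′ β x)))
          }
          where
          off-nonneg′ : ∀ α → ¬ α ≡ β → 0# ≤ coeff ℝ (G′ β) α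
          off-nonneg′ α α≢β = at (α ≟ᵉ k)
            where
            at : Dec (α ≡ k) → 0# ≤ coeff ℝ (G′ β) α
            at (yes ≡.refl) = ≤-trans (*-nonneg (b-nonneg β) -ra≤1) (≤-reflexive (sym (coeff-at-k β β≢k)))
            at (no α≢k) = ≤-trans (+-nonneg (off-nonneg (age family β) α α≢β)
                  (*-nonneg (off-τ-nonneg β β≢k) (off-nonneg (age family k) α α≢k)))
                (≤-reflexive (sym (coeff-G′ β α)))

          off-odd′ : ∀ α → ¬ α ≡ β → ¬ IsEven α → coeff ℝ (G′ β) α ≈ 0#
          off-odd′ α α≢β odd = at (α ≟ᵉ k)
            where
            at : Dec (α ≡ k) → coeff ℝ (G′ β) α ≈ 0#
            at (yes ≡.refl) = trans (coeff-at-k β β≢k)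
                (trans (*-congʳ (trans (b-off β β≢k) (off-odd (age family β) k α≢β odd))) (zeroˡ _))
            at (no α≢k) = trans (coeff-G′ β α)
                (trans (+-cong (off-odd (age family β) α α≢β odd) (trans (*-congˡ (off-odd (age family k) α α≢k odd)) (zeroʳ _))) (+-identityˡ _))

      family′ : Family G′
      family′ = record
        { age         = age′
        ; total-coeff = λ α → begin
            coeff ℝ f α
              ≈⟨ total-coeff family α ⟩
            ∑ᴸ (λ β → coeff ℝ (G β) α) B
              ≈⟨ trans (+-congˡ (trans (*-congˡ τ-sum) (zeroʳ _))) (+-identityʳ _) ⟨
            ∑ᴸ (λ β → coeff ℝ (G β) α) B + coeff ℝ (G k) α * ∑ᴸ τ B
              ≈⟨ +-congˡ (*-distribˡ-∑ᴸ (coeff ℝ (G k) α) τ B) ⟩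
            ∑ᴸ (λ β → coeff ℝ (G β) α) B + ∑ᴸ (λ β → coeff ℝ (G k) α * τ β) B
              ≈⟨ ∑ᴸ-+ _ _ B ⟨
            ∑ᴸ (λ β → coeff ℝ (G β) α + coeff ℝ (G k) α * τ β) B
              ≈⟨ ∑ᴸ-cong (λ β → trans (coeff-G′ β α) (+-congˡ (*-comm _ _))) B ⟨
            ∑ᴸ (λ β → coeff ℝ (G′ β) α) B ∎
        }
        where open ≈-Reasoning

      processed : Processed k G′
      processed = record
        { inner-nonneg = λ k∈Λ → ≤-reflexive (sym (trans (trans (coeff-G′ k k) (remaining a)) (trans (*-congʳ (exhausted k∈Λ)) (zeroˡ a))))
        ; not-vertex   = not-vertex′
        }
        where
        exhausted : Λ ℝ f k → 1# - r * S ≈ 0#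
        exhausted (_ , _ , 0<f[k]) with proj₂ (proj₂ (proj₂ maximum))
        ... | inj₁ M≈S  = trans (+-congˡ (-‿cong (trans (*-congˡ (sym M≈S)) (recip-inverseˡ 0<M)))) (-‿inverseʳ 1#)
        -- In this case S ≤ - a, and f_k = a + S could not be positive.
        ... | inj₂ M≈-a = contradiction
          (≤-trans (+-mono-≤ (≤-refl {a}) (≤-trans S≤M (≤-reflexive M≈-a))) (≤-reflexive (-‿inverseʳ a)))
          (<⇒≱ (<-respʳ f[k]≈a+S 0<f[k]))

        not-vertex′ : ¬ Λ ℝ f k → ∀ {β} → β ∈ B → ¬ β ≡ k → coeff ℝ (G′ β) k ≈ 0#
        not-vertex′ k∉Λ {β} β∈B β≢k with em {IsEven k}
        ... | no  odd  = off-odd (age′ β) k (λ k≡β → β≢k (≡.sym k≡β)) odd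
        ... | yes even = trans (coeff-at-k β β≢k) (trans (*-congˡ 1+ra≈0) (zeroʳ _))
          where
          S≤-a : S ≤ - a
          S≤-a = ≤-trans (≤-reflexive (solve 2 (λ a s → s := (a :+ s) :+ :- a) refl a S))
            (≤-trans (+-monoˡ-≤ _ _ (- a) (≤-trans (≤-reflexive (sym f[k]≈a+S)) (even∉Λ⇒nonpos k∉Λ even))) (≤-reflexive (+-identityˡ (- a))))
          -a≈M : - a ≈ M
          -a≈M = antisym -a≤M ([ (λ M≈S → ≤-trans (≤-reflexive M≈S) S≤-a) , ≤-reflexive ]′ (proj₂ (proj₂ (proj₂ maximum))))
          1+ra≈0 : 1# + r * a ≈ 0#
          1+ra≈0 = trans (solve 2 (λ r a → con (1 , 0) :+ r :* a := con (1 , 0) :- r :* (:- a)) refl r a)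
            (trans (+-congˡ (-‿cong (trans (*-congˡ -a≈M) (recip-inverseˡ 0<M)))) (-‿inverseʳ 1#))

      -- For k′ in Λ(f), a nonnegative multiple of a nonnegative coefficient is added to G k′ at k′.
      -- For other k′, G k itself is free of k′ and cannot bring it back.
      still-processed : ∀ {k′} → ¬ k′ ≡ k → Processed k′ G → Processed k′ G′
      still-processed {k′} k′≢k old = record
        { inner-nonneg = λ k′∈Λ → ≤-trans (+-nonneg (inner-nonneg old k′∈Λ)
            (*-nonneg (off-τ-nonneg k′ k′≢k) (off-nonneg (age family k) k′ k′≢k))) (≤-reflexive (sym (coeff-G′ k′ k′)))
        ; not-vertex   = λ k′∉Λ {β} β∈B β≢k′ → trans (coeff-G′ β k′) (trans
            (+-cong (not-vertex old k′∉Λ β∈B β≢k′)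
              (trans (*-congˡ (not-vertex old k′∉Λ k∈B (λ k≡k′ → k′≢k (≡.sym k≡k′)))) (zeroʳ _)))
            (+-identityˡ _))
        }

    process : ∀ {G} → Family G → ∀ {k} → k ∈ B →
      Σ[ G′ ∈ (Exponent n → Polynomial ℝ n) ] Family G′ × Processed k G′ × (∀ {k′} → ¬ k′ ≡ k → Processed k′ G → Processed k′ G′)
    process {G} family {k} k∈B with em {0# ≤ coeff ℝ (G k) k}
    ... | yes 0≤a = G , family , record
            { inner-nonneg = λ _ → 0≤a
            ; not-vertex   = nonneg-inner⇒not-vertex family (λ _ → 0≤a)
            } , λ _ old → old
    ... | no  0≰a = G′ , family′ , processed , still-processed
      where open Step family k∈B (≰⇒> 0≰a)

    process-all : ∀ {G} → Family G → ∀ ks → (∀ {k} → k ∈ ks → k ∈ B) →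
      Σ[ G′ ∈ (Exponent n → Polynomial ℝ n) ] Family G′ × (∀ {k} → k ∈ ks → Processed k G′)
    process-all {G} family []       ks⊆B = G , family , λ ()
    process-all {G} family (k ∷ ks) ks⊆B with process-all family ks (λ k∈ks → ks⊆B (there k∈ks))
    ... | G₁ , family₁ , processed₁ with process family₁ (ks⊆B (here ≡.refl))
    ...   | G₂ , family₂ , processed-k , still-processed = G₂ , family₂ , all-processed
      where
      all-processed : ∀ {k′} → k′ ∈ k ∷ ks → Processed k′ G₂
      all-processed (here ≡.refl) = processed-k
      all-processed {k′} (there k′∈ks) with k′ ≟ᵉ k
      ... | yes ≡.refl = processed-k
      ... | no  k′≢k   = still-processed k′≢k (processed₁ k′∈ks)

    module _ {G : Exponent n → Polynomial ℝ n} (family : Family G) (processed : ∀ {k} → k ∈ B → Processed k G) where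

      off-inner⊆Λ : ∀ {β} → β ∈ B → ∀ α → ¬ α ≡ β → Supp ℝ (G β) α → Λ ℝ f α
      off-inner⊆Λ {β} β∈B α α≢β G[α]≉0 with em {Λ ℝ f α}
      ... | yes α∈Λ = α∈Λ
      ... | no  α∉Λ with em {α ∈ B}
      ...   | yes α∈B = contradiction (not-vertex (processed α∈B) α∉Λ β∈B (λ β≡α → α≢β (≡.sym β≡α))) G[α]≉0
      ...   | no  α∉B = contradiction
                (nonneg-inner⇒not-vertex family (λ α∈B → contradiction α∈B α∉B) α∉Λ β∈B (λ β≡α → α≢β (≡.sym β≡α))) G[α]≉0

      -- All other members are free of β, so G β alone accounts for f_β; a nonzero coefficient there
      -- places β in Γ(f).
      inner-coeff : ∀ {β} → β ∈ B → ¬ Λ ℝ f β → coeff ℝ (G β) β ≈ coeff ℝ f β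
      inner-coeff {β} β∈B β∉Λ = sym (begin
        coeff ℝ f β                               ≈⟨ total-coeff family β ⟩
        ∑ᴸ (λ γ → coeff ℝ (G γ) β) B              ≈⟨ ∑ᴸ-cong-∈ B concentrated ⟩
        ∑ᴸ at-β B                                 ≈⟨ ∑ᴸ-split {g = at-β} {λ _ → 0#} B! β∈B refl (λ γ γ≢β → sym (reflexive (override-off γ≢β))) ⟩
        at-β β + ∑ᴸ (λ _ → 0#) B                  ≈⟨ +-cong (reflexive (override-at β)) (∑ᴸ-zero _ B (λ _ → refl)) ⟩
        coeff ℝ (G β) β + 0#                      ≈⟨ +-identityʳ _ ⟩
        coeff ℝ (G β) β                           ∎)
        where
        open ≈-Reasoning
        at-β : Exponent n → Carrier
        at-β = override β (coeff ℝ (G β) β) (λ _ → 0#)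
        concentrated : ∀ {γ} → γ ∈ B → coeff ℝ (G γ) β ≈ at-β γ
        concentrated {γ} γ∈B with γ ≟ᵉ β
        ... | yes ≡.refl = refl
        ... | no  γ≢β    = not-vertex (processed β∈B) β∉Λ γ∈B γ≢β

      decompose-member : ∀ {β} → β ∈ B → Decomposed f (G β)
      decompose-member {β} β∈B with em {Λ ℝ f β}
      ... | yes β∈Λ = decompose-monomials f (G β) coeff-nonneg supp⊆Λ
        where
        coeff-nonneg : ∀ α → 0# ≤ coeff ℝ (G β) α
        coeff-nonneg α with α ≟ᵉ β
        ... | yes ≡.refl = inner-nonneg (processed β∈B) β∈Λ
        ... | no  α≢β    = off-nonneg (age family β) α α≢β
        supp⊆Λ : ∀ α → Supp ℝ (G β) α → Λ ℝ f α
        supp⊆Λ α G[α]≉0 with α ≟ᵉ β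
        ... | yes ≡.refl = β∈Λ
        ... | no  α≢β    = off-inner⊆Λ β∈B α α≢β G[α]≉0
      ... | no β∉Λ with em {coeff ℝ (G β) β ≈ 0#}
      ...   | no  G[β]≉0 = decompose-circuits f ((λ f[β]≈0 → G[β]≉0 (trans (inner-coeff β∈B β∉Λ) f[β]≈0)) , β∉Λ)
                (G β) (age family β) (off-inner⊆Λ β∈B) (inner-coeff β∈B β∉Λ)
      ...   | yes G[β]≈0 = decompose-monomials f (G β) coeff-nonneg supp⊆Λ
        where
        coeff-nonneg : ∀ α → 0# ≤ coeff ℝ (G β) α
        coeff-nonneg α with α ≟ᵉ β
        ... | yes ≡.refl = ≤-reflexive (sym G[β]≈0)
        ... | no  α≢β    = off-nonneg (age family β) α α≢β
        supp⊆Λ : ∀ α → Supp ℝ (G β) α → Λ ℝ f α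
        supp⊆Λ α G[α]≉0 with α ≟ᵉ β
        ... | yes ≡.refl = contradiction G[β]≈0 G[α]≉0
        ... | no  α≢β    = off-inner⊆Λ β∈B α α≢β G[α]≉0

  -- Adding up the decomposed members

  Decomposed-++ : ∀ {n} (f p q : Polynomial ℝ n) → Decomposed f p → Decomposed f q → Decomposed f (p ++ q)
  Decomposed-++ f p q (ss , es , ss-positive , es-Λ , p≋) (ss′ , es′ , ss′-positive , es′-Λ , q≋) =
    ss ++ ss′ , es ++ es′ , All.++⁺ ss-positive ss′-positive , All.++⁺ es-Λ es′-Λ , λ α → begin
      coeff ℝ (p ++ q) α
        ≈⟨ trans (coeff-++ p q α) (+-cong (trans (p≋ α) (coeff-++ P es α)) (trans (q≋ α) (coeff-++ Q es′ α))) ⟩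
      (coeff ℝ P α + coeff ℝ es α) + (coeff ℝ Q α + coeff ℝ es′ α)
        ≈⟨ solve 4 (λ a b c d → (a :+ b) :+ (c :+ d) := (a :+ c) :+ (b :+ d)) refl _ _ _ _ ⟩
      (coeff ℝ P α + coeff ℝ Q α) + (coeff ℝ es α + coeff ℝ es′ α)
        ≈⟨ +-cong (coeff-++ P Q α) (coeff-++ es es′ α) ⟨
      coeff ℝ (P ++ Q) α + coeff ℝ (es ++ es′) α
        ≡⟨ ≡.cong (λ r → coeff ℝ r α + coeff ℝ (es ++ es′) α) (≡.sym
             (≡.trans (≡.cong concat (List.map-++ Summand.poly ss ss′)) (≡.sym (List.concat-++ (map Summand.poly ss) (map Summand.poly ss′))))) ⟩
      coeff ℝ (concat (map Summand.poly (ss ++ ss′))) α + coeff ℝ (es ++ es′) α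
        ≈⟨ coeff-++ (concat (map Summand.poly (ss ++ ss′))) (es ++ es′) α ⟨
      coeff ℝ (concat (map Summand.poly (ss ++ ss′)) ++ (es ++ es′)) α ∎
    where
    open ≈-Reasoning
    P = concat (map Summand.poly ss)
    Q = concat (map Summand.poly ss′)

  Decomposed-concat : ∀ {n} (f : Polynomial ℝ n) (G : Exponent n → Polynomial ℝ n) B → (∀ {β} → β ∈ B → Decomposed f (G β)) →
    Decomposed f (concat (map G B))
  Decomposed-concat f G []      decomposed = [] , [] , [] , [] , λ α → refl
  Decomposed-concat f G (β ∷ B) decomposed = Decomposed-++ f (G β) (concat (map G B)) (decomposed (here ≡.refl))
    (Decomposed-concat f G B (λ β∈B → decomposed (there β∈B)))

  coeff-concat-map : ∀ {n} {A : Set} (G : A → Polynomial ℝ n) xs α → coeff ℝ (concat (map G xs)) α ≈ ∑ᴸ (λ x → coeff ℝ (G x) α) xs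
  coeff-concat-map G []       α = refl
  coeff-concat-map G (x ∷ xs) α = trans (coeff-++ (G x) (concat (map G xs)) α) (+-congˡ (coeff-concat-map G xs α))

  SONC⇒Decomposed : ∀ {n} (f : Polynomial ℝ n) → SONC ℝ f → Decomposed f f
  SONC⇒Decomposed {n} f (ps , circuits , f≋) =
    let (βs , G , G-AGE , G-total) = gather ps circuits
        B = List.deduplicate _≟ᵉ_ βs
        B! = Unique.deduplicate-! _≟ᵉ_ βs
        open Elimination f B!
        family : Family G
        family = record { age = G-AGE ; total-coeff = λ α → trans (f≋ α) (G-total B! (∈-deduplicate⁺ _≟ᵉ_) α) }
        (G′ , family′ , processed) = process-all family B (λ k∈B → k∈B)
    in Decomposed-resp f f (concat (map G′ B))
         (λ α → trans (Family.total-coeff family′ α) (sym (coeff-concat-map G′ B α)))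
         (Decomposed-concat f G′ B (decompose-member family′ processed))

  -- Collecting circuits with the same simplex

  sum-single : ∀ {m} {g : Vector Carrier m} j → (∀ i → ¬ i ≡ j → g i ≈ 0#) → sum g ≈ g j
  sum-single zero    g≈0 = trans (+-congˡ (sum-zero (λ i → g≈0 (suc i) λ ()))) (+-identityʳ _)
  sum-single (suc j) g≈0 = trans (+-cong (g≈0 zero λ ())
    (sum-single j (λ i i≢j → g≈0 (suc i) λ { ≡.refl → i≢j ≡.refl }))) (+-identityˡ _)

  -- If two vertices coincide, the difference of their unit weights is an affine dependence.
  affinely-independent⇒injective : ∀ {n m} {v : Vector (Exponent n) m} → AffinelyIndependent ℝ v → ∀ i j → v i ≡ v j → i ≡ j
  affinely-independent⇒injective {m = m} {v} independent i j vi≡vj with i ≟ᶠ j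
  ... | yes i≡j = i≡j
  ... | no  i≢j = contradiction (trans (sym μi≈1) (independent μ sum-μ dot-μ i)) 1≉0
    where
    δ : Fin m → Vector Carrier m
    δ k l with l ≟ᶠ k
    ... | yes _ = 1#
    ... | no  _ = 0#
    δ-at : ∀ k → δ k k ≈ 1#
    δ-at k with k ≟ᶠ k
    ... | yes _   = refl
    ... | no  k≢k = contradiction ≡.refl k≢k
    δ-off : ∀ {k l} → ¬ l ≡ k → δ k l ≈ 0#
    δ-off {k} {l} l≢k with l ≟ᶠ k
    ... | yes l≡k = contradiction l≡k l≢k
    ... | no  _   = refl
    μ : Vector Carrier m
    μ l = δ i l - δ j l
    δ-sum : ∀ k (g : Vector Carrier m) → sum (λ l → δ k l * g l) ≈ g k
    δ-sum k g = trans (sum-single k (λ l l≢k → trans (*-congʳ (δ-off l≢k)) (zeroˡ _))) (trans (*-congʳ (δ-at k)) (*-identityˡ _))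
    μ-sum : ∀ (g : Vector Carrier m) → sum (λ l → μ l * g l) ≈ g i - g j
    μ-sum g = trans (sum-cong-≋ (λ l → solve 3 (λ a b g → (a :- b) :* g := a :* g :- b :* g) refl (δ i l) (δ j l) (g l)))
      (trans (sum-difference (λ l → δ i l * g l) (λ l → δ j l * g l)) (+-cong (δ-sum i g) (-‿cong (δ-sum j g))))
    sum-μ : sum μ ≈ 0#
    sum-μ = trans (sum-cong-≋ (λ l → sym (*-identityʳ (μ l)))) (trans (μ-sum (λ _ → 1#)) (-‿inverseʳ 1#))
    dot-μ : ∀ k → sum (λ l → μ l * fromℕ (lookup (v l) k)) ≈ 0#
    dot-μ k = trans (μ-sum (λ l → fromℕ (lookup (v l) k)))
      (trans (+-congʳ (reflexive (≡.cong (λ α → fromℕ (lookup α k)) vi≡vj))) (-‿inverseʳ _))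
    μi≈1 : μ i ≈ 1#
    μi≈1 = trans (+-cong (δ-at i) (-‿cong (δ-off i≢j))) (solve 0 (con (1 , 0) :- con (0 , 0) := con (1 , 0)) refl)

  coeff-tabulate-∉ : ∀ {n m} (c : Vector Carrier m) (v : Vector (Exponent n) m) {α} → (∀ i → ¬ v i ≡ α) →
    coeff ℝ (tabulate (λ i → c i , v i)) α ≈ 0#
  coeff-tabulate-∉ {m = zero}  c v v≢α = refl
  coeff-tabulate-∉ {m = suc m} c v v≢α = trans (coeff-there (c zero) {v zero} _ (v≢α zero))
    (coeff-tabulate-∉ (λ i → c (suc i)) (λ i → v (suc i)) (λ i → v≢α (suc i)))

  coeff-tabulate-∈ : ∀ {n m} (c : Vector Carrier m) (v : Vector (Exponent n) m) → (∀ i j → v i ≡ v j → i ≡ j) → ∀ j →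
    coeff ℝ (tabulate (λ i → c i , v i)) (v j) ≈ c j
  coeff-tabulate-∈ c v injective zero = trans (coeff-here (c zero) (v zero) _) (trans
    (+-congˡ (coeff-tabulate-∉ (λ i → c (suc i)) (λ i → v (suc i)) (λ i eq → contradiction (injective (suc i) zero eq) λ ())))
    (+-identityʳ _))
  coeff-tabulate-∈ c v injective (suc j) = trans
    (coeff-there (c zero) {v zero} _ (λ eq → contradiction (injective zero (suc j) eq) λ ()))
    (coeff-tabulate-∈ (λ i → c (suc i)) (λ i → v (suc i)) (λ i k eq → suc-injective (injective (suc i) (suc k) eq)) j)

  module _ {n m} {v : Vector (Exponent n) m} {β : Exponent n}
           (injective : ∀ i j → v i ≡ v j → i ≡ j) (v≢β : ∀ i → ¬ v i ≡ β) where

    form-coeff-vertex : ∀ c d i → coeff ℝ (vertices-and-inner c v β d) (v i) ≈ c i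
    form-coeff-vertex c d i = trans (coeff-++ (tabulate (λ i → c i , v i)) [ (- d , β) ] (v i))
      (trans (+-cong (coeff-tabulate-∈ c v injective i) (coeff-there (- d) {β} [] (λ β≡v → v≢β i (≡.sym β≡v)))) (+-identityʳ _))

    form-coeff-inner : ∀ c d → coeff ℝ (vertices-and-inner c v β d) β ≈ - d
    form-coeff-inner c d = trans (coeff-++ (tabulate (λ i → c i , v i)) [ (- d , β) ] β)
      (trans (+-cong (coeff-tabulate-∉ c v v≢β) (coeff-here (- d) β [])) (trans (+-identityˡ _) (+-identityʳ _)))

    form-coeff-other : ∀ c d α → (∀ i → ¬ v i ≡ α) → ¬ α ≡ β → coeff ℝ (vertices-and-inner c v β d) α ≈ 0#
    form-coeff-other c d α v≢α α≢β = trans (coeff-++ (tabulate (λ i → c i , v i)) [ (- d , β) ] α)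
      (trans (+-cong (coeff-tabulate-∉ c v v≢α) (coeff-there (- d) {β} [] (λ β≡α → α≢β (≡.sym β≡α)))) (+-identityʳ _))

    supported-form : ∀ p → (∀ α → (∀ i → ¬ v i ≡ α) → ¬ α ≡ β → coeff ℝ p α ≈ 0#) →
      _≋_ ℝ (vertices-and-inner (λ i → coeff ℝ p (v i)) v β (- coeff ℝ p β)) p
    supported-form p other≈0 α with em {∃[ i ] v i ≡ α}
    ... | yes (i , ≡.refl) = form-coeff-vertex _ _ i
    ... | no  α∉V = by-cases (α ≟ᵉ β)
      where
      by-cases : Dec (α ≡ β) → _
      by-cases (yes ≡.refl) = trans (form-coeff-inner _ _) (solve 1 (λ x → :- (:- x) := x) refl (coeff ℝ p β))
      by-cases (no α≢β)     = trans (form-coeff-other _ _ α (λ i vi≡α → α∉V (i , vi≡α)) α≢β)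
        (sym (other≈0 α (λ i vi≡α → α∉V (i , vi≡α)) α≢β))

  -- 0 = 1 - 1, with the simplex {0}.
  zero-circuit : ∀ {n} (p : Polynomial ℝ n) → (∀ α → coeff ℝ p α ≈ 0#) → IsCircuitPolynomial ℝ p
  zero-circuit {n} p p≋0 = origin , (λ _ → 1#) , replicate n 0 , 1# , (λ _ → even) , (λ _ → 0<1) ,
      ((λ _ → 1#) , (λ _ → 0<1) , +-identityʳ 1# , λ j → trans (+-identityʳ _) (*-identityˡ _)) ,
      λ α → trans (p≋0 α) (sym (cancels α))
    where
    origin : Simplex ℝ n
    origin = record { dim = 0 ; vertex = λ _ → replicate n 0 ; affinelyIndependent = λ { μ sum≈0 _ zero → trans (sym (+-identityʳ _)) sum≈0 } }
    even : IsEven (replicate n 0)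
    even = VecAll.lookup⁻ (λ j → ≡.subst (2 ∣_) (≡.sym (Vec.lookup-replicate j 0)) (2 ∣0))
    cancels : ∀ α → coeff ℝ (circuitForm ℝ origin (λ _ → 1#) (replicate n 0) 1#) α ≈ 0#
    cancels α with em {replicate n 0 ≡ α}
    ... | yes ≡.refl = trans (coeff-here 1# (replicate n 0) [ (- 1# , replicate n 0) ]) (trans (+-congˡ (trans (coeff-here (- 1#) (replicate n 0) []) (+-identityʳ _))) (-‿inverseʳ 1#))
    ... | no  0≢α    = trans (coeff-there 1# {replicate n 0} [ (- 1# , replicate n 0) ] 0≢α) (coeff-there (- 1#) {replicate n 0} [] 0≢α)

  -- Enumerating and grouping finite lists

  powerset : ∀ {A : Set} → List A → List (List A)
  powerset []       = [ [] ]
  powerset (x ∷ xs) = map (x ∷_) (powerset xs) ++ powerset xs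

  filter∈powerset : ∀ {A : Set} {P : A → Set} (P? : ∀ x → Dec (P x)) xs → filter P? xs ∈ powerset xs
  filter∈powerset P? []       = here ≡.refl
  filter∈powerset P? (x ∷ xs) with P? x
  ... | yes _ = ∈-++⁺ˡ (∈-map⁺ (x ∷_) (filter∈powerset P? xs))
  ... | no  _ = ∈-++⁺ʳ (map (x ∷_) (powerset xs)) (filter∈powerset P? xs)

  -- An element is dropped if it is related to one already kept from the tail. R need not be
  -- symmetric: coverage is claimed only for predicates that R transports forwards.
  representatives : ∀ {A : Set} (R : A → A → Set) xs →
    Σ[ ys ∈ List A ] AllPairs (λ x y → ¬ R x y) ys ×
      (∀ (P : A → Set) → (∀ {x y} → R x y → P x → P y) → Any P xs → Any P ys)
  representatives R [] = [] , [] , λ P resp ()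
  representatives R (x ∷ xs) with representatives R xs
  ... | ys , ys-distinct , covers with em {Any (R x) ys}
  ...   | yes Rx = ys , ys-distinct , λ { P resp (here Px) → Any.map (λ Rxy → resp Rxy Px) Rx ; P resp (there Pxs) → covers P resp Pxs }
  ...   | no ¬Rx = x ∷ ys , All.¬Any⇒All¬ ys ¬Rx ∷ ys-distinct ,
            λ { P resp (here Px) → here Px ; P resp (there Pxs) → there (covers P resp Pxs) }

  when : Set → Carrier → Carrier
  when P y with em {P}
  ... | yes _ = y
  ... | no  _ = 0#

  when-false : ∀ {P : Set} {y} → ¬ P → when P y ≈ 0#
  when-false {P} ¬P with em {P}
  ... | yes p = contradiction p ¬P
  ... | no  _ = refl

  when-true : ∀ {P : Set} {y} → P → when P y ≈ y
  when-true {P} p with em {P}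
  ... | yes _  = refl
  ... | no  ¬P = contradiction p ¬P

  ∑ᴸ-exactly-once : ∀ {A : Set} (P : A → Set) y {xs} → AllPairs (λ x x′ → P x → ¬ P x′) xs → Any P xs → ∑ᴸ (λ x → when (P x) y) xs ≈ y
  ∑ᴸ-exactly-once P y {x ∷ xs} (x-only ∷ _) (here Px) = trans
    (+-cong (when-true Px) (∑ᴸ-zero _ xs (λ x′∈xs → when-false (All.lookup x-only x′∈xs Px)))) (+-identityʳ _)
  ∑ᴸ-exactly-once P y {x ∷ xs} (x-only ∷ distinct) (there Pxs) = trans
    (+-cong (when-false (λ Px → All.All¬⇒¬Any (All.map (λ only → only Px) x-only) Pxs)) (∑ᴸ-exactly-once P y distinct Pxs)) (+-identityˡ _)

  ∑ᴸ-filter : ∀ {A : Set} (P : A → Set) (g : A → Carrier) x xs →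
    ∑ᴸ g (filter (λ y → em {P y}) (x ∷ xs)) ≈ when (P x) (g x) + ∑ᴸ g (filter (λ y → em {P y}) xs)
  ∑ᴸ-filter P g x xs with em {P x}
  ... | yes _ = refl
  ... | no  _ = sym (+-identityˡ _)

  -- Every a is related to exactly one b in bs, so its term lands in exactly one block.
  ∑ᴸ-partition : ∀ {A B : Set} (R : A → B → Set) (g : A → Carrier) {bs} → (∀ {a} → AllPairs (λ b b′ → R a b → ¬ R a b′) bs) →
    (∀ a → Any (R a) bs) → ∀ as → ∑ᴸ (λ b → ∑ᴸ g (filter (λ a → em {R a b}) as)) bs ≈ ∑ᴸ g as
  ∑ᴸ-partition R g {bs} distinct covered []       = ∑ᴸ-zero _ bs (λ _ → refl)
  ∑ᴸ-partition R g {bs} distinct covered (a ∷ as) = trans (∑ᴸ-cong (λ b → ∑ᴸ-filter (λ a → R a b) g a as) bs)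
    (trans (∑ᴸ-+ _ _ bs) (+-cong (∑ᴸ-exactly-once (R a) (g a) distinct (covered a)) (∑ᴸ-partition R g distinct covered as)))

  module Assembly {n} (f : Polynomial ℝ n) where

    open Summand

    SameIndex : Summand ℝ f → Summand ℝ f → Set
    SameIndex s t = HasIndex ℝ (β s) (Δ s) t

    SameIndex-sym : ∀ {s t} → SameIndex s t → SameIndex t s
    SameIndex-sym (β≡ , Δ≐) = ≡.sym β≡ , λ α → ⇔.sym (Δ≐ α)

    HasIndex-trans : ∀ {γ Δ′ s t} → HasIndex ℝ γ Δ′ s → SameIndex s t → HasIndex ℝ γ Δ′ t
    HasIndex-trans (β≡ , Δ≐) (β≡′ , Δ≐′) = ≡.trans β≡ β≡′ , λ α → ⇔.trans (Δ≐ α) (Δ≐′ α)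

    -- Up to `_≐_` a simplex is its vertex set, here a subset of supp(f). Running through all
    -- subsets of the exponents, with excluded middle picking those that span a suitable simplex,
    -- therefore exhausts every Δ(β).
    index-list : Σ[ ss ∈ List (Summand ℝ f) ] IndexedByAllPairs ℝ ss
    index-list = proj₁ reps , proj₁ (proj₂ reps) , λ γ Δ′ γ∈Γ Δ′∈ →
        proj₂ (proj₂ reps) (HasIndex ℝ γ Δ′) (λ {s} {t} st index → HasIndex-trans {γ} {Δ′} {s} {t} index st) (covered γ Δ′ γ∈Γ Δ′∈)
      where
      E = exponents f

      Spans : Exponent n → List (Exponent n) → Set
      Spans γ A = Σ[ Δ′ ∈ Simplex ℝ n ] Γ ℝ f γ × InΔ ℝ f γ Δ′ × (∀ α → _∈V_ ℝ α Δ′ ⇔ α ∈ A)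

      candidate : ∀ γ A → Dec (Spans γ A) → List (Summand ℝ f)
      -- Only the index matters; c and d are placeholders that `merge` replaces.
      candidate γ A (yes (Δ′ , γ∈Γ , Δ′∈ , _)) = [ record { β = γ ; Δ = Δ′ ; β∈Γ = γ∈Γ ; Δ∈ = Δ′∈ ; c = λ _ → 0# ; d = 0# } ]
      candidate γ A (no _)                     = []

      candidates = concatMap (λ γ → concatMap (λ A → candidate γ A em) (powerset E)) E
      reps = representatives SameIndex candidates

      covered : ∀ γ Δ′ → Γ ℝ f γ → InΔ ℝ f γ Δ′ → Any (HasIndex ℝ γ Δ′) candidates
      covered γ Δ′ γ∈Γ Δ′∈ = Any.concatMap⁺ _ (lose (supp⊆exponents f (proj₁ γ∈Γ))
          (Any.concatMap⁺ _ (lose (filter∈powerset (λ α → em {_∈V_ ℝ α Δ′}) E) (chosen em))))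
        where
        A = filter (λ α → em {_∈V_ ℝ α Δ′}) E
        vertices : ∀ α → _∈V_ ℝ α Δ′ ⇔ α ∈ A
        vertices α = mk⇔
          (λ { (i , ≡.refl) → ∈-filter⁺ (λ α → em {_∈V_ ℝ α Δ′}) (supp⊆exponents f (proj₁ (proj₂ Δ′∈ i))) (i , ≡.refl) })
          (λ α∈A → proj₂ (∈-filter⁻ (λ α → em {_∈V_ ℝ α Δ′}) {xs = E} α∈A))
        chosen : (spans? : Dec (Spans γ A)) → Any (HasIndex ℝ γ Δ′) (candidate γ A spans?)
        chosen (yes (Δ″ , _ , _ , vertices″)) = here (≡.refl , λ α → ⇔.trans (vertices α) (⇔.sym (vertices″ α)))
        chosen (no none) = contradiction (Δ′ , γ∈Γ , Δ′∈ , vertices) none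

    module _ (s : Summand ℝ f) where

      vertices-injective : ∀ i j → Simplex.vertex (Δ s) i ≡ Simplex.vertex (Δ s) j → i ≡ j
      vertices-injective = affinely-independent⇒injective (Simplex.affinelyIndependent (Δ s))

      vertex≢inner : ∀ i → ¬ Simplex.vertex (Δ s) i ≡ β s
      vertex≢inner i eq = proj₂ (β∈Γ s) (≡.subst (Λ ℝ f) eq (proj₂ (Δ∈ s) i))

    concat-nonneg : ∀ qs → All (PositiveCircuit f) qs → Nonnegative ℝ (concat (map poly qs))
    concat-nonneg []       []                     x = ≤-refl
    concat-nonneg (q ∷ qs) ((_ , nonneg) ∷ qs-pos) x = ≤-trans (+-nonneg (nonneg x) (concat-nonneg qs qs-pos x))
      (≤-reflexive (sym (eval-++ (poly q) (concat (map poly qs)) x)))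

    -- Circuits with the same index may list their vertices in different orders, so the coefficients
    -- are read off from their sum instead of being added entrywise.
    merge : Summand ℝ f → List (Summand ℝ f) → Summand ℝ f
    merge s qs = record
      { β   = β s
      ; Δ   = Δ s
      ; β∈Γ = β∈Γ s
      ; Δ∈  = Δ∈ s
      ; c   = λ i → coeff ℝ (concat (map poly qs)) (Simplex.vertex (Δ s) i)
      ; d   = - coeff ℝ (concat (map poly qs)) (β s)
      }

    module _ (s : Summand ℝ f) where

      other-coeff≈0 : ∀ qs → All (λ q → SameIndex q s) qs → ∀ α → (∀ i → ¬ Simplex.vertex (Δ s) i ≡ α) → ¬ α ≡ β s →
        coeff ℝ (concat (map poly qs)) α ≈ 0#
      other-coeff≈0 []       []                       α α∉V α≢β = refl
      other-coeff≈0 (q ∷ qs) ((β≡ , Δ≐) ∷ qs-index) α α∉V α≢β = trans (coeff-++ (poly q) (concat (map poly qs)) α) (trans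
        (+-cong (form-coeff-other (vertices-injective q) (vertex≢inner q) (c q) (d q) α
                   (λ i vi≡α → let (j , vj≡α) = Equivalence.to (Δ≐ α) (i , vi≡α) in α∉V j vj≡α)
                   (λ α≡β → α≢β (≡.trans α≡β β≡)))
                (other-coeff≈0 qs qs-index α α∉V α≢β))
        (+-identityˡ _))

      merge≋ : ∀ qs → All (λ q → SameIndex q s) qs → _≋_ ℝ (poly (merge s qs)) (concat (map poly qs))
      merge≋ qs qs-index = supported-form (vertices-injective s) (vertex≢inner s) (concat (map poly qs)) (other-coeff≈0 qs qs-index)

      vertex-coeff-pos : ∀ q → SameIndex q s → PositiveCircuit f q → ∀ i → 0# < coeff ℝ (poly q) (Simplex.vertex (Δ s) i)
      vertex-coeff-pos q (_ , Δ≐) (0<c , _) i with Equivalence.from (Δ≐ _) (i , ≡.refl)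
      ... | j , vj≡vi = ≡.subst (λ α → 0# < coeff ℝ (poly q) α) vj≡vi
            (<-respʳ (sym (form-coeff-vertex (vertices-injective q) (vertex≢inner q) (c q) (d q) j)) (0<c j))

      vertex-coeff-nonneg : ∀ qs → All (λ q → SameIndex q s) qs → All (PositiveCircuit f) qs → ∀ i →
        0# ≤ coeff ℝ (concat (map poly qs)) (Simplex.vertex (Δ s) i)
      vertex-coeff-nonneg []       []                   []                     i = ≤-refl
      vertex-coeff-nonneg (q ∷ qs) (q-index ∷ qs-index) (q-pos ∷ qs-pos) i = ≤-trans
        (+-nonneg (<⇒≤ (vertex-coeff-pos q q-index q-pos i)) (vertex-coeff-nonneg qs qs-index qs-pos i))
        (≤-reflexive (sym (coeff-++ (poly q) (concat (map poly qs)) _)))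

      merge-is-circuit : ∀ qs → All (λ q → SameIndex q s) qs → All (PositiveCircuit f) qs → IsCircuitPolynomial ℝ (poly (merge s qs))
      -- No circuit has this index. The zero polynomial has no positive coefficients on Δ s, so its
      -- circuit form comes from another simplex.
      merge-is-circuit []         qs-index             qs-pos           = zero-circuit (poly (merge s [])) (merge≋ [] qs-index)
      merge-is-circuit (q ∷ qs) (q-index ∷ qs-index) (q-pos ∷ qs-pos) =
        Δ s , c (merge s (q ∷ qs)) , β s , d (merge s (q ∷ qs)) , (λ i → proj₁ (proj₂ (proj₂ (Δ∈ s) i))) ,
        (λ i → <-respʳ (sym (coeff-++ (poly q) (concat (map poly qs)) _))
          (+-pos-nonneg (vertex-coeff-pos q q-index q-pos i) (vertex-coeff-nonneg qs qs-index qs-pos i))) ,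
        proj₁ (Δ∈ s) , λ α → refl

      merge-nonnegative : ∀ qs → All (λ q → SameIndex q s) qs → All (PositiveCircuit f) qs → IsNonnegativeCircuit ℝ (poly (merge s qs))
      merge-nonnegative qs qs-index qs-pos = merge-is-circuit qs qs-index qs-pos , λ x → ≤-trans (concat-nonneg qs qs-pos x)
        (≤-reflexive (sym (eval-cong {p = poly (merge s qs)} {concat (map poly qs)} (merge≋ qs qs-index) x)))

    same-support : Decomposed f f → SameSupportSONC ℝ f
    same-support (qs , es , qs-pos , es-Λ , f≋) = map collect base , es ,
        -- `merge` keeps β and Δ, so the indexing of `base` carries over.
        (AllPairs.map⁺ base-distinct , λ γ Δ′ γ∈Γ Δ′∈ → Any.map⁺ (base-covers γ Δ′ γ∈Γ Δ′∈)) ,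
        All.map⁺ (All.universal (λ s → merge-nonnegative s (members s) (members-index s) (All.filter⁺ (λ q → em {SameIndex q s}) qs-pos)) base) ,
        es-Λ , λ α → begin
          coeff ℝ f α
            ≈⟨ f≋ α ⟩
          coeff ℝ (concat (map poly qs) ++ es) α
            ≈⟨ coeff-++ (concat (map poly qs)) es α ⟩
          coeff ℝ (concat (map poly qs)) α + coeff ℝ es α
            ≈⟨ +-congʳ (coeff-concat-map poly qs α) ⟩
          ∑ᴸ (λ q → coeff ℝ (poly q) α) qs + coeff ℝ es α
            ≈⟨ +-congʳ (∑ᴸ-partition SameIndex (λ q → coeff ℝ (poly q) α) {base}
                 (λ {q} → AllPairs.map (λ {s} {t} s≁t q∼s q∼t → s≁t (HasIndex-trans {β s} {Δ s} {q} {t} (SameIndex-sym {q} {s} q∼s) q∼t)) base-distinct)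
                 (λ q → base-covers (β q) (Δ q) (β∈Γ q) (Δ∈ q)) qs) ⟨
          ∑ᴸ (λ s → ∑ᴸ (λ q → coeff ℝ (poly q) α) (members s)) base + coeff ℝ es α
            ≈⟨ +-congʳ (∑ᴸ-cong (λ s → trans (merge≋ s (members s) (members-index s) α) (coeff-concat-map poly (members s) α)) base) ⟨
          ∑ᴸ (λ s → coeff ℝ (poly (collect s)) α) base + coeff ℝ es α
            ≈⟨ +-congʳ (trans (coeff-concat-map poly (map collect base) α) (∑ᴸ-map (λ s → coeff ℝ (poly s) α) collect base)) ⟨
          coeff ℝ (concat (map poly (map collect base))) α + coeff ℝ es α
            ≈⟨ coeff-++ (concat (map poly (map collect base))) es α ⟨
          coeff ℝ (concat (map poly (map collect base)) ++ es) α ∎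
      where
      open ≈-Reasoning
      base = proj₁ index-list
      base-distinct = proj₁ (proj₂ index-list)
      base-covers = proj₂ (proj₂ index-list)
      members : Summand ℝ f → List (Summand ℝ f)
      members s = filter (λ q → em {SameIndex q s}) qs
      members-index : ∀ s → All (λ q → SameIndex q s) (members s)
      members-index s = All.all-filter (λ q → em {SameIndex q s}) qs
      collect : Summand ℝ f → Summand ℝ f
      collect s = merge s (members s)

theorem4p2 : ExcludedMiddle 0ℓ →
    (ℝ : RealNumbers) (n : ℕ) (f : Polynomial ℝ n) →
    SONC ℝ f → SameSupportSONC ℝ f
theorem4p2 em ℝ n f f∈SONC = Assembly.same-support em ℝ f (SONC⇒Decomposed em ℝ f f∈SONC)
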